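{- Let $M$ be a real Hilbert space, viewed as a two-sorted structure as described in the context, of cardinality $\lambda$, such that the logical structure $(M,\mathcal R)$, with $\mathcal R$ the quantifier-free definable relations, is strongly $\lambda$-homogeneous and $\lambda$ is large enough that (P) holds with $\pi=\aleph_1$ and some uncountable $\pi'\le\lambda$. Then $(M,\mathcal R)$ is $\aleph_1$-simply stable.
   Context: The Hilbert space $H$ over $\mathbb R$ is viewed as a first-order structure with a sort $S_V$ for the vectors and a sort $S_F$ for $\mathbb R$, the inner product $\langle-,-\rangle:S_V\times S_V\to S_F$, the field operations and $<$ on $S_F$, scalar multiplication, vector addition, and a constant for each real number; $\mathcal R$ is the class of quantifier-free definable relations. Logical structure: $(M,\mathcal R)$ with $\mathcal R$ a collection of finitary relations invariant under automorphisms of $M$, closed under finite unions, intersections and coordinate permutations. For sequences $\bar a,\bar b$, $tp(\bar a/\bar b)$ is the set of all expressions $R(v_{i_1},\dots,v_{i_m},b_{j_1},\dots,b_{j_l})$, $R\in\mathcal R$, true of the corresponding entries. Strongly $\lambda$-homogeneous: for $\alpha<\lambda$, $\bar a,\bar b\in M^\alpha$ with $tp(\bar a)=tp(\bar b)$ some automorphism of $(M,\mathcal R)$ maps $\bar a$ to $\bar b$. Large type: $\ge\lambda$ realizations. $\{\bar a_i:i\in X\}$ is indiscernible over $A$ if increasing $n$-tuples have the same type over $A$. Condition (P) with cardinals $\pi\le\pi'\le\lambda$: for every type $p$ over $A$ in $<\pi$ variables, $|A|<\pi$, any sequence $X$ of realizations of $p$ of length $\ge\pi'$ yields an $A$-indiscernible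 $\{\bar b_i:i<\omega\}$ each of whose $tp(\bar b_0,\dots,\bar b_n/A)$ is realized by an increasing subsequence of $X$. "Set" means subset of $M$ of cardinality $<\pi$. A type $p(\bar v,\bar b)$ divides over $A$ if there is an infinite $A$-indiscernible $\{\bar b_i:i\in X\}$ with $tp(\bar b_i/A)=tp(\bar b/A)$ and $\bigcup_i p(\bar v,\bar b_i)$ not realized in $M$. $A$ is $\chi$-free from $B$ over $C$ if for all sequences $\bar a$ from $A$, $\bar b$ from $B\cup C$ of length $<\chi$, $tp(\bar a/\bar b)$ does not divide over $C$. A set $A$ is a $\kappa$-extension base if for every $\bar a$ of length $<\kappa$ with $tp(\bar a/A)$ large, every $B\subseteq A$ with $\bar a$ $\kappa$-free from $A$ over $B$, and every set $C\supseteq A$, some realization of $tp(\bar a/A)$ is $\kappa$-free from $C$ over $B$. $(M,\mathcal R)$ is $\kappa$-simple if (1) $\aleph_0$-freeness implies $\kappa$-freeness for all sets; (2) for every $\bar a$ of length $<\kappa$ and set $A$ some $B\subseteq A$, $|B|<\kappa$, has $\bar a$ $\kappa$-free from $A$ over $B$; (3) every set is a $\kappa$-extension base. A free extension of $p=tp(\bar a/A)$ over $B\supseteq A$ is $tp(\bar a'/B)$ for some realization $\bar a'$ of $p$ that is $\kappa$-free from $B$ over $A$. $(M,\mathcal R)$ is $\kappa$-simply stable if it is $\kappa$-simple and for some $\mu<|M|$: whenever $p$ is a complete type over $A\subseteq M$ with $|A|\le\lambda$ and $A\subseteq B\subseteq M$ with $|B|\le\mu$, there are at most $\mu$ complete types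 over $B$ which are free extensions of $p$.
   Formalization: In the definition of dividing, the infinite indiscernible family {b_i : i∈X} must have |X| < λ; with X of size λ, clause (1) fails for infinite-dimensional M. In simple stability, types have fewer than ℵ_1 variables. -}

module Defs where

open import Level using (Level; 0ℓ; _⊔_) renaming (suc to lsuc)
open import Algebra.Bundles using (CommutativeRing)
open import Algebra.Structures using (IsCommutativeRing)
open import Algebra.Module.Structures using (IsLeftModule)
open import Data.Empty using (⊥)
open import Data.Fin using (Fin; toℕ) renaming (_<_ to _<ᶠ_)
open import Data.Fin.Permutation using (Permutation′; _⟨$⟩ʳ_)
open import Data.Nat using (ℕ; suc) renaming (_<_ to _<ℕ_; _≤_ to _≤ℕ_)
open import Data.Product using (Σ; ∃; ∃-syntax; Σ-syntax; _×_; _,_; proj₁; proj₂; uncurry)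
open import Data.Sum using (_⊎_; [_,_]′)
open import Data.Sum.Function.Propositional using (_⊎-⇔_)
open import Data.Product.Function.NonDependent.Propositional using (_×-⇔_)
open import Function using (_∘_; _⇔_; _↔_; Injection; Inverse)
open import Induction.WellFounded using (WellFounded)
open import Relation.Binary using (Rel; Setoid; IsStrictTotalOrder)
import Relation.Binary.Construct.On as On
open import Relation.Binary.PropositionalEquality
  using (_≡_; _≢_; refl; cong; cong₂; subst; setoid; _→-setoid_)
open import Relation.Nullary using (¬_)
open import Relation.Unary using (Pred; _∈_; _⊆_; _≐_; _∪_; _∩_)
open import Relation.Unary.Relation.Binary.Equality using (≐-setoid)

------------------------------------------------------------------------
-- Cardinals.  A cardinal is given by any type of that cardinality, and
-- the collections to be counted (subsets, sets of sequences, sets of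
-- types) by setoids, so that a setoid is counted up to its equality.

module _ {a ℓ b ℓ′ : Level} where

  infix 4 _≼_ _≺_

  _≼_ : Setoid a ℓ → Setoid b ℓ′ → Set (a ⊔ ℓ ⊔ b ⊔ ℓ′)
  S ≼ T = Injection S T

  _≺_ : Setoid a ℓ → Setoid b ℓ′ → Set (a ⊔ ℓ ⊔ b ⊔ ℓ′)
  S ≺ T = S ≼ T × ¬ (Injection T S)

card : Set → Setoid 0ℓ 0ℓ
card A = setoid A

-- Predicates may be proof-relevant; the proofs are not counted.
restrict : ∀ {a ℓ p} (S : Setoid a ℓ) → Pred (Setoid.Carrier S) p → Setoid (a ⊔ p) ℓ
restrict S P = On.setoid S (proj₁ {B = P})

-- ℵ₁ is the least uncountable cardinal.
IsAleph₁ : Set → Set₁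
IsAleph₁ K = card ℕ ≺ card K × (∀ (I : Set) → card I ≺ card K → card I ≼ card ℕ)

------------------------------------------------------------------------
-- Logical structures.  Invariance of ℛ under automorphisms is not a
-- field: an automorphism of (M , ℛ) preserves ℛ by definition.

record LogicalStructure : Set₁ where
  field
    M              : Set
    ℛ              : ∀ {n} → Pred (Fin n → M) 0ℓ → Set
    ∪-closed       : ∀ {n} {R S : Pred (Fin n → M) 0ℓ} → ℛ R → ℛ S → ℛ (R ∪ S)
    ∩-closed       : ∀ {n} {R S : Pred (Fin n → M) 0ℓ} → ℛ R → ℛ S → ℛ (R ∩ S)
    permute-closed : ∀ {n} {R : Pred (Fin n → M) 0ℓ} (σ : Permutation′ n) →
                     ℛ R → ℛ (λ x → R (x ∘ (σ ⟨$⟩ʳ_)))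

-- Λ is the cardinal λ; "sets" are the subsets of M of cardinality < π.
module Simplicity (L : LogicalStructure) (Λ π : Set) where

  infix 4 _realizes_at_

  open LogicalStructure L public

  Subset : Set₁
  Subset = Pred M 0ℓ

  ∣_∣ : Subset → Setoid 0ℓ 0ℓ
  ∣ A ∣ = restrict (setoid M) A

  IsSet : Pred Subset 0ℓ
  IsSet A = ∣ A ∣ ≺ card π

  -- A sequence is a family indexed by an arbitrary type: the order of
  -- the index plays no role for the type of a single sequence.
  range : {I : Set} → (I → M) → Subset
  range a m = ∃[ i ] a i ≡ m

  enum : (A : Subset) → ∃ A → M
  enum A = proj₁

  -- R(v_{i₁},…,v_{iₘ},b_{j₁},…,b_{jₗ}) with v indexed by I and b by J.
  -- Parameters are recorded by index, so that a type p(v̄,b̄) can be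
  -- evaluated at another parameter sequence b̄′.
  record Expr (I J : Set) : Set₁ where
    field
      arity : ℕ
      R     : Pred (Fin arity → M) 0ℓ
      R∈ℛ   : ℛ R
      args  : Fin arity → I ⊎ J

  Type : Set → Set → Set₁
  Type I J = Pred (Expr I J) 0ℓ

  tp : {I J : Set} → (I → M) → (J → M) → Type I J
  tp a b e = R ([ a , b ]′ ∘ args) where open Expr e

  tp∅ : {I : Set} → (I → M) → Type I ⊥
  tp∅ a = tp a (λ ())

  _realizes_at_ : {I J : Set} → (I → M) → Type I J → (J → M) → Set₁
  a realizes p at b = p ⊆ tp a b

  -- Types over A have as parameters the family enum A.
  TypeOver : Set → Subset → Set₁
  TypeOver I A = Type I (∃ A)

  tp/ : {I : Set} → (I → M) → (A : Subset) → TypeOver I A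
  tp/ a A = tp a (enum A)

  IsAutomorphism : M ↔ M → Set₁
  IsAutomorphism g = ∀ {n} (R : Pred (Fin n → M) 0ℓ) → ℛ R →
                     ∀ x → R x ⇔ R (Inverse.to g ∘ x)

  StronglyHomogeneous : Set₁
  StronglyHomogeneous =
    ∀ (I : Set) → card I ≺ card Λ → (a b : I → M) → tp∅ a ≐ tp∅ b →
    Σ[ g ∈ (M ↔ M) ] IsAutomorphism g × (∀ i → Inverse.to g (a i) ≡ b i)

  Large : {I : Set} {A : Subset} → TypeOver I A → Set₁
  Large {I} {A} p = card Λ ≼ restrict (I →-setoid M) (λ a → a realizes p at enum A)

  Increasing : {X : Set} → Rel X 0ℓ → {n : ℕ} → (Fin n → X) → Set
  Increasing _<_ x = ∀ {i j} → i <ᶠ j → x i < x j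

  concat : {n : ℕ} {I : Set} → (Fin n → I → M) → Fin n × I → M
  concat = uncurry

  Indiscernible : {X I : Set} → Rel X 0ℓ → (X → I → M) → Subset → Set₁
  Indiscernible {X} _<_ b A =
    ∀ {n} (x y : Fin n → X) → Increasing _<_ x → Increasing _<_ y →
    tp/ (concat (b ∘ x)) A ≐ tp/ (concat (b ∘ y)) A

  -- Types over A are the tp(c̄/A).  Sequences are indexed by a
  -- well-ordered X; its length is ≥ the cardinal π′ iff π′ ≼ X.
  ConditionP : Set → Set₁
  ConditionP π′ =
    card π ≼ card π′ × card π′ ≼ card Λ ×
    (∀ (I : Set) → card I ≺ card π →
     ∀ (A : Subset) → IsSet A →
     ∀ (c : I → M) →
     ∀ (X : Set) (_<_ : Rel X 0ℓ) → IsStrictTotalOrder _≡_ _<_ → WellFounded _<_ →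
     card π′ ≼ card X →
     ∀ (a : X → I → M) → (∀ x → a x realizes tp/ c A at enum A) →
     Σ[ b ∈ (ℕ → I → M) ] Indiscernible _<ℕ_ b A ×
       (∀ n → Σ[ x ∈ (Fin (suc n) → X) ] Increasing _<_ x ×
         concat (a ∘ x) realizes tp/ (concat {suc n} (λ k → b (toℕ k))) A at enum A))

  -- As for all sequences of the λ-homogeneous structure, the length of
  -- an indiscernible sequence is < λ.  (Were X allowed to be as large as
  -- M, an indiscernible sequence could exhaust M and types would divide
  -- merely because no room is left to realize the union.)
  record Divides {I J : Set} (p : Type I J) (b : J → M) (A : Subset) : Set₁ where
    field
      X                  : Set
      _<_                : Rel X 0ℓ
      isStrictTotalOrder : IsStrictTotalOrder _≡_ _<_
      infinite           : card ℕ ≼ card X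
      small              : card X ≺ card Λ
      b′                 : X → J → M
      indiscernible      : Indiscernible _<_ b′ A
      same-type          : ∀ x → tp/ (b′ x) A ≐ tp/ b A
      not-realized       : ¬ (Σ[ a ∈ (I → M) ] ∀ x → a realizes p at b′ x)

  Free : Set → Subset → Subset → Subset → Set₁
  Free χ A B C =
    ∀ (I J : Set) → card I ≺ card χ → card J ≺ card χ →
    ∀ (a : I → M) (b : J → M) → (∀ i → a i ∈ A) → (∀ j → b j ∈ B ∪ C) →
    ¬ Divides (tp a b) b C

  IsExtensionBase : Set → Subset → Set₁
  IsExtensionBase κ A =
    ∀ (I : Set) → card I ≺ card κ → (a : I → M) → Large {A = A} (tp/ a A) →
    ∀ (B : Subset) → B ⊆ A → Free κ (range a) A B →
    ∀ (C : Subset) → IsSet C → A ⊆ C →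
    Σ[ a′ ∈ (I → M) ] a′ realizes tp/ a A at enum A × Free κ (range a′) C B

  record IsSimple (κ : Set) : Set₁ where
    field
      finite-character : ∀ (A B C : Subset) → IsSet A → IsSet B → IsSet C →
                         Free ℕ A B C → Free κ A B C
      local-character  : ∀ (I : Set) → card I ≺ card κ → (a : I → M) →
                         ∀ (A : Subset) → IsSet A →
                         Σ[ B ∈ Subset ] B ⊆ A × ∣ B ∣ ≺ card κ × Free κ (range a) A B
      extension-bases  : ∀ (A : Subset) → IsSet A → IsExtensionBase κ A

  IsFreeExtension : (κ : Set) {I : Set} (A : Subset) → TypeOver I A →
                    (B : Subset) → Pred (TypeOver I B) (lsuc 0ℓ)
  IsFreeExtension κ {I} A p B q =
    Σ[ a′ ∈ (I → M) ] a′ realizes p at enum A × Free κ (range a′) B A × q ≐ tp/ a′ B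

  -- The complete types over A are the tp(c̄/A); as a cardinal of stability
  -- theory, μ is infinite.
  IsSimplyStable : Set → Set₁
  IsSimplyStable κ =
    IsSimple κ ×
    (Σ[ μ ∈ Set ] card ℕ ≼ card μ × card μ ≺ card M ×
      (∀ (I : Set) → card I ≺ card κ →
       ∀ (A B : Subset) → ∣ A ∣ ≼ card Λ → A ⊆ B → ∣ B ∣ ≼ card μ →
       ∀ (c : I → M) →
       restrict (≐-setoid (Expr I (∃ B)) 0ℓ) (IsFreeExtension κ A (tp/ c A) B) ≼ card μ))

------------------------------------------------------------------------
-- ℝ, as a complete ordered field (unique up to unique isomorphism).

record CompleteOrderedField : Set₁ where
  infix  4 _<_ _≤_
  infixl 6 _+_
  infixl 7 _*_
  infix  8 -_
  infix  9 _⁻¹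
  field
    Carrier            : Set
    _<_                : Rel Carrier 0ℓ
    _+_ _*_            : Carrier → Carrier → Carrier
    -_ _⁻¹             : Carrier → Carrier
    0# 1#              : Carrier
    isCommutativeRing  : IsCommutativeRing _≡_ _+_ _*_ -_ 0# 1#
    0≢1                : 0# ≢ 1#
    ⁻¹-inverse         : ∀ x → x ≢ 0# → x * x ⁻¹ ≡ 1#
    0⁻¹                : 0# ⁻¹ ≡ 0#
    isStrictTotalOrder : IsStrictTotalOrder _≡_ _<_
    +-monoʳ-<          : ∀ x {y z} → y < z → x + y < x + z
    *-pos              : ∀ {x y} → 0# < x → 0# < y → 0# < x * y

  _≤_ : Rel Carrier 0ℓ
  x ≤ y = x < y ⊎ x ≡ y

  UpperBound : Pred Carrier 0ℓ → Pred Carrier 0ℓ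
  UpperBound P u = ∀ x → P x → x ≤ u

  field
    supremum : (P : Pred Carrier 0ℓ) → ∃ P → ∃ (UpperBound P) →
               Σ[ s ∈ Carrier ] UpperBound P s × (∀ u → UpperBound P u → s ≤ u)

  commutativeRing : CommutativeRing 0ℓ 0ℓ
  commutativeRing = record { isCommutativeRing = isCommutativeRing }

  open CommutativeRing commutativeRing public using (ring)

record HilbertSpace (ℝ : CompleteOrderedField) : Set₁ where
  private module ℝ = CompleteOrderedField ℝ
  infixl 6 _+_ _-_
  infixr 7 _•_
  infix  8 -_
  field
    V            : Set
    _+_          : V → V → V
    0ⱽ           : V
    -_           : V → V
    _•_          : ℝ.Carrier → V → V
    isLeftModule : IsLeftModule ℝ.ring _≡_ _+_ 0ⱽ -_ _•_
    ⟨_,_⟩        : V → V → ℝ.Carrier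
    ⟨⟩-sym       : ∀ u v → ⟨ u , v ⟩ ≡ ⟨ v , u ⟩
    ⟨⟩-+         : ∀ u v w → ⟨ u + v , w ⟩ ≡ ⟨ u , w ⟩ ℝ.+ ⟨ v , w ⟩
    ⟨⟩-•         : ∀ r u v → ⟨ r • u , v ⟩ ≡ r ℝ.* ⟨ u , v ⟩
    ⟨⟩-pos       : ∀ v → v ≢ 0ⱽ → ℝ.0# ℝ.< ⟨ v , v ⟩

  _-_ : V → V → V
  u - v = u + (- v)

  -- ‖ u - v ‖ < ε, for ε > 0
  Within : ℝ.Carrier → V → V → Set
  Within ε u v = ⟨ u - v , u - v ⟩ ℝ.< ε ℝ.* ε

  Cauchy : (ℕ → V) → Set
  Cauchy x = ∀ ε → ℝ.0# ℝ.< ε → ∃[ N ] ∀ m n → N ≤ℕ m → N ≤ℕ n → Within ε (x m) (x n)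

  _⟶_ : (ℕ → V) → V → Set
  x ⟶ l = ∀ ε → ℝ.0# ℝ.< ε → ∃[ N ] ∀ n → N ≤ℕ n → Within ε (x n) l

  field
    complete : ∀ x → Cauchy x → ∃[ l ] x ⟶ l

------------------------------------------------------------------------
-- The two-sorted structure of a Hilbert space.

data Sort : Set where
  SV SF : Sort

module TwoSorted {ℝ : CompleteOrderedField} (H : HilbertSpace ℝ) where

  private
    module ℝ = CompleteOrderedField ℝ
    module H = HilbertSpace H

  infix  4 _⊨_
  infixr 5 _∧ᵗ_ _∨ᵗ_
  infix  6 ¬ᵗ_ _≈ᵗ_ _<ᵗ_
  infixl 7 _+ᶠ_ _+ⱽ_
  infixl 8 _*ᶠ_
  infixr 8 _•ⱽ_
  infix  9 -ᶠ_
  infix  10 _⁻¹ᶠ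

  ⟦_⟧ˢ : Sort → Set
  ⟦ SV ⟧ˢ = H.V
  ⟦ SF ⟧ˢ = ℝ.Carrier

  data Term {n : ℕ} (s : Fin n → Sort) : Sort → Set where
    var     : (i : Fin n) → Term s (s i)
    const   : ℝ.Carrier → Term s SF
    _+ᶠ_    : Term s SF → Term s SF → Term s SF
    _*ᶠ_    : Term s SF → Term s SF → Term s SF
    -ᶠ_     : Term s SF → Term s SF
    _⁻¹ᶠ    : Term s SF → Term s SF
    ⟨_,_⟩ᶠ  : Term s SV → Term s SV → Term s SF
    _+ⱽ_    : Term s SV → Term s SV → Term s SV
    _•ⱽ_    : Term s SF → Term s SV → Term s SV

  data QF {n : ℕ} (s : Fin n → Sort) : Set where
    _≈ᵗ_ : {σ : Sort} → Term s σ → Term s σ → QF s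
    _<ᵗ_ : Term s SF → Term s SF → QF s
    ¬ᵗ_  : QF s → QF s
    _∧ᵗ_ : QF s → QF s → QF s
    _∨ᵗ_ : QF s → QF s → QF s

  Env : {n : ℕ} → (Fin n → Sort) → Set
  Env s = ∀ i → ⟦ s i ⟧ˢ

  eval : {n : ℕ} {s : Fin n → Sort} {σ : Sort} → Term s σ → Env s → ⟦ σ ⟧ˢ
  eval (var i)      x = x i
  eval (const r)    x = r
  eval (t +ᶠ u)     x = eval t x ℝ.+ eval u x
  eval (t *ᶠ u)     x = eval t x ℝ.* eval u x
  eval (-ᶠ t)       x = ℝ.- eval t x
  eval (t ⁻¹ᶠ)      x = eval t x ℝ.⁻¹
  eval ⟨ t , u ⟩ᶠ   x = H.⟨ eval t x , eval u x ⟩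
  eval (t +ⱽ u)     x = eval t x H.+ eval u x
  eval (t •ⱽ u)     x = eval t x H.• eval u x

  _⊨_ : {n : ℕ} {s : Fin n → Sort} → Env s → QF s → Set
  x ⊨ (t ≈ᵗ u) = eval t x ≡ eval u x
  x ⊨ (t <ᵗ u) = eval t x ℝ.< eval u x
  x ⊨ (¬ᵗ φ)   = ¬ (x ⊨ φ)
  x ⊨ (φ ∧ᵗ ψ) = (x ⊨ φ) × (x ⊨ ψ)
  x ⊨ (φ ∨ᵗ ψ) = (x ⊨ φ) ⊎ (x ⊨ ψ)

  Universe : Set
  Universe = Σ Sort ⟦_⟧ˢ

  -- A formula fixes the sorts of its variables.  A relation on the
  -- two-sorted universe is quantifier-free definable when, for each of
  -- the finitely many assignments of sorts to its coordinates, its part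
  -- on that product of sorts is defined by a formula; these are the
  -- finite unions of the relations defined by single formulas.
  Definable : {n : ℕ} → Pred (Fin n → Universe) 0ℓ → Set
  Definable {n} R =
    (s : Fin n → Sort) → Σ[ φ ∈ QF s ] ∀ (x : Env s) → R (λ i → s i , x i) ⇔ (x ⊨ φ)

  module _ {n : ℕ} {s : Fin n → Sort} (f : Fin n → Fin n) where

    renameᵗ : {σ : Sort} → Term (s ∘ f) σ → Term s σ
    renameᵗ (var i)      = var (f i)
    renameᵗ (const r)    = const r
    renameᵗ (t +ᶠ u)     = renameᵗ t +ᶠ renameᵗ u
    renameᵗ (t *ᶠ u)     = renameᵗ t *ᶠ renameᵗ u
    renameᵗ (-ᶠ t)       = -ᶠ renameᵗ t
    renameᵗ (t ⁻¹ᶠ)      = renameᵗ t ⁻¹ᶠ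
    renameᵗ ⟨ t , u ⟩ᶠ   = ⟨ renameᵗ t , renameᵗ u ⟩ᶠ
    renameᵗ (t +ⱽ u)     = renameᵗ t +ⱽ renameᵗ u
    renameᵗ (t •ⱽ u)     = renameᵗ t •ⱽ renameᵗ u

    rename : QF (s ∘ f) → QF s
    rename (t ≈ᵗ u) = renameᵗ t ≈ᵗ renameᵗ u
    rename (t <ᵗ u) = renameᵗ t <ᵗ renameᵗ u
    rename (¬ᵗ φ)   = ¬ᵗ rename φ
    rename (φ ∧ᵗ ψ) = rename φ ∧ᵗ rename ψ
    rename (φ ∨ᵗ ψ) = rename φ ∨ᵗ rename ψ

    eval-rename : {σ : Sort} (t : Term (s ∘ f) σ) (x : Env s) →
                  eval t (x ∘ f) ≡ eval (renameᵗ t) x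
    eval-rename (var i)      x = refl
    eval-rename (const r)    x = refl
    eval-rename (t +ᶠ u)     x = cong₂ ℝ._+_ (eval-rename t x) (eval-rename u x)
    eval-rename (t *ᶠ u)     x = cong₂ ℝ._*_ (eval-rename t x) (eval-rename u x)
    eval-rename (-ᶠ t)       x = cong ℝ.-_ (eval-rename t x)
    eval-rename (t ⁻¹ᶠ)      x = cong ℝ._⁻¹ (eval-rename t x)
    eval-rename ⟨ t , u ⟩ᶠ   x = cong₂ H.⟨_,_⟩ (eval-rename t x) (eval-rename u x)
    eval-rename (t +ⱽ u)     x = cong₂ H._+_ (eval-rename t x) (eval-rename u x)
    eval-rename (t •ⱽ u)     x = cong₂ H._•_ (eval-rename t x) (eval-rename u x)

    ⊨-rename : (φ : QF (s ∘ f)) (x : Env s) → ((x ∘ f) ⊨ φ) ≡ (x ⊨ rename φ)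
    ⊨-rename (t ≈ᵗ u) x = cong₂ _≡_ (eval-rename t x) (eval-rename u x)
    ⊨-rename (t <ᵗ u) x = cong₂ ℝ._<_ (eval-rename t x) (eval-rename u x)
    ⊨-rename (¬ᵗ φ)   x = cong ¬_ (⊨-rename φ x)
    ⊨-rename (φ ∧ᵗ ψ) x = cong₂ _×_ (⊨-rename φ x) (⊨-rename ψ x)
    ⊨-rename (φ ∨ᵗ ψ) x = cong₂ _⊎_ (⊨-rename φ x) (⊨-rename ψ x)

  permute-definable : {n : ℕ} (f : Fin n → Fin n) {R : Pred (Fin n → Universe) 0ℓ} →
                      Definable R → Definable (λ x → R (x ∘ f))
  permute-definable f {R} dR s with dR (s ∘ f)
  ... | φ , e = rename {s = s} f φ ,
        λ x → subst (R (λ i → s (f i) , x (f i)) ⇔_) (⊨-rename {s = s} f φ x) (e (x ∘ f))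

  structure : LogicalStructure
  structure = record
    { M = Universe
    ; ℛ = Definable
    ; ∪-closed = λ dR dS s →
        proj₁ (dR s) ∨ᵗ proj₁ (dS s) , λ x → proj₂ (dR s) x ⊎-⇔ proj₂ (dS s) x
    ; ∩-closed = λ dR dS s →
        proj₁ (dR s) ∧ᵗ proj₁ (dS s) , λ x → proj₂ (dR s) x ×-⇔ proj₂ (dS s) x
    ; permute-closed = λ {_} {R} σ → permute-definable (σ ⟨$⟩ʳ_) {R}
    }

{-# OPTIONS --safe #-}

-- A quantifier-free type of a sequence is its Gram matrix together with
-- its real entries.  If V contains two orthogonal nonzero vectors, (P)
-- forbids a countable separating set of vectors: otherwise M would inject
-- into ℝ and hence into a circle, where no three points of an arc are
-- equidistant.  So V has an infinite orthonormal sequence, and then strong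
-- homogeneity, applied to a family of vectors and its image under a
-- non-surjective isometry, gives orthonormal sequences orthogonal to any
-- family of fewer than λ vectors.  With this room, A is free from B over
-- a countable C exactly when ⟨ a , b ⟩ = ⟨ P a , b ⟩ for the projection P
-- onto the closed span of C; simplicity follows, and a free extension is
-- determined by the type it extends, so that μ = ℵ₀ works.  If V has
-- dimension at most one, a type has at most the realizations ± c, and
-- nothing divides.

module Submission where

open import Defs
open import Axiom.ExcludedMiddle using (ExcludedMiddle)
open import Axiom.Extensionality.Propositional using (Extensionality)
open import Algebra.Bundles using (CommutativeRing; Group)
open import Algebra.Module.Structures using (IsLeftModule)
import Algebra.Properties.AbelianGroup
import Algebra.Properties.Group
import Algebra.Properties.Ring
import Algebra.Properties.Semiring.Mult.TCOptimised
import Algebra.Solver.Ring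
open import Algebra.Solver.Ring.AlmostCommutativeRing using (fromCommutativeRing; _-Raw-AlmostCommutative⟶_)
open import Data.Bool using (Bool; true; false; T)
open import Data.Bool.Properties using (T-irrelevant)
open import Data.Empty using (⊥; ⊥-elim)
open import Data.Fin using (Fin; zero; suc; toℕ; fromℕ<) renaming (_<_ to _<ᶠ_)
open import Data.Fin.Properties using (toℕ-injective; toℕ-fromℕ<; ℕ→Fin-notInjective) renaming (<-cmp to <ᶠ-cmp)
open import Data.Integer as ℤ using (ℤ; -[1+_]; _⊖_; _◃_; sign; ∣_∣)
open import Data.Integer.Properties using ([1+m]⊖[1+n]≡m⊖n)
open import Data.List using (List; []; _∷_; lookup)
open import Data.List.Membership.Propositional using () renaming (_∈_ to _∈ˡ_; _∉_ to _∉ˡ_)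
open import Data.List.Relation.Unary.Any using (here; there; index)
open import Data.List.Relation.Unary.Any.Properties using (lookup-index)
open import Data.Maybe using (Maybe; just; nothing)
open import Data.Nat as ℕ using (ℕ; zero; suc; z≤n; s≤s)
import Data.Nat.Properties as ℕ
open import Data.Product using (Σ; Σ-syntax; ∃; ∃-syntax; _×_; _,_; proj₁; proj₂)
open import Data.Sign as Sign using (Sign)
open import Data.Sum using (_⊎_; inj₁; inj₂; [_,_]′; map₁)
open import Data.Sum.Properties using (inj₁-injective; inj₂-injective)
open import Function using (_∘_; _⇔_; _↔_; Equivalence; Inverse; Injection; Injective; mk↣; mk⇔; case_of_)
open import Function.Construct.Composition using () renaming (injection to ≼-trans)
open import Induction.WellFounded using (WellFounded; Acc; acc)
open import Level using (0ℓ)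
open import Relation.Binary using (Rel; Setoid; IsStrictTotalOrder; Tri; tri<; tri≈; tri>)
open import Relation.Binary.PropositionalEquality
open import Relation.Nullary using (¬_; Dec; yes; no; contradiction)
open import Relation.Nullary.Decidable using (True; isYes; toWitness; fromWitness; decidable-stable)
open import Relation.Unary using (Pred)

-- Excluded middle is assumed for types that carry witnesses, so deciding an existential also
-- chooses. With extensionality this yields a well-ordering of every type in `Set`, which (P)
-- requires of its index set, and maximal cliques, from which `X × ℕ ≼ X` follows for infinite `X`.
-- The latter is forced by dividing sequences, whose length may be any infinite cardinal below λ:
-- the family to be avoided is indexed by `X × Q` with `Q` countable, and homogeneity applies only
-- while this product stays below λ. (P) extracts from realizations of a single type, so the vectors
-- fed to it must share one norm; hence the reals are sent to a circle and not to a line. The gap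
-- between ℵ₀-freeness and ℵ₁-freeness is that a finite tuple contains only finitely many elements
-- of `C`, while the projection of `b` is an infinite series over `C`. So orthogonality follows from
-- ℵ₀-freeness only in the limit, by a Cauchy-Schwarz estimate of the tail.

abstract

  -- Injective coding of natural numbers

  pair : ℕ → ℕ → ℕ
  pair zero    b = 2 ℕ.* b
  pair (suc a) b = suc (2 ℕ.* pair a b)

  -- In binary, `pair a b` is `b` followed by a zero and then `a` ones, so the last zero separates
  -- the two arguments.
  pair-injective : ∀ a b {a′ b′} → pair a b ≡ pair a′ b′ → a ≡ a′ × b ≡ b′
  pair-injective zero    b {zero}   {b′} e = refl , ℕ.*-cancelˡ-≡ b b′ 2 e
  pair-injective zero    b {suc a′} {b′} e = contradiction e (ℕ.even≢odd b (pair a′ b′))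
  pair-injective (suc a) b {zero}   {b′} e = contradiction (sym e) (ℕ.even≢odd b′ (pair a b))
  pair-injective (suc a) b {suc a′} {b′} e
    with p , q ← pair-injective a b (ℕ.*-cancelˡ-≡ (pair a b) (pair a′ b′) 2 (ℕ.suc-injective e)) =
    cong suc p , q

  merge : ℕ ⊎ ℕ → ℕ
  merge (inj₁ n) = 2 ℕ.* n
  merge (inj₂ n) = suc (2 ℕ.* n)

  merge-injective : Injective _≡_ _≡_ merge
  merge-injective {inj₁ m} {inj₁ n} e = cong inj₁ (ℕ.*-cancelˡ-≡ m n 2 e)
  merge-injective {inj₁ m} {inj₂ n} e = contradiction e (ℕ.even≢odd m n)
  merge-injective {inj₂ m} {inj₁ n} e = contradiction (sym e) (ℕ.even≢odd n m)
  merge-injective {inj₂ m} {inj₂ n} e = cong inj₂ (ℕ.*-cancelˡ-≡ m n 2 (ℕ.suc-injective e))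

-- Choice, well-ordering and cardinal arithmetic from excluded middle

module Classical (em : ∀ {ℓ} → ExcludedMiddle ℓ) (ext : ∀ {a b} → Extensionality a b) where

  by-contradiction : ∀ {ℓ} {P : Set ℓ} → ¬ ¬ P → P
  by-contradiction = decidable-stable em

  ¬∀⇒∃¬ : ∀ {a ℓ} {A : Set a} {P : A → Set ℓ} → ¬ (∀ x → P x) → ∃[ x ] ¬ P x
  ¬∀⇒∃¬ ¬all = by-contradiction λ none → ¬all λ x → by-contradiction λ ¬Px → none (x , ¬Px)

  -- Impredicativity: every proposition has a proof-irrelevant copy in Set.
  Squash : ∀ {ℓ} → Set ℓ → Set
  Squash P = True (em {P = P})

  squash : ∀ {ℓ} {P : Set ℓ} → P → Squash P
  squash = fromWitness

  unsquash : ∀ {ℓ} {P : Set ℓ} → Squash P → P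
  unsquash = toWitness

  Squash-irrelevant : ∀ {ℓ} {P : Set ℓ} (p q : Squash P) → p ≡ q
  Squash-irrelevant = T-irrelevant

  -- Zermelo's well-ordering theorem

  module WellOrdering (U : Set) where

    -- Boolean-valued, so that subsets form a type in `Set` over which families can range;
    -- extensionality turns mutual inclusion into equality.
    Sub : Set
    Sub = U → Bool

    infix 4 _∈_ _⊆_ _≺ʷ_
    infix 10 _⁺

    _∈_ : U → Sub → Set
    x ∈ S = T (S x)

    _⊆_ : Sub → Sub → Set
    S ⊆ S′ = ∀ {x} → x ∈ S → x ∈ S′

    ⟪_⟫ : ∀ {ℓ} → (U → Set ℓ) → Sub
    ⟪ P ⟫ x = isYes (em {P = P x})

    T-antisym : ∀ {x y} → (T x → T y) → (T y → T x) → x ≡ y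
    T-antisym {true}  {true}  f g = refl
    T-antisym {true}  {false} f g = ⊥-elim (f _)
    T-antisym {false} {true}  f g = ⊥-elim (g _)
    T-antisym {false} {false} f g = refl

    ⊆-antisym : ∀ {S S′} → S ⊆ S′ → S′ ⊆ S → S ≡ S′
    ⊆-antisym f g = ext λ _ → T-antisym f g

    -- The witness that `em` returns depends on `S` alone, so it serves as a choice function on
    -- nonempty complements.
    Fresh : Sub → U → Set
    Fresh S x with em {P = ∃[ y ] ¬ y ∈ S}
    ... | yes (y , _) = x ≡ y
    ... | no _        = ⊥

    fresh : ∀ S {x} → ¬ x ∈ S → ∃[ y ] Fresh S y × ¬ y ∈ S
    fresh S x∉S with em {P = ∃[ y ] ¬ y ∈ S}
    ... | yes (y , y∉S) = y , refl , y∉S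
    ... | no none       = contradiction (_ , x∉S) none

    Fresh-unique : ∀ S {x y} → Fresh S x → Fresh S y → x ≡ y
    Fresh-unique S p q with em {P = ∃[ y ] ¬ y ∈ S}
    ... | yes _ = trans p (sym q)

    _⁺ : Sub → Sub
    S ⁺ = ⟪ (λ x → x ∈ S ⊎ Fresh S x) ⟫

    ⋃ : (Sub → Set) → Sub
    ⋃ F = ⟪ (λ x → ∃[ S ] F S × x ∈ S) ⟫

    -- Zermelo's chain: the least family closed under unions and under adjoining the chosen element.
    -- The empty set is the empty union.
    data Tower : Sub → Set₁ where
      union : ∀ F → (∀ {S} → F S → Tower S) → Tower (⋃ F)
      succ  : ∀ {S} → Tower S → Tower (S ⁺)

    ⊆⁺ : ∀ S → S ⊆ S ⁺
    ⊆⁺ S x∈S = squash (inj₁ x∈S)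

    -- Nothing lies strictly between `S` and `S ⁺`: this is what `linear-succ` supplies, by
    -- induction on the second tower, once `S` is comparable with every tower.
    linear : ∀ {S S′} → Tower S → Tower S′ → S ⊆ S′ ⊎ S′ ⁺ ⊆ S
    linear-succ : ∀ {S S′} → (∀ {Q} → Tower Q → S ⊆ Q ⊎ Q ⁺ ⊆ S) →
                  Tower S′ → S ⊆ S′ → S ⁺ ⊆ S′ ⊎ S′ ⊆ S

    linear {S′ = S′} (union F t) t′ with em {P = ∃[ S ] F S × ¬ S ⊆ S′}
    ... | no none = inj₁ λ x∈ → let S , f , x∈S = unsquash x∈ in
                    by-contradiction λ x∉ → none (S , f , λ sub → x∉ (sub x∈S))
    ... | yes (S , f , S⊈S′) with linear (t f) t′
    ...   | inj₁ S⊆S′ = contradiction (λ {x} → S⊆S′ {x}) S⊈S′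
    ...   | inj₂ S′⁺⊆S = inj₂ λ x∈ → squash (S , f , S′⁺⊆S x∈)
    linear {S′ = S′} (succ {S} t) t′ with linear t t′
    ... | inj₂ S′⁺⊆S = inj₂ (⊆⁺ S ∘ S′⁺⊆S)
    ... | inj₁ S⊆S′ with linear-succ (linear t) t′ S⊆S′
    ...   | inj₁ S⁺⊆S′ = inj₁ S⁺⊆S′
    ...   | inj₂ S′⊆S = inj₂ λ {x} → subst (λ Q → x ∈ Q ⁺) (⊆-antisym {S′} {S} S′⊆S S⊆S′)

    linear-succ {S} lin (union F t) S⊆ with em {P = ∃[ Q ] F Q × ¬ Q ⊆ S}
    ... | no none = inj₂ λ x∈ → let Q , f , x∈Q = unsquash x∈ in
                    by-contradiction λ x∉ → none (Q , f , λ sub → x∉ (sub x∈Q))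
    ... | yes (Q , f , Q⊈S) with lin (t f)
    ...   | inj₂ Q⁺⊆S = contradiction (λ {x} x∈ → Q⁺⊆S {x} (⊆⁺ Q x∈)) Q⊈S
    ...   | inj₁ S⊆Q with linear-succ lin (t f) S⊆Q
    ...     | inj₁ S⁺⊆Q = inj₁ λ x∈ → squash (Q , f , S⁺⊆Q x∈)
    ...     | inj₂ Q⊆S = contradiction (λ {x} → Q⊆S {x}) Q⊈S
    linear-succ {S} lin (succ {Q} t) S⊆Q⁺ with lin t
    ... | inj₂ Q⁺⊆S = inj₂ Q⁺⊆S
    ... | inj₁ S⊆Q with linear-succ lin t S⊆Q
    ...   | inj₁ S⁺⊆Q = inj₁ (⊆⁺ Q ∘ S⁺⊆Q)
    ...   | inj₂ Q⊆S = inj₁ λ {x} → subst (λ P → x ∈ P ⁺) (⊆-antisym {S} {Q} S⊆Q Q⊆S)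

    Avoids : U → Sub → Set
    Avoids x S = Squash (Tower S × ¬ x ∈ S)

    -- The largest tower that omits `x`.
    before : U → Sub
    before x = ⋃ (Avoids x)

    before-tower : ∀ x → Tower (before x)
    before-tower x = union _ (proj₁ ∘ unsquash)

    before-irrefl : ∀ x → ¬ x ∈ before x
    before-irrefl x x∈ = let S , av , x∈S = unsquash x∈ in proj₂ (unsquash av) x∈S

    -- Otherwise adjoining the chosen element would give a larger tower that still omits `x`.
    Fresh-before : ∀ x → Fresh (before x) x
    Fresh-before x with fresh (before x) (before-irrefl x) | em {P = x ∈ before x ⁺}
    ... | _ , _ , _ | yes x∈ with unsquash x∈
    ...   | inj₁ x∈b = contradiction x∈b (before-irrefl x)
    ...   | inj₂ f = f
    Fresh-before x | y , fr , y∉ | no x∉ =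
      contradiction (squash (before x ⁺ , squash (succ (before-tower x) , x∉) , squash (inj₂ fr))) y∉

    _≺ʷ_ : Rel U 0ℓ
    x ≺ʷ y = x ∈ before y

    ⊆⇒≼ : ∀ x y → before x ⊆ before y → x ≡ y ⊎ x ≺ʷ y
    ⊆⇒≼ x y sub with linear (before-tower y) (before-tower x)
    ... | inj₂ sup = inj₂ (sup (squash (inj₂ (Fresh-before x))))
    ... | inj₁ sup = inj₁ (Fresh-unique (before x) (Fresh-before x)
            (subst (λ S → Fresh S y) (⊆-antisym {before y} {before x} sup sub) (Fresh-before y)))

    ≺ʷ-trans : ∀ {x y z} → x ≺ʷ y → y ≺ʷ z → x ≺ʷ z
    ≺ʷ-trans {x} {y} {z} x≺y y≺z with linear (before-tower y) (before-tower z)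
    ... | inj₁ sub = sub x≺y
    ... | inj₂ sup = contradiction (sup (⊆⁺ (before z) y≺z)) (before-irrefl y)

    ≺ʷ-asym : ∀ {x y} → x ≺ʷ y → ¬ y ≺ʷ x
    ≺ʷ-asym {x} p q = before-irrefl x (≺ʷ-trans p q)

    ≺ʷ-irrefl : ∀ {x y} → x ≡ y → ¬ x ≺ʷ y
    ≺ʷ-irrefl {x} refl = before-irrefl x

    ≺ʷ-compare : ∀ x y → Tri (x ≺ʷ y) (x ≡ y) (y ≺ʷ x)
    ≺ʷ-compare x y with linear (before-tower x) (before-tower y)
    ... | inj₂ sup = let y≺x = sup (squash (inj₂ (Fresh-before y))) in
                     tri> (≺ʷ-asym y≺x) (λ e → ≺ʷ-irrefl (sym e) y≺x) y≺x
    ... | inj₁ sub with ⊆⇒≼ x y sub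
    ...   | inj₁ refl = tri≈ (before-irrefl x) refl (before-irrefl x)
    ...   | inj₂ x≺y = tri< x≺y (λ e → ≺ʷ-irrefl e x≺y) (≺ʷ-asym x≺y)

    ≺ʷ-isStrictTotalOrder : IsStrictTotalOrder _≡_ _≺ʷ_
    ≺ʷ-isStrictTotalOrder = record
      { isStrictPartialOrder = record
        { isEquivalence = isEquivalence
        ; irrefl = ≺ʷ-irrefl
        ; trans = λ {x} → ≺ʷ-trans {x}
        ; <-resp-≈ = (λ where refl p → p) , (λ where refl p → p)
        }
      ; compare = ≺ʷ-compare
      }

    -- In the successor case linearity puts all predecessors of the new element into `S`, where they
    -- are accessible by induction.
    Tower-acc : ∀ {S x} → Tower S → x ∈ S → Acc _≺ʷ_ x
    Tower-acc (union F t) x∈ = let S , f , x∈S = unsquash x∈ in Tower-acc (t f) x∈S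
    Tower-acc {x = x} (succ {S} t) x∈ with unsquash x∈
    ... | inj₁ x∈S = Tower-acc t x∈S
    ... | inj₂ fr with linear (before-tower x) t
    ...   | inj₁ sub = acc λ y≺x → Tower-acc t (sub y≺x)
    ...   | inj₂ sup = contradiction (sup (squash (inj₂ fr))) (before-irrefl x)

    ≺ʷ-wellFounded : WellFounded _≺ʷ_
    ≺ʷ-wellFounded x = Tower-acc (succ (before-tower x)) (squash (inj₂ (Fresh-before x)))

    module MaximalClique (R : U → U → Set) where

      -- Transfinite recursion: an element joins when every earlier member is related to it. The
      -- recursion runs on the accessibility proof, so the value formally depends on that proof,
      -- whence the irrelevance lemma.
      Member′ : ∀ x → Acc _≺ʷ_ x → Set
      Member′ x (acc rs) = ∀ y (y≺x : y ≺ʷ x) → Member′ y (rs y≺x) → R y x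

      Member′-irrelevant : ∀ {x} (p q : Acc _≺ʷ_ x) → Member′ x p → Member′ x q
      Member′-irrelevant (acc rs) (acc rs′) m y y≺x m′ =
        m y y≺x (Member′-irrelevant (rs′ y≺x) (rs y≺x) m′)

      Member : U → Set
      Member x = Member′ x (≺ʷ-wellFounded x)

      clique : ∀ {x y} → Member x → Member y → y ≺ʷ x → R y x
      clique {x} {y} mx my y≺x with ≺ʷ-wellFounded x
      ... | acc rs = mx y y≺x (Member′-irrelevant _ _ my)

      maximal : ∀ {x} → (∀ {y} → Member y → R y x) → Member x
      maximal {x} r with ≺ʷ-wellFounded x
      ... | acc rs = λ y y≺x m → r (Member′-irrelevant _ _ m)

      connected : ∀ {x y} → Member x → Member y → x ≢ y → R x y ⊎ R y x
      connected {x} {y} mx my x≢y with ≺ʷ-compare x y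
      ... | tri< x≺y _ _ = inj₁ (clique my mx x≺y)
      ... | tri≈ _ x≡y _ = contradiction x≡y x≢y
      ... | tri> _ _ y≺x = inj₂ (clique mx my y≺x)

  abstract
    -- Takes the place of Zorn's lemma. Of two members the earlier one is related to the later one,
    -- hence the disjunction.
    maximal-clique : {U : Set} (R : U → U → Set) → Σ[ K ∈ (U → Set) ]
                     (∀ {x y} → K x → K y → x ≢ y → R x y ⊎ R y x) ×
                     (∀ {x} → (∀ {y} → K y → R y x) → K x)
    maximal-clique {U} R = Member , connected , maximal
      where open WellOrdering.MaximalClique U R

  module _ (A : Set) where

    private
      extend : List A → List A
      extend l with em {P = ∃[ x ] x ∉ˡ l}
      ... | yes (x , _) = x ∷ l
      ... | no _        = l

      lists : ℕ → List A
      lists zero    = []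
      lists (suc n) = extend (lists n)

      Exhausted : ℕ → Set
      Exhausted n = ∀ x → x ∈ˡ lists n

      exhausted⇒≼ : ∀ l → (∀ x → x ∈ˡ l) → card A ≼ card ℕ
      exhausted⇒≼ l all = mk↣ {to = λ x → toℕ (index (all x))} λ {x} {y} e →
        trans (lookup-index (all x)) (trans (cong (lookup l) (toℕ-injective e))
          (sym (lookup-index (all y))))

      module _ (never : ∀ n → ¬ Exhausted n) where

        new : ∀ n → ∃[ x ] x ∉ˡ lists n × lists (suc n) ≡ x ∷ lists n
        new n with em {P = ∃[ x ] x ∉ˡ lists n}
        ... | yes (x , x∉) = x , x∉ , refl
        ... | no none = contradiction (λ x → by-contradiction λ x∉ → none (x , x∉)) (never n)

        new-∈ : ∀ {m n} → m ℕ.< n → proj₁ (new m) ∈ˡ lists n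
        new-∈ {m} {suc n} (s≤s m≤n) rewrite proj₂ (proj₂ (new n)) with ℕ.m≤n⇒m<n∨m≡n m≤n
        ... | inj₁ m<n = there (new-∈ m<n)
        ... | inj₂ refl = here refl

        new-injective : Injective _≡_ _≡_ (proj₁ ∘ new)
        new-injective {m} {n} e with ℕ.<-cmp m n
        ... | tri≈ _ m≡n _ = m≡n
        ... | tri< m<n _ _ = contradiction (subst (_∈ˡ lists n) e (new-∈ m<n)) (proj₁ (proj₂ (new n)))
        ... | tri> _ _ n<m = contradiction (subst (_∈ˡ lists m) (sym e) (new-∈ n<m)) (proj₁ (proj₂ (new m)))

    -- New elements are added to a list as long as there are any; either a finite list exhausts `A`
    -- or the added elements form an injective sequence.
    countable-or-infinite : card A ≼ card ℕ ⊎ card ℕ ≼ card A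
    countable-or-infinite with em {P = ∃[ n ] Exhausted n}
    ... | yes (n , all) = inj₁ (exhausted⇒≼ (lists n) all)
    ... | no none = inj₂ (mk↣ (new-injective λ n all → none (n , all)))

  -- A maximal family of disjoint injective sequences leaves a remainder that contains no such
  -- sequence. In each sequence the even places hold the copies of its own points; the odd places of
  -- one fixed sequence hold those of the remainder.
  ≼ℕ×-absorbs : {X : Set} → card ℕ ≼ card X → card (X × ℕ) ≼ card X
  ≼ℕ×-absorbs {X} inf = mk↣ {to = embed} embed-injective
    where
    Seq : Set
    Seq = Σ[ s ∈ (ℕ → X) ] Injective _≡_ _≡_ s

    Disjoint : Seq → Seq → Set
    Disjoint s t = ∀ m n → proj₁ s m ≢ proj₁ t n

    Member : Seq → Set
    Member = proj₁ (maximal-clique Disjoint)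

    Covered : X → Set
    Covered x = Σ[ s ∈ Seq ] Member s × ∃[ n ] proj₁ s n ≡ x

    Rest : Set
    Rest = Σ[ x ∈ X ] Squash (¬ Covered x)

    Rest-≡ : {x y : Rest} → proj₁ x ≡ proj₁ y → x ≡ y
    Rest-≡ {x , p} {y , q} refl = cong (x ,_) (Squash-irrelevant p q)

    ¬ℕ≼Rest : ¬ (card ℕ ≼ card Rest)
    ¬ℕ≼Rest i = unsquash (proj₂ (Injection.to i 0)) (t , t-member , 0 , refl)
      where
      t : Seq
      t = proj₁ ∘ Injection.to i , λ e → Injection.injective i (Rest-≡ e)
      t-member : Member t
      t-member = proj₂ (proj₂ (maximal-clique Disjoint)) λ {s} ms m n e → unsquash (proj₂ (Injection.to i n)) (s , ms , m , e)

    Rest≼ℕ : card Rest ≼ card ℕ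
    Rest≼ℕ with countable-or-infinite Rest
    ... | inj₁ c = c
    ... | inj₂ i = contradiction i ¬ℕ≼Rest

    member : ∃ Member
    member with em {P = ∃ Member}
    ... | yes m = m
    -- Without members nothing would be covered, and the infinite `X` would embed into the
    -- remainder.
    ... | no none = contradiction (≼-trans inf (mk↣ {to = λ x → x , squash λ (s , ms , _) → none (s , ms)}
                      (cong proj₁))) ¬ℕ≼Rest

    classify : ∀ x → Covered x ⊎ Squash (¬ Covered x)
    classify x with em {P = Covered x}
    ... | yes c = inj₁ c
    ... | no ¬c = inj₂ (squash ¬c)

    rank : ∀ x → Squash (¬ Covered x) → ℕ
    rank x r = Injection.to Rest≼ℕ (x , r)

    embed′ : ∀ x → Covered x ⊎ Squash (¬ Covered x) → ℕ → X
    embed′ x (inj₁ (s , _ , k , _)) n = proj₁ s (merge (inj₁ (pair k n)))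
    embed′ x (inj₂ r) n = proj₁ (proj₁ member) (merge (inj₂ (pair (rank x r) n)))

    embed : X × ℕ → X
    embed (x , n) = embed′ x (classify x) n

    same : ∀ {s t} → Member s → Member t → ∀ {m n} → proj₁ s m ≡ proj₁ t n → s ≡ t × m ≡ n
    same {s} {t} ms mt {m} {n} e with em {P = s ≡ t}
    ... | yes refl = refl , proj₂ s e
    ... | no s≢t with proj₁ (proj₂ (maximal-clique Disjoint)) ms mt s≢t
    ...   | inj₁ d = contradiction e (d m n)
    ...   | inj₂ d = contradiction (sym e) (d n m)

    embed′-injective : ∀ {x y} (c : Covered x ⊎ Squash (¬ Covered x)) (d : Covered y ⊎ Squash (¬ Covered y)) {m n} →
                       embed′ x c m ≡ embed′ y d n → x ≡ y × m ≡ n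
    embed′-injective (inj₁ (s , ms , k , refl)) (inj₁ (t , mt , l , refl)) {m} {n} e
      with s≡t , e₁ ← same {s} {t} ms mt e
      with inj₁-injective (merge-injective {inj₁ (pair k m)} {inj₁ (pair l n)} e₁)
    ... | e₂ with k≡l , m≡n ← pair-injective k m {l} {n} e₂ = cong₂ (λ s k → proj₁ s k) s≡t k≡l , m≡n
    embed′-injective {y = y} (inj₁ (s , ms , k , refl)) (inj₂ r) {m} {n} e
      with () ← merge-injective {inj₁ (pair k m)} {inj₂ (pair (rank y r) n)}
                  (proj₂ (same {s} {proj₁ member} ms (proj₂ member) e))
    embed′-injective {x} (inj₂ r) (inj₁ (s , ms , k , refl)) {m} {n} e
      with () ← merge-injective {inj₂ (pair (rank x r) m)} {inj₁ (pair k n)}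
                  (proj₂ (same {proj₁ member} {s} (proj₂ member) ms e))
    embed′-injective {x} {y} (inj₂ r) (inj₂ r′) {m} {n} e
      with p , q ← pair-injective (rank x r) m {rank y r′} {n} (inj₂-injective
             (merge-injective {inj₂ (pair (rank x r) m)} {inj₂ (pair (rank y r′) n)}
               (proj₂ (proj₁ member) e))) =
      cong proj₁ (Injection.injective Rest≼ℕ p) , q

    embed-injective : Injective _≡_ _≡_ embed
    embed-injective {x , m} {y , n} e with refl , refl ← embed′-injective (classify x) (classify y) e = refl

-- The ring solver needs coefficients with a computing equality test:
-- these are the integers.
module IntegerCoefficients {c ℓ} (CR : CommutativeRing c ℓ) where

  open CommutativeRing CR hiding (zero) renaming (refl to ≈-refl; sym to ≈-sym; trans to ≈-trans; setoid to ≈-setoid)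
  open Algebra.Properties.Ring ring
  open Algebra.Properties.AbelianGroup +-abelianGroup using (⁻¹-∙-comm)
  open Algebra.Properties.Semiring.Mult.TCOptimised semiring renaming (_×_ to _·_)
  open import Relation.Binary.Reasoning.Setoid ≈-setoid

  fromℤ : ℤ → Carrier
  fromℤ (ℤ.+ n)  = n · 1#
  fromℤ -[1+ n ] = - (suc n · 1#)

  signed : Sign → Carrier → Carrier
  signed Sign.+ x = x
  signed Sign.- x = - x

  signed-cong : ∀ s {x y} → x ≈ y → signed s x ≈ signed s y
  signed-cong Sign.+ e = e
  signed-cong Sign.- e = -‿cong e

  signed-* : ∀ s t x y → signed (s Sign.* t) (x * y) ≈ signed s x * signed t y
  signed-* Sign.+ Sign.+ x y = ≈-refl
  signed-* Sign.+ Sign.- x y = -‿distribʳ-* x y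
  signed-* Sign.- Sign.+ x y = -‿distribˡ-* x y
  signed-* Sign.- Sign.- x y = begin
    x * y           ≈⟨ -‿involutive (x * y) ⟨
    - (- (x * y))   ≈⟨ -‿cong (-‿distribʳ-* x y) ⟩
    - (x * - y)     ≈⟨ -‿distribˡ-* x (- y) ⟩
    - x * - y       ∎

  fromℤ-◃ : ∀ s n → fromℤ (s ◃ n) ≈ signed s (n · 1#)
  fromℤ-◃ Sign.+ zero    = ≈-refl
  fromℤ-◃ Sign.- zero    = ≈-sym -0#≈0#
  fromℤ-◃ Sign.+ (suc n) = ≈-refl
  fromℤ-◃ Sign.- (suc n) = ≈-refl

  fromℤ-sign : ∀ i → signed (sign i) (∣ i ∣ · 1#) ≈ fromℤ i
  fromℤ-sign (ℤ.+ n)  = ≈-refl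
  fromℤ-sign -[1+ n ] = ≈-refl

  fromℤ-* : ∀ i j → fromℤ (i ℤ.* j) ≈ fromℤ i * fromℤ j
  fromℤ-* i j = begin
    fromℤ (i ℤ.* j)                                            ≈⟨ fromℤ-◃ s (∣ i ∣ ℕ.* ∣ j ∣) ⟩
    signed s ((∣ i ∣ ℕ.* ∣ j ∣) · 1#)                   ≈⟨ signed-cong s (×1-homo-* ∣ i ∣ ∣ j ∣) ⟩
    signed s ((∣ i ∣ · 1#) * (∣ j ∣ · 1#))                     ≈⟨ signed-* (sign i) (sign j) _ _ ⟩
    signed (sign i) (∣ i ∣ · 1#) * signed (sign j) (∣ j ∣ · 1#) ≈⟨ *-cong (fromℤ-sign i) (fromℤ-sign j) ⟩
    fromℤ i * fromℤ j                                          ∎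
    where s = sign i Sign.* sign j

  fromℤ-⊖ : ∀ m n → fromℤ (m ⊖ n) ≈ m · 1# + - (n · 1#)
  fromℤ-⊖ zero    zero    = ≈-sym (-‿inverseʳ 0#)
  fromℤ-⊖ zero    (suc n) = ≈-sym (+-identityˡ _)
  fromℤ-⊖ (suc m) zero    = ≈-sym (≈-trans (+-congˡ -0#≈0#) (+-identityʳ _))
  fromℤ-⊖ (suc m) (suc n) = begin
    fromℤ (suc m ⊖ suc n)                 ≡⟨ cong fromℤ ([1+m]⊖[1+n]≡m⊖n m n) ⟩
    fromℤ (m ⊖ n)                         ≈⟨ fromℤ-⊖ m n ⟩
    a + - b                               ≈⟨ +-congʳ (+-identityʳ a) ⟨
    (a + 0#) + - b                        ≈⟨ +-congʳ (+-congˡ (-‿inverseʳ 1#)) ⟨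
    (a + (1# + - 1#)) + - b               ≈⟨ +-congʳ (+-assoc a 1# (- 1#)) ⟨
    ((a + 1#) + - 1#) + - b               ≈⟨ +-assoc _ _ _ ⟩
    (a + 1#) + (- 1# + - b)               ≈⟨ +-cong (+-comm a 1#) (⁻¹-∙-comm 1# b) ⟩
    (1# + a) + - (1# + b)                 ≈⟨ +-cong (1+× m 1#) (-‿cong (1+× n 1#)) ⟨
    suc m · 1# + - (suc n · 1#)           ∎
    where
    a = m · 1#
    b = n · 1#

  fromℤ-+ : ∀ i j → fromℤ (i ℤ.+ j) ≈ fromℤ i + fromℤ j
  fromℤ-+ (ℤ.+ m)  (ℤ.+ n)  = ×-homo-+ 1# m n
  fromℤ-+ (ℤ.+ m)  -[1+ n ] = fromℤ-⊖ m (suc n)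
  fromℤ-+ -[1+ m ] (ℤ.+ n)  = ≈-trans (fromℤ-⊖ n (suc m)) (+-comm _ _)
  fromℤ-+ -[1+ m ] -[1+ n ] = begin
    - (suc (suc (m ℕ.+ n)) · 1#)     ≡⟨ cong (λ k → - (suc k · 1#)) (ℕ.+-suc m n) ⟨
    - ((suc m ℕ.+ suc n) · 1#)       ≈⟨ -‿cong (×-homo-+ 1# (suc m) (suc n)) ⟩
    - (suc m · 1# + suc n · 1#)             ≈⟨ ⁻¹-∙-comm _ _ ⟨
    - (suc m · 1#) + - (suc n · 1#)         ∎

  fromℤ-neg : ∀ i → fromℤ (ℤ.- i) ≈ - fromℤ i
  fromℤ-neg (ℤ.+ zero)  = ≈-sym -0#≈0#
  fromℤ-neg (ℤ.+ suc n) = ≈-refl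
  fromℤ-neg -[1+ n ]    = ≈-sym (-‿involutive _)

  morphism : ℤ.+-*-rawRing -Raw-AlmostCommutative⟶ fromCommutativeRing CR
  morphism = record
    { ⟦_⟧    = fromℤ
    ; +-homo = fromℤ-+
    ; *-homo = fromℤ-*
    ; -‿homo = fromℤ-neg
    ; 0-homo = ≈-refl
    ; 1-homo = ≈-refl
    }

  _≈?_ : ∀ i j → Maybe (fromℤ i ≈ fromℤ j)
  i ≈? j with i ℤ.≟ j
  ... | yes refl = just ≈-refl
  ... | no  _      = nothing

  open Algebra.Solver.Ring ℤ.+-*-rawRing (fromCommutativeRing CR) morphism _≈?_ public
    using (solve; _:=_; _:+_; _:*_; _:-_; :-_; con; Polynomial)

-- The real field: order, square roots, approximation and coding of sequences

module RealField (em : ∀ {ℓ} → ExcludedMiddle ℓ) (ext : ∀ {a b} → Extensionality a b)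
                 (ℝ : CompleteOrderedField) where

  open Classical em ext
  open CompleteOrderedField ℝ
  open CommutativeRing commutativeRing public
    using (+-comm; +-assoc; +-identityˡ; +-identityʳ; -‿inverseʳ; *-comm; *-assoc;
           *-identityˡ; *-identityʳ; zeroˡ; zeroʳ; distribˡ)
  open IsStrictTotalOrder isStrictTotalOrder public
    using (compare) renaming (trans to <-trans; irrefl to <-irrefl; asym to <-asym)
  open IntegerCoefficients commutativeRing public
    using (solve; _:=_; _:+_; _:*_; _:-_; :-_; con; Polynomial)

  :0 :1 :2 :3 : ∀ {n} → Polynomial n
  :0 = con (ℤ.+ 0)
  :1 = con (ℤ.+ 1)
  :2 = con (ℤ.+ 2)
  :3 = con (ℤ.+ 3)

  infixl 6 _-_
  _-_ : Carrier → Carrier → Carrier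
  x - y = x + (- y)

  2# 3# : Carrier
  2# = 1# + 1#
  3# = 2# + 1#

  <⇒0<- : ∀ {x y} → x < y → 0# < y - x
  <⇒0<- {x} {y} x<y = subst₂ _<_ (solve 1 (λ x → (:- x) :+ x := :0) refl x)
    (solve 2 (λ x y → (:- x) :+ y := y :- x) refl x y) (+-monoʳ-< (- x) x<y)

  0<-⇒< : ∀ {x y} → 0# < y - x → x < y
  0<-⇒< {x} {y} 0<y-x = subst₂ _<_ (+-identityʳ x)
    (solve 2 (λ x y → x :+ (y :- x) := y) refl x y) (+-monoʳ-< x 0<y-x)

  infix 2 _since_
  -- Reduces an inequality to the positivity of an expression that the ring solver identifies with
  -- the difference of its sides.
  _since_ : ∀ {x y e} → 0# < e → e ≡ y - x → x < y
  0<e since e = 0<-⇒< (subst (0# <_) e 0<e)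

  0<-+ : ∀ {x y} → 0# < x → 0# < y → 0# < x + y
  0<-+ {x} {y} 0<x 0<y = <-trans 0<x (subst (_< x + y) (+-identityʳ x) (+-monoʳ-< x 0<y))

  ≤-refl : ∀ {x} → x ≤ x
  ≤-refl = inj₂ refl

  <-≤-trans : ∀ {x y z} → x < y → y ≤ z → x < z
  <-≤-trans x<y (inj₁ y<z) = <-trans x<y y<z
  <-≤-trans x<y (inj₂ refl) = x<y

  ≤-<-trans : ∀ {x y z} → x ≤ y → y < z → x < z
  ≤-<-trans (inj₁ x<y) y<z = <-trans x<y y<z
  ≤-<-trans (inj₂ refl) y<z = y<z

  ≤-trans : ∀ {x y z} → x ≤ y → y ≤ z → x ≤ z
  ≤-trans (inj₁ x<y) y≤z = inj₁ (<-≤-trans x<y y≤z)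
  ≤-trans (inj₂ refl) y≤z = y≤z

  ≤⇒≯ : ∀ {x y} → x ≤ y → ¬ y < x
  ≤⇒≯ x≤y y<x = <-irrefl refl (≤-<-trans x≤y y<x)

  ≮⇒≥ : ∀ {x y} → ¬ x < y → y ≤ x
  ≮⇒≥ {x} {y} x≮y with compare x y
  ... | tri< x<y _ _ = contradiction x<y x≮y
  ... | tri≈ _ x≡y _ = inj₂ (sym x≡y)
  ... | tri> _ _ y<x = inj₁ y<x

  ≤-antisym : ∀ {x y} → x ≤ y → y ≤ x → x ≡ y
  ≤-antisym (inj₂ x≡y) _ = x≡y
  ≤-antisym (inj₁ x<y) y≤x = contradiction x<y (≤⇒≯ y≤x)

  ≤⇒0≤- : ∀ {x y} → x ≤ y → 0# ≤ y - x
  ≤⇒0≤- (inj₁ x<y) = inj₁ (<⇒0<- x<y)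
  ≤⇒0≤- {x} (inj₂ refl) = inj₂ (sym (-‿inverseʳ x))

  0≤-⇒≤ : ∀ {x y} → 0# ≤ y - x → x ≤ y
  0≤-⇒≤ (inj₁ p) = inj₁ (0<-⇒< p)
  0≤-⇒≤ {x} {y} (inj₂ e) = inj₂ (begin
    x            ≡⟨ +-identityʳ x ⟨
    x + 0#       ≡⟨ cong (x +_) e ⟩
    x + (y - x)  ≡⟨ solve 2 (λ x y → x :+ (y :- x) := y) refl x y ⟩
    y            ∎)
    where open ≡-Reasoning

  infix 2 _since≤_
  _since≤_ : ∀ {x y e} → 0# ≤ e → e ≡ y - x → x ≤ y
  0≤e since≤ e = 0≤-⇒≤ (subst (0# ≤_) e 0≤e)

  0≤-+ : ∀ {x y} → 0# ≤ x → 0# ≤ y → 0# ≤ x + y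
  0≤-+ {x} {y} (inj₁ 0<x) (inj₁ 0<y) = inj₁ (0<-+ 0<x 0<y)
  0≤-+ {x} {y} p (inj₂ refl) = subst (0# ≤_) (sym (+-identityʳ x)) p
  0≤-+ {x} {y} (inj₂ refl) q = subst (0# ≤_) (sym (+-identityˡ y)) q

  0<-+ʳ : ∀ {x y} → 0# < x → 0# ≤ y → 0# < x + y
  0<-+ʳ 0<x (inj₁ 0<y) = 0<-+ 0<x 0<y
  0<-+ʳ {x} 0<x (inj₂ refl) = subst (0# <_) (sym (+-identityʳ x)) 0<x

  0≤-* : ∀ {x y} → 0# ≤ x → 0# ≤ y → 0# ≤ x * y
  0≤-* (inj₁ 0<x) (inj₁ 0<y) = inj₁ (*-pos 0<x 0<y)
  0≤-* {x} _ (inj₂ refl) = inj₂ (sym (zeroʳ x))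
  0≤-* {y = y} (inj₂ refl) _ = inj₂ (sym (zeroˡ y))

  <0⇒0<- : ∀ {x} → x < 0# → 0# < - x
  <0⇒0<- {x} x<0 = subst (0# <_) (+-identityˡ (- x)) (<⇒0<- x<0)

  0<-square : ∀ {x} → x ≢ 0# → 0# < x * x
  0<-square {x} x≢0 with compare x 0#
  ... | tri< x<0 _ _ = subst (0# <_) (solve 1 (λ x → (:- x) :* (:- x) := x :* x) refl x)
                         (*-pos (<0⇒0<- x<0) (<0⇒0<- x<0))
  ... | tri≈ _ x≡0 _ = contradiction x≡0 x≢0
  ... | tri> _ _ 0<x = *-pos 0<x 0<x

  0≤-square : ∀ x → 0# ≤ x * x
  0≤-square x with em {P = x ≡ 0#}
  ... | yes refl = inj₂ (sym (zeroʳ 0#))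
  ... | no x≢0 = inj₁ (0<-square x≢0)

  0<1 : 0# < 1#
  0<1 = subst (0# <_) (*-identityʳ 1#) (0<-square (0≢1 ∘ sym))

  0<2 : 0# < 2#
  0<2 = 0<-+ 0<1 0<1

  0<3 : 0# < 3#
  0<3 = 0<-+ 0<2 0<1

  0<⇒≢0 : ∀ {x} → 0# < x → x ≢ 0#
  0<⇒≢0 0<x x≡0 = <-irrefl (sym x≡0) 0<x

  *-cancel-pos : ∀ {x y} → 0# < x → 0# < x * y → 0# < y
  *-cancel-pos {x} {y} 0<x 0<xy with compare y 0#
  ... | tri< y<0 _ _ = contradiction 0<xy (<-asym (*-pos 0<x (<0⇒0<- y<0) since
                         solve 2 (λ x y → x :* (:- y) := :0 :- x :* y) refl x y))
  ... | tri≈ _ refl _ = contradiction 0<xy (<-irrefl (sym (zeroʳ x)))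
  ... | tri> _ _ 0<y = 0<y

  *-monoʳ-< : ∀ {x y z} → 0# < x → y < z → x * y < x * z
  *-monoʳ-< {x} {y} {z} 0<x y<z = *-pos 0<x (<⇒0<- y<z) since
    solve 3 (λ x y z → x :* (z :- y) := x :* z :- x :* y) refl x y z

  x*y≡0⇒y≡0 : ∀ {x y} → x ≢ 0# → x * y ≡ 0# → y ≡ 0#
  x*y≡0⇒y≡0 {x} {y} x≢0 e = begin
    y                ≡⟨ *-identityˡ y ⟨
    1# * y           ≡⟨ cong (_* y) (⁻¹-inverse x x≢0) ⟨
    x * x ⁻¹ * y     ≡⟨ solve 3 (λ x i y → x :* i :* y := i :* (x :* y)) refl x (x ⁻¹) y ⟩
    x ⁻¹ * (x * y)   ≡⟨ cong (x ⁻¹ *_) e ⟩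
    x ⁻¹ * 0#        ≡⟨ zeroʳ (x ⁻¹) ⟩
    0#               ∎
    where open ≡-Reasoning

  ⁻¹-pos : ∀ {x} → 0# < x → 0# < x ⁻¹
  ⁻¹-pos {x} 0<x = *-cancel-pos 0<x (subst (0# <_) (sym (⁻¹-inverse x (0<⇒≢0 0<x))) 0<1)

  *-monoˡ-≤ : ∀ {a b c} → 0# ≤ c → a ≤ b → a * c ≤ b * c
  *-monoˡ-≤ {a} {b} {c} 0≤c a≤b = 0≤-* (≤⇒0≤- a≤b) 0≤c since≤
    solve 3 (λ a b c → (b :- a) :* c := b :* c :- a :* c) refl a b c

  *-monoʳ-≤ : ∀ {a b c} → 0# ≤ c → a ≤ b → c * a ≤ c * b
  *-monoʳ-≤ {a} {b} {c} 0≤c a≤b = subst₂ _≤_ (*-comm a c) (*-comm b c) (*-monoˡ-≤ 0≤c a≤b)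

  square-mono-< : ∀ {x y} → 0# ≤ x → x < y → x * x < y * y
  square-mono-< {x} {y} 0≤x x<y =
    *-pos (<⇒0<- x<y) (0<-+ʳ (≤-<-trans 0≤x x<y) 0≤x) since
    solve 2 (λ x y → (y :- x) :* (y :+ x) := y :* y :- x :* x) refl x y

  x-y≡0⇒x≡y : ∀ {x y} → x - y ≡ 0# → x ≡ y
  x-y≡0⇒x≡y {x} {y} e = begin
    x            ≡⟨ solve 2 (λ x y → x := (x :- y) :+ y) refl x y ⟩
    (x - y) + y  ≡⟨ cong (_+ y) e ⟩
    0# + y       ≡⟨ +-identityˡ y ⟩
    y            ∎
    where open ≡-Reasoning

  arbitrarily-small : ∀ {x} → (∀ ε → 0# < ε → x * x < ε * ε) → x ≡ 0#
  arbitrarily-small {x} small = by-contradiction λ x≢0 → case compare x 0# of λ where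
    (tri< x<0 _ _) → <-irrefl (solve 1 (λ x → x :* x := (:- x) :* (:- x)) refl x) (small (- x) (<0⇒0<- x<0))
    (tri≈ _ x≡0 _) → x≢0 x≡0
    (tri> _ _ 0<x) → <-irrefl refl (small x 0<x)

  sup-approx : ∀ {P : Carrier → Set} (ne : ∃ P) (bd : ∃ (UpperBound P)) {δ} → 0# < δ →
               ∃[ x ] P x × proj₁ (supremum P ne bd) - δ < x
  sup-approx {P} ne bd {δ} 0<δ = by-contradiction λ none →
    ≤⇒≯ (proj₂ (proj₂ (supremum P ne bd)) (s - δ) λ x Px → ≮⇒≥ λ lt → none (x , Px , lt))
      (0<δ since solve 2 (λ s δ → δ := s :- (s :- δ)) refl s δ)
    where s = proj₁ (supremum P ne bd)

  module Sqrt (r : Carrier) (0≤r : 0# ≤ r) where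

    Below : Carrier → Set
    Below x = 0# ≤ x × x * x ≤ r

    below-0 : Below 0#
    below-0 = ≤-refl , subst (_≤ r) (sym (zeroʳ 0#)) 0≤r

    -- The square of `1# + r` exceeds `r` by `1# + r + r * r`, so no distinction between small and
    -- large `r` is needed.
    bound : UpperBound Below (1# + r)
    bound x (_ , xx≤r) = ≮⇒≥ λ lt → ≤⇒≯ xx≤r
      (<-trans (0<-+ʳ (0<-+ʳ 0<1 0≤r) (0≤-square r) since
          solve 1 (λ r → (:1 :+ r) :+ r :* r := (:1 :+ r) :* (:1 :+ r) :- r) refl r)
        (square-mono-< (0≤-+ (inj₁ 0<1) 0≤r) lt))

    sup = supremum Below (0# , below-0) (1# + r , bound)
    s = proj₁ sup

    0≤s : 0# ≤ s
    0≤s = proj₁ (proj₂ sup) 0# below-0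

    ¬< : ¬ s * s < r
    ¬< ss<r = ≤⇒≯ (proj₁ (proj₂ sup) (s + δ) (0≤-+ 0≤s (inj₁ 0<δ) , inj₁ (below since refl)))
                (0<δ since solve 2 (λ s δ → δ := (s :+ δ) :- s) refl s δ)
      where
      d = r - s * s
      0<d = <⇒0<- ss<r
      K = 2# * s + 1#
      0<K : 0# < K
      0<K = subst (0# <_) (+-comm 1# (2# * s)) (0<-+ʳ 0<1 (0≤-* (inj₁ 0<2) 0≤s))
      0<d+K = 0<-+ 0<d 0<K
      -- Dividing by `d + K` and not by `K` makes `δ` smaller than one; since `δ * (d + K)` is `d`,
      -- the slack left below `r` is `δ * d + δ * (1# - δ)`.
      δ = d * (d + K) ⁻¹
      0<δ : 0# < δ
      0<δ = *-pos 0<d (⁻¹-pos 0<d+K)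
      δ[d+K]≡d : δ * (d + K) ≡ d
      δ[d+K]≡d = trans (solve 3 (λ d i e → d :* i :* e := d :* (e :* i)) refl d ((d + K) ⁻¹) (d + K))
        (trans (cong (d *_) (⁻¹-inverse (d + K) (0<⇒≢0 0<d+K))) (*-identityʳ d))
      0<1-δ : 0# < 1# - δ
      0<1-δ = *-cancel-pos 0<d+K (subst (0# <_) (begin
        K                             ≡⟨ solve 2 (λ d K → K := (d :+ K) :- d) refl d K ⟩
        (d + K) - d                   ≡⟨ cong (λ z → (d + K) - z) δ[d+K]≡d ⟨
        (d + K) - δ * (d + K)         ≡⟨ solve 2 (λ δ e → e :- δ :* e := e :* (:1 :- δ)) refl δ (d + K) ⟩
        (d + K) * (1# - δ)            ∎) 0<K)
        where open ≡-Reasoning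
      below : 0# < r - (s + δ) * (s + δ)
      below = subst (0# <_) (begin
        δ * d + δ * (1# - δ)                       ≡⟨ solve 3 (λ δ d s → δ :* d :+ δ :* (:1 :- δ) :=
             δ :* (d :+ (:2 :* s :+ :1)) :- δ :* (:2 :* s :+ δ)) refl δ d s ⟩
        δ * (d + K) - δ * (2# * s + δ)             ≡⟨ cong (_- δ * (2# * s + δ)) δ[d+K]≡d ⟩
        d - δ * (2# * s + δ)                       ≡⟨ solve 3 (λ δ r s → (r :- s :* s) :- δ :* (:2 :* s :+ δ) :=
             r :- (s :+ δ) :* (s :+ δ)) refl δ r s ⟩
        r - (s + δ) * (s + δ)                      ∎)
        (0<-+ (*-pos 0<δ 0<d) (*-pos 0<δ 0<1-δ))
        where open ≡-Reasoning

    ¬> : ¬ r < s * s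
    ¬> r<ss = ≤⇒≯ (proj₂ (proj₂ sup) (s - δ) λ x (_ , xx≤r) → ≮⇒≥ λ lt →
                  ≤⇒≯ xx≤r (<-trans above (square-mono-< 0≤s-δ lt)))
                (0<δ since solve 2 (λ s δ → δ := s :- (s :- δ)) refl s δ)
      where
      e = s * s - r
      0<e = <⇒0<- r<ss
      0<s : 0# < s
      0<s with 0≤s
      ... | inj₁ p = p
      ... | inj₂ 0≡s = contradiction r<ss (≤⇒≯ (subst (_≤ r) (trans (sym (zeroʳ 0#)) (cong₂ _*_ 0≡s 0≡s)) 0≤r))
      0<2s = *-pos 0<2 0<s
      -- The Newton step from `s`: the square of `s - δ` is `r + δ * δ`, still above `r`, and
      -- `2# * s * (s - δ)` is `s * s + r`.
      δ = e * (2# * s) ⁻¹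
      0<δ : 0# < δ
      0<δ = *-pos 0<e (⁻¹-pos 0<2s)
      2sδ≡e : 2# * s * δ ≡ e
      2sδ≡e = trans (solve 3 (λ t e i → t :* (e :* i) := e :* (t :* i)) refl (2# * s) e ((2# * s) ⁻¹))
        (trans (cong (e *_) (⁻¹-inverse (2# * s) (0<⇒≢0 0<2s))) (*-identityʳ e))
      above : r < (s - δ) * (s - δ)
      above = *-pos 0<δ 0<δ since (begin
        δ * δ                                             ≡⟨ solve 3 (λ s r δ → δ :* δ :=
             (s :- δ) :* (s :- δ) :- (s :* s :- :2 :* s :* δ)) refl s r δ ⟩
        (s - δ) * (s - δ) - (s * s - 2# * s * δ)          ≡⟨ cong (λ z → (s - δ) * (s - δ) - (s * s - z)) 2sδ≡e ⟩
        (s - δ) * (s - δ) - (s * s - (s * s - r))         ≡⟨ solve 3 (λ s r δ →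
             (s :- δ) :* (s :- δ) :- (s :* s :- (s :* s :- r)) := (s :- δ) :* (s :- δ) :- r) refl s r δ ⟩
        (s - δ) * (s - δ) - r                             ∎)
        where open ≡-Reasoning
      0≤s-δ : 0# ≤ s - δ
      0≤s-δ = inj₁ (*-cancel-pos 0<2s (subst (0# <_) (begin
        s * s + r                        ≡⟨ solve 2 (λ s r → s :* s :+ r := :2 :* s :* s :- (s :* s :- r)) refl s r ⟩
        2# * s * s - (s * s - r)         ≡⟨ cong (λ z → 2# * s * s - z) 2sδ≡e ⟨
        2# * s * s - 2# * s * δ          ≡⟨ solve 2 (λ s δ → :2 :* s :* s :- :2 :* s :* δ := :2 :* s :* (s :- δ)) refl s δ ⟩
        2# * s * (s - δ)                 ∎) (0<-+ʳ (*-pos 0<s 0<s) 0≤r)))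
        where open ≡-Reasoning

    square : s * s ≡ r
    square with compare (s * s) r
    ... | tri< p _ _ = contradiction p ¬<
    ... | tri≈ _ e _ = e
    ... | tri> _ _ p = contradiction p ¬>

  abstract
    sqrt : ∀ r → 0# ≤ r → ∃[ s ] 0# ≤ s × s * s ≡ r
    sqrt r 0≤r = s , 0≤s , square
      where open Sqrt r 0≤r

  fromℕ : ℕ → Carrier
  fromℕ zero    = 0#
  fromℕ (suc n) = fromℕ n + 1#

  -- A supremum of the naturals would be exceeded by the successor of a natural that is within one
  -- of it.
  archimedean : ∀ x → ∃[ n ] x < fromℕ n
  archimedean x = by-contradiction λ none →
    let Nat y = ∃[ n ] fromℕ n ≡ y
        ne = 0# , 0 , refl
        bd = x , λ where y (n , refl) → ≮⇒≥ λ lt → none (n , lt)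
        s , ub , _ = supremum Nat ne bd
        y , (n , e) , lt = sup-approx {Nat} ne bd 0<1
    in ≤⇒≯ (ub (fromℕ (suc n)) (suc n , refl))
         (<⇒0<- (subst (s - 1# <_) (sym e) lt) since
           solve 2 (λ n s → n :- (s :- :1) := (n :+ :1) :- s) refl (fromℕ n) s)

  floor : ∀ x → 0# ≤ x → ∃[ n ] x < fromℕ n × fromℕ n ≤ x + 1#
  floor x 0≤x = go (proj₁ (archimedean x)) (proj₂ (archimedean x))
    where
    go : ∀ n → x < fromℕ n → ∃[ n ] x < fromℕ n × fromℕ n ≤ x + 1#
    go zero lt = contradiction lt (≤⇒≯ 0≤x)
    go (suc n) lt with em {P = x < fromℕ n}
    ... | yes lt′ = go n lt′
    ... | no ≮ = suc n , lt , (≤⇒0≤- (≮⇒≥ ≮) since≤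
                   solve 2 (λ n x → x :- n := (x :+ :1) :- (n :+ :1)) refl (fromℕ n) x)

  -- The rational number (a - b) / c lies above r.
  Above : ℕ → ℕ → ℕ → Carrier → Set
  Above a b c r = fromℕ b + r * fromℕ c < fromℕ a

  -- `c` stretches the interval from `r` to `s` to a length above one, `b` shifts its left end into
  -- the positive reals, and `a` is the first natural beyond that end.
  separate : ∀ {r s} → r < s → ∃[ a ] ∃[ b ] ∃[ c ] Above a b c r × ¬ Above a b c s
  separate {r} {s} r<s = a , b , c , y<a , λ lt → <-irrefl refl (<-trans a<b+sc lt)
    where
    0<s-r = <⇒0<- r<s
    c = proj₁ (archimedean ((s - r) ⁻¹))
    C = fromℕ c
    1<[s-r]c : 1# < (s - r) * C
    1<[s-r]c = subst (_< (s - r) * C) (⁻¹-inverse (s - r) (0<⇒≢0 0<s-r))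
                 (*-monoʳ-< 0<s-r (proj₂ (archimedean ((s - r) ⁻¹))))
    b = proj₁ (archimedean (- (r * C)))
    y = fromℕ b + r * C
    0<y : 0# < y
    0<y = subst (0# <_) (solve 2 (λ b z → b :- (:- z) := b :+ z) refl (fromℕ b) (r * C))
            (<⇒0<- (proj₂ (archimedean (- (r * C)))))
    a = proj₁ (floor y (inj₁ 0<y))
    y<a = proj₁ (proj₂ (floor y (inj₁ 0<y)))
    a<b+sc : fromℕ a < fromℕ b + s * C
    a<b+sc = ≤-<-trans (proj₂ (proj₂ (floor y (inj₁ 0<y)))) (<⇒0<- 1<[s-r]c since
      solve 4 (λ r s b c → (s :- r) :* c :- :1 := (b :+ s :* c) :- ((b :+ r :* c) :+ :1)) refl r s (fromℕ b) C)

  module _ (f : ℕ → Carrier) where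
    -- Collects the upper cuts of all `f k` in one set of naturals, so that a sequence of reals
    -- becomes one sequence of bits.
    Coded : ℕ → Set
    Coded n = Σ[ k ∈ ℕ ] ∃[ a ] ∃[ b ] ∃[ c ] pair k (pair a (pair b c)) ≡ n × Above a b c (f k)

    encode : ℕ → Bool
    encode n = isYes (em {P = Coded n})

  Coded-pair : ∀ f {k a b c} → Coded f (pair k (pair a (pair b c))) → Above a b c (f k)
  Coded-pair f {k} {a} {b} {c} (k′ , a′ , b′ , c′ , e , p)
    with refl , e₁ ← pair-injective k′ _ {k} e
    with refl , e₂ ← pair-injective a′ _ {a} e₁
    with refl , refl ← pair-injective b′ c′ {b} {c} e₂ = p

  encode-transfer : ∀ {f g} → encode f ≡ encode g → ∀ {k a b c} → Above a b c (f k) → Above a b c (g k)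
  encode-transfer {f} {g} e {k} {a} {b} {c} p = Coded-pair g (toWitness {a? = em}
    (subst T (cong-app e n) (fromWitness {a? = em} (k , a , b , c , refl , p))))
    where n = pair k (pair a (pair b c))

  encode-injective : Injective _≡_ _≡_ encode
  encode-injective {f} {g} e = ext λ k → case compare (f k) (g k) of λ where
    (tri< lt _ _) → let a , b , c , p , q = separate lt in
                    contradiction (encode-transfer {f} {g} e {k} {a} {b} {c} p) q
    (tri≈ _ eq _) → eq
    (tri> _ _ gt) → let a , b , c , p , q = separate gt in
                    contradiction (encode-transfer {g} {f} (sym e) {k} {a} {b} {c} p) q

  fromBool : Bool → Carrier
  fromBool false = 0#
  fromBool true  = 1#

  0≤fromBool : ∀ b → 0# ≤ fromBool b
  0≤fromBool false = ≤-refl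
  0≤fromBool true  = inj₁ 0<1

  ⅓ : Carrier
  ⅓ = 3# ⁻¹

  0<⅓ : 0# < ⅓
  0<⅓ = ⁻¹-pos 0<3

  3*⅓ : 3# * ⅓ ≡ 1#
  3*⅓ = ⁻¹-inverse 3# (0<⇒≢0 0<3)

  -- Horner form of the sum of `β k` over the powers of three. Digits zero and one in base three
  -- leave no two expansions with the same value.
  partial : ℕ → (ℕ → Bool) → Carrier
  partial zero    β = 0#
  partial (suc n) β = fromBool (β 0) + ⅓ * partial n (β ∘ suc)

  fromBool≤1 : ∀ b → fromBool b ≤ 1#
  fromBool≤1 false = inj₁ 0<1
  fromBool≤1 true  = ≤-refl

  -- The sharp bound is three halves, but two is easier to write and is also preserved, with `⅓` to
  -- spare.
  partial≤2 : ∀ n β → partial n β ≤ 2#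
  partial≤2 zero    β = inj₁ 0<2
  partial≤2 (suc n) β = 0≤-+ (0≤-+ (≤⇒0≤- (fromBool≤1 (β 0)))
      (0≤-* (inj₁ 0<⅓) (≤⇒0≤- (partial≤2 n (β ∘ suc))))) (inj₁ 0<⅓) since≤ (begin
    (1# - b) + ⅓ * (2# - p) + ⅓       ≡⟨ solve 3 (λ b t p → (:1 :- b) :+ t :* (:2 :- p) :+ t :=
                                           (:1 :+ :3 :* t) :- (b :+ t :* p)) refl b ⅓ p ⟩
    (1# + 3# * ⅓) - (b + ⅓ * p)       ≡⟨ cong (λ z → (1# + z) - (b + ⅓ * p)) 3*⅓ ⟩
    2# - (b + ⅓ * p)                  ∎)
    where
    open ≡-Reasoning
    b = fromBool (β 0)
    p = partial n (β ∘ suc)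

  Partial : (ℕ → Bool) → Carrier → Set
  Partial β x = ∃[ n ] partial n β ≡ x

  cantor-sup : ∀ β → Σ[ s ∈ Carrier ] UpperBound (Partial β) s × (∀ u → UpperBound (Partial β) u → s ≤ u)
  cantor-sup β = supremum (Partial β) (0# , 0 , refl) (2# , λ where _ (n , refl) → partial≤2 n β)

  cantor : (ℕ → Bool) → Carrier
  cantor β = proj₁ (cantor-sup β)

  partial≤cantor : ∀ n β → partial n β ≤ cantor β
  partial≤cantor n β = proj₁ (proj₂ (cantor-sup β)) _ (n , refl)

  cantor≤ : ∀ β {u} → (∀ n → partial n β ≤ u) → cantor β ≤ u
  cantor≤ β ub = proj₂ (proj₂ (cantor-sup β)) _ λ where _ (n , refl) → ub n

  0≤cantor : ∀ β → 0# ≤ cantor β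
  0≤cantor = partial≤cantor 0

  cantor≤2 : ∀ β → cantor β ≤ 2#
  cantor≤2 β = cantor≤ β λ n → partial≤2 n β

  -- Passes the recursion of the partial sums to the supremum, after which digits can be compared
  -- without limits.
  cantor-step : ∀ β → cantor β ≡ fromBool (β 0) + ⅓ * cantor (β ∘ suc)
  cantor-step β = ≤-antisym (cantor≤ β upper) lower
    where
    open ≡-Reasoning
    b = fromBool (β 0)
    c′ = cantor (β ∘ suc)
    upper : ∀ n → partial n β ≤ b + ⅓ * c′
    upper zero = 0≤-+ (0≤fromBool (β 0)) (0≤-* (inj₁ 0<⅓) (0≤cantor (β ∘ suc)))
    upper (suc n) = 0≤-* (inj₁ 0<⅓) (≤⇒0≤- (partial≤cantor n (β ∘ suc))) since≤
      solve 4 (λ b t p c → t :* (c :- p) := (b :+ t :* c) :- (b :+ t :* p)) refl b ⅓ (partial n (β ∘ suc)) c′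
    lower : b + ⅓ * c′ ≤ cantor β
    lower = 0≤-* (inj₁ 0<⅓) (≤⇒0≤- (cantor≤ (β ∘ suc) λ n →
        0≤-* (inj₁ 0<3) (≤⇒0≤- (partial≤cantor (suc n) β)) since≤ (begin
          3# * (cantor β - (b + ⅓ * partial n (β ∘ suc)))   ≡⟨ solve 4 (λ c b t p →
               :3 :* (c :- (b :+ t :* p)) := :3 :* (c :- b) :- (:3 :* t) :* p) refl (cantor β) b ⅓ (partial n (β ∘ suc)) ⟩
          3# * (cantor β - b) - 3# * ⅓ * partial n (β ∘ suc) ≡⟨ cong (λ z → 3# * (cantor β - b) - z)
               (trans (cong (_* partial n (β ∘ suc)) 3*⅓) (*-identityˡ _)) ⟩
          3# * (cantor β - b) - partial n (β ∘ suc)          ∎))) since≤ (begin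
      ⅓ * (3# * (cantor β - b) - c′)            ≡⟨ solve 4 (λ c b t p →
           t :* (:3 :* (c :- b) :- p) := (:3 :* t) :* (c :- b) :- t :* p) refl (cantor β) b ⅓ c′ ⟩
      3# * ⅓ * (cantor β - b) - ⅓ * c′          ≡⟨ cong (λ z → z * (cantor β - b) - ⅓ * c′) 3*⅓ ⟩
      1# * (cantor β - b) - ⅓ * c′              ≡⟨ solve 4 (λ c b t p →
           :1 :* (c :- b) :- t :* p := c :- (b :+ t :* p)) refl (cantor β) b ⅓ c′ ⟩
      cantor β - (b + ⅓ * c′)                   ∎)

  ⅓*cantor<1 : ∀ β → ⅓ * cantor β < 1#
  ⅓*cantor<1 β = 0<-+ʳ 0<⅓ (0≤-* (inj₁ 0<⅓) (≤⇒0≤- (cantor≤2 β))) since (begin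
    ⅓ + ⅓ * (2# - cantor β)     ≡⟨ solve 2 (λ t c → t :+ t :* (:2 :- c) := :3 :* t :- t :* c) refl ⅓ (cantor β) ⟩
    3# * ⅓ - ⅓ * cantor β       ≡⟨ cong (_- ⅓ * cantor β) 3*⅓ ⟩
    1# - ⅓ * cantor β           ∎)
    where open ≡-Reasoning

  -- A tail scaled by `⅓` stays below one, so it cannot make up for a missing leading digit.
  leading-digit : ∀ β γ → β 0 ≡ true → γ 0 ≡ false → cantor β ≢ cantor γ
  leading-digit β γ eβ eγ e = <-irrefl (sym e) (≤-<-trans
    (inj₂ (trans (cantor-step γ) (trans (cong (λ b → fromBool b + ⅓ * cantor (γ ∘ suc)) eγ) (+-identityˡ _))))
    (<-≤-trans (⅓*cantor<1 (γ ∘ suc))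
      (0≤-* (inj₁ 0<⅓) (0≤cantor (β ∘ suc)) since≤
        trans (solve 1 (λ z → z := (:1 :+ z) :- :1) refl _)
          (cong (_- 1#) (trans (cong (λ b → fromBool b + ⅓ * cantor (β ∘ suc)) (sym eβ)) (sym (cantor-step β)))))))

  cantor-head : ∀ {β γ} → cantor β ≡ cantor γ → β 0 ≡ γ 0
  cantor-head {β} {γ} e with β 0 in eβ | γ 0 in eγ
  ... | true  | true  = refl
  ... | false | false = refl
  ... | true  | false = contradiction e (leading-digit β γ eβ eγ)
  ... | false | true  = contradiction (sym e) (leading-digit γ β eγ eβ)

  cantor-tail : ∀ {β γ} → cantor β ≡ cantor γ → cantor (β ∘ suc) ≡ cantor (γ ∘ suc)
  cantor-tail {β} {γ} e = x-y≡0⇒x≡y (x*y≡0⇒y≡0 (0<⇒≢0 0<⅓) (begin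
    ⅓ * (c - c′)                            ≡⟨ solve 4 (λ b t c c′ → t :* (c :- c′) := (b :+ t :* c) :- (b :+ t :* c′)) refl b ⅓ c c′ ⟩
    (b + ⅓ * c) - (b + ⅓ * c′)              ≡⟨ cong₂ _-_ (sym (cantor-step β))
                                                 (trans (cong (λ z → fromBool z + ⅓ * c′) (cantor-head {β} {γ} e)) (sym (cantor-step γ))) ⟩
    cantor β - cantor γ                     ≡⟨ cong (_- cantor γ) e ⟩
    cantor γ - cantor γ                     ≡⟨ -‿inverseʳ (cantor γ) ⟩
    0#                                      ∎))
    where
    open ≡-Reasoning
    b = fromBool (β 0)
    c = cantor (β ∘ suc)
    c′ = cantor (γ ∘ suc)

  cantor-digit : ∀ n {β γ} → cantor β ≡ cantor γ → β n ≡ γ n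
  cantor-digit zero    {β} {γ} e = cantor-head {β} {γ} e
  cantor-digit (suc n) {β} {γ} e = cantor-digit n {β ∘ suc} {γ ∘ suc} (cantor-tail {β} {γ} e)

  cantor-injective : Injective _≡_ _≡_ cantor
  cantor-injective {β} {γ} e = ext λ n → cantor-digit n {β} {γ} e

-- Hilbert space geometry: orthogonal series, projections, Gram-Schmidt and shifts

module HilbertGeometry (em : ∀ {ℓ} → ExcludedMiddle ℓ) (ext : ∀ {a b} → Extensionality a b)
                       (ℝ : CompleteOrderedField) (H : HilbertSpace ℝ) where

  open Classical em ext
  open CompleteOrderedField ℝ
  open RealField em ext ℝ
  open HilbertSpace H public
    using (V; 0ⱽ; _•_; ⟨_,_⟩; isLeftModule; ⟨⟩-sym; ⟨⟩-+; ⟨⟩-•; ⟨⟩-pos; Within; Cauchy; _⟶_; complete)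
    renaming (_+_ to _⊕_; -_ to ⊖_; _-_ to _⊝_)
  private
    module 𝕍 = IsLeftModule isLeftModule
    +-group : Group _ _
    +-group = record { isGroup = 𝕍.+ᴹ-isGroup }

  ⟨0,⟩ : ∀ w → ⟨ 0ⱽ , w ⟩ ≡ 0#
  ⟨0,⟩ w = trans (cong ⟨_, w ⟩ (sym (𝕍.*ₗ-zeroˡ 0ⱽ))) (trans (⟨⟩-• 0# 0ⱽ w) (zeroˡ _))

  ⟨,0⟩ : ∀ w → ⟨ w , 0ⱽ ⟩ ≡ 0#
  ⟨,0⟩ w = trans (⟨⟩-sym w 0ⱽ) (⟨0,⟩ w)

  ⟨⊕⟩ʳ : ∀ w u v → ⟨ w , u ⊕ v ⟩ ≡ ⟨ w , u ⟩ + ⟨ w , v ⟩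
  ⟨⊕⟩ʳ w u v = trans (⟨⟩-sym w (u ⊕ v)) (trans (⟨⟩-+ u v w) (cong₂ _+_ (⟨⟩-sym u w) (⟨⟩-sym v w)))

  ⟨•⟩ʳ : ∀ r w v → ⟨ w , r • v ⟩ ≡ r * ⟨ w , v ⟩
  ⟨•⟩ʳ r w v = trans (⟨⟩-sym w (r • v)) (trans (⟨⟩-• r v w) (cong (r *_) (⟨⟩-sym v w)))

  ⟨⊖⟩ˡ : ∀ v w → ⟨ ⊖ v , w ⟩ ≡ - ⟨ v , w ⟩
  ⟨⊖⟩ˡ v w = begin
    ⟨ ⊖ v , w ⟩                              ≡⟨ solve 2 (λ a b → b := (a :+ b) :- a) refl ⟨ v , w ⟩ ⟨ ⊖ v , w ⟩ ⟩
    (⟨ v , w ⟩ + ⟨ ⊖ v , w ⟩) - ⟨ v , w ⟩    ≡⟨ cong (_- ⟨ v , w ⟩) (⟨⟩-+ v (⊖ v) w) ⟨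
    ⟨ v ⊝ v , w ⟩ - ⟨ v , w ⟩                ≡⟨ cong (λ z → ⟨ z , w ⟩ - ⟨ v , w ⟩) (𝕍.-ᴹ‿inverseʳ v) ⟩
    ⟨ 0ⱽ , w ⟩ - ⟨ v , w ⟩                   ≡⟨ cong (_- ⟨ v , w ⟩) (⟨0,⟩ w) ⟩
    0# - ⟨ v , w ⟩                           ≡⟨ +-identityˡ _ ⟩
    - ⟨ v , w ⟩                              ∎
    where open ≡-Reasoning

  ⟨⊖⟩ʳ : ∀ w v → ⟨ w , ⊖ v ⟩ ≡ - ⟨ w , v ⟩
  ⟨⊖⟩ʳ w v = trans (⟨⟩-sym w (⊖ v)) (trans (⟨⊖⟩ˡ v w) (cong -_ (⟨⟩-sym v w)))

  ⟨⊖,⊖⟩ : ∀ v w → ⟨ ⊖ v , ⊖ w ⟩ ≡ ⟨ v , w ⟩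
  ⟨⊖,⊖⟩ v w = trans (⟨⊖⟩ˡ v (⊖ w)) (trans (cong -_ (⟨⊖⟩ʳ v w)) (solve 1 (λ x → :- (:- x) := x) refl ⟨ v , w ⟩))

  ⟨⊝⟩ˡ : ∀ u v w → ⟨ u ⊝ v , w ⟩ ≡ ⟨ u , w ⟩ - ⟨ v , w ⟩
  ⟨⊝⟩ˡ u v w = trans (⟨⟩-+ u (⊖ v) w) (cong (⟨ u , w ⟩ +_) (⟨⊖⟩ˡ v w))

  ⟨⊝⟩ʳ : ∀ w u v → ⟨ w , u ⊝ v ⟩ ≡ ⟨ w , u ⟩ - ⟨ w , v ⟩
  ⟨⊝⟩ʳ w u v = trans (⟨⊕⟩ʳ w u (⊖ v)) (cong (⟨ w , u ⟩ +_) (⟨⊖⟩ʳ w v))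

  ‖_‖² : V → Carrier
  ‖ v ‖² = ⟨ v , v ⟩

  ‖⊝‖² : ∀ u v → ‖ u ⊝ v ‖² ≡ ‖ u ‖² - 2# * ⟨ u , v ⟩ + ‖ v ‖²
  ‖⊝‖² u v = begin
    ⟨ u ⊝ v , u ⊝ v ⟩                                          ≡⟨ ⟨⊝⟩ˡ u v (u ⊝ v) ⟩
    ⟨ u , u ⊝ v ⟩ - ⟨ v , u ⊝ v ⟩                              ≡⟨ cong₂ _-_ (⟨⊝⟩ʳ u u v) (⟨⊝⟩ʳ v u v) ⟩
    (⟨ u , u ⟩ - ⟨ u , v ⟩) - (⟨ v , u ⟩ - ⟨ v , v ⟩)          ≡⟨ cong (λ z → (⟨ u , u ⟩ - ⟨ u , v ⟩) - (z - ⟨ v , v ⟩)) (⟨⟩-sym v u) ⟩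
    (⟨ u , u ⟩ - ⟨ u , v ⟩) - (⟨ u , v ⟩ - ⟨ v , v ⟩)          ≡⟨ solve 3 (λ a b c → (a :- b) :- (b :- c) := a :- :2 :* b :+ c) refl ⟨ u , u ⟩ ⟨ u , v ⟩ ⟨ v , v ⟩ ⟩
    ‖ u ‖² - 2# * ⟨ u , v ⟩ + ‖ v ‖²                           ∎
    where open ≡-Reasoning

  ‖⊕‖² : ∀ u v → ‖ u ⊕ v ‖² ≡ ‖ u ‖² + 2# * ⟨ u , v ⟩ + ‖ v ‖²
  ‖⊕‖² u v = begin
    ⟨ u ⊕ v , u ⊕ v ⟩                                          ≡⟨ ⟨⟩-+ u v (u ⊕ v) ⟩
    ⟨ u , u ⊕ v ⟩ + ⟨ v , u ⊕ v ⟩                              ≡⟨ cong₂ _+_ (⟨⊕⟩ʳ u u v) (⟨⊕⟩ʳ v u v) ⟩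
    (⟨ u , u ⟩ + ⟨ u , v ⟩) + (⟨ v , u ⟩ + ⟨ v , v ⟩)          ≡⟨ cong (λ z → (⟨ u , u ⟩ + ⟨ u , v ⟩) + (z + ⟨ v , v ⟩)) (⟨⟩-sym v u) ⟩
    (⟨ u , u ⟩ + ⟨ u , v ⟩) + (⟨ u , v ⟩ + ⟨ v , v ⟩)          ≡⟨ solve 3 (λ a b c → (a :+ b) :+ (b :+ c) := a :+ :2 :* b :+ c) refl ⟨ u , u ⟩ ⟨ u , v ⟩ ⟨ v , v ⟩ ⟩
    ‖ u ‖² + 2# * ⟨ u , v ⟩ + ‖ v ‖²                           ∎
    where open ≡-Reasoning

  ‖‖²≡0 : ∀ {v} → ‖ v ‖² ≡ 0# → v ≡ 0ⱽ
  ‖‖²≡0 {v} e = by-contradiction λ v≢0 → <-irrefl (sym e) (⟨⟩-pos v v≢0)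

  abstract
    0≤‖‖² : ∀ v → 0# ≤ ‖ v ‖²
    0≤‖‖² v with em {P = v ≡ 0ⱽ}
    ... | yes refl = inj₂ (sym (⟨0,⟩ 0ⱽ))
    ... | no v≢0 = inj₁ (⟨⟩-pos v v≢0)

  ⊝≡0 : ∀ {u v} → u ⊝ v ≡ 0ⱽ → u ≡ v
  ⊝≡0 {u} {v} = x∙y⁻¹≈ε⇒x≈y u v
    where open Algebra.Properties.Group +-group

  ‖⊝‖²≡0 : ∀ {u v} → ‖ u ⊝ v ‖² ≡ 0# → u ≡ v
  ‖⊝‖²≡0 e = ⊝≡0 (‖‖²≡0 e)

  -- Turns identities between vectors into identities between reals, where the ring solver applies.
  V-ext : ∀ {u v} → (∀ z → ⟨ u , z ⟩ ≡ ⟨ v , z ⟩) → u ≡ v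
  V-ext {u} {v} e = ‖⊝‖²≡0 (trans (⟨⊝⟩ˡ u v (u ⊝ v))
    (trans (cong (_- ⟨ v , u ⊝ v ⟩) (e (u ⊝ v))) (-‿inverseʳ _)))

  Cauchy-Schwarz : ∀ u v → ⟨ u , v ⟩ * ⟨ u , v ⟩ ≤ ‖ u ‖² * ‖ v ‖²
  Cauchy-Schwarz u v with em {P = v ≡ 0ⱽ}
  ... | yes refl = inj₂ (trans (cong₂ _*_ (⟨,0⟩ u) (⟨,0⟩ u)) (trans (zeroʳ 0#)
                     (sym (trans (cong (‖ u ‖² *_) (⟨0,⟩ 0ⱽ)) (zeroʳ _)))))
  ... | no v≢0 = 0≤-⇒≤ (case 0≤‖‖² w of λ where
      (inj₁ 0<w) → inj₁ (*-cancel-pos 0<q (subst (0# <_) expand 0<w))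
      (inj₂ 0≡w) → inj₂ (sym (x*y≡0⇒y≡0 (0<⇒≢0 0<q) (sym (trans 0≡w expand)))))
    where
    open ≡-Reasoning
    p = ⟨ u , v ⟩
    q = ‖ v ‖²
    0<q = ⟨⟩-pos v v≢0
    -- The component of `u` orthogonal to `v`, multiplied by `q` to avoid a division.
    w = q • u ⊝ p • v
    expand : ‖ w ‖² ≡ q * (‖ u ‖² * q - p * p)
    expand = begin
      ‖ w ‖²                                                            ≡⟨ ‖⊝‖² (q • u) (p • v) ⟩
      ⟨ q • u , q • u ⟩ - 2# * ⟨ q • u , p • v ⟩ + ⟨ p • v , p • v ⟩     ≡⟨ cong₂ _+_ (cong₂ (λ x y → x - 2# * y)
          (trans (⟨⟩-• q u _) (cong (q *_) (⟨•⟩ʳ q u u))) (trans (⟨⟩-• q u _) (cong (q *_) (⟨•⟩ʳ p u v))))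
          (trans (⟨⟩-• p v _) (cong (p *_) (⟨•⟩ʳ p v v))) ⟩
      q * (q * ‖ u ‖²) - 2# * (q * (p * p)) + p * (p * q)                ≡⟨ solve 3 (λ q p a →
          q :* (q :* a) :- :2 :* (q :* (p :* p)) :+ p :* (p :* q) := q :* (a :* q :- p :* p)) refl q p ‖ u ‖² ⟩
      q * (‖ u ‖² * q - p * p)                                           ∎

  -- The hypothesis is used at `ε` divided by `1# + K`: the square of `1# + K` exceeds `K` by
  -- `1# + K + K * K`.
  small-multiples : ∀ {x K} → 0# ≤ K → (∀ ε → 0# < ε → x * x ≤ K * (ε * ε)) → x ≡ 0#
  small-multiples {x} {K} 0≤K small = arbitrarily-small λ ε 0<ε →
    ≤-<-trans (small (ε * i) (*-pos 0<ε 0<i)) (*-pos (*-pos 0<ε 0<ε)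
      (*-pos (0<-+ʳ (0<-+ʳ 0<1 0≤K) (0≤-square K)) (*-pos 0<i 0<i)) since (begin
        ε * ε * ((1# + K + K * K) * (i * i))                    ≡⟨ solve 3 (λ ε K i →
           ε :* ε :* ((:1 :+ K :+ K :* K) :* (i :* i)) :=
           ε :* ε :* (((:1 :+ K) :* i) :* ((:1 :+ K) :* i)) :- K :* ((ε :* i) :* (ε :* i))) refl ε K i ⟩
        ε * ε * ((1# + K) * i * ((1# + K) * i)) - K * (ε * i * (ε * i))  ≡⟨ cong (_- K * (ε * i * (ε * i)))
           (trans (cong (λ z → ε * ε * (z * z)) 1+K*i) (solve 1 (λ e → e :* (:1 :* :1) := e) refl (ε * ε))) ⟩
        ε * ε - K * (ε * i * (ε * i))                            ∎))
    where
    open ≡-Reasoning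
    0<1+K = 0<-+ʳ 0<1 0≤K
    i = (1# + K) ⁻¹
    0<i = ⁻¹-pos 0<1+K
    1+K*i = ⁻¹-inverse (1# + K) (0<⇒≢0 0<1+K)

  square-⊕≤ : ∀ x y → (x - y) * (x - y) ≤ 2# * (x * x + y * y)
  square-⊕≤ x y = 0≤-square (x + y) since≤
    solve 2 (λ x y → (x :+ y) :* (x :+ y) := :2 :* (x :* x :+ y :* y) :- (x :- y) :* (x :- y)) refl x y

  -- With two sequences and two test vectors, one lemma both evaluates a limit against a constant
  -- sequence and compares two series term by term.
  ⟨⟩-continuous : ∀ {x y l m} z z′ → x ⟶ l → y ⟶ m →
                  ∃[ N ] (∀ n → N ℕ.≤ n → ⟨ x n , z ⟩ ≡ ⟨ y n , z′ ⟩) → ⟨ l , z ⟩ ≡ ⟨ m , z′ ⟩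
  ⟨⟩-continuous {x} {y} {l} {m} z z′ x→l y→m (N , agree) = sym (x-y≡0⇒x≡y (small-multiples {K = K} 0≤K λ ε 0<ε →
      let N₁ , near₁ = x→l ε 0<ε
          N₂ , near₂ = y→m ε 0<ε
          n = N ℕ.+ (N₁ ℕ.+ N₂)
          A = ⟨ x n ⊝ l , z ⟩
          B = ⟨ y n ⊝ m , z′ ⟩
          A≤ : A * A ≤ ε * ε * ‖ z ‖²
          A≤ = ≤-trans (Cauchy-Schwarz (x n ⊝ l) z) (*-monoˡ-≤ (0≤‖‖² z)
                 (inj₁ (near₁ n (ℕ.≤-trans (ℕ.m≤m+n N₁ N₂) (ℕ.m≤n+m _ N)))))
          B≤ : B * B ≤ ε * ε * ‖ z′ ‖²
          B≤ = ≤-trans (Cauchy-Schwarz (y n ⊝ m) z′) (*-monoˡ-≤ (0≤‖‖² z′)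
                 (inj₁ (near₂ n (ℕ.≤-trans (ℕ.m≤n+m N₂ N₁) (ℕ.m≤n+m _ N)))))
          eq : A - B ≡ ⟨ m , z′ ⟩ - ⟨ l , z ⟩
          eq = trans (cong₂ _-_ (⟨⊝⟩ˡ (x n) l z) (⟨⊝⟩ˡ (y n) m z′))
                 (trans (cong (λ w → (w - ⟨ l , z ⟩) - (⟨ y n , z′ ⟩ - ⟨ m , z′ ⟩)) (agree n (ℕ.m≤m+n N _)))
                 (solve 3 (λ w a b → (w :- a) :- (w :- b) := b :- a) refl ⟨ y n , z′ ⟩ ⟨ l , z ⟩ ⟨ m , z′ ⟩))
      in subst (λ w → w * w ≤ K * (ε * ε)) eq (≤-trans (square-⊕≤ A B)
           (0≤-* (inj₁ 0<2) (0≤-+ (≤⇒0≤- A≤) (≤⇒0≤- B≤)) since≤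
             solve 5 (λ A B e a b → :2 :* ((e :* a :- A) :+ (e :* b :- B)) :=
               :2 :* (a :+ b) :* e :- :2 :* (A :+ B)) refl (A * A) (B * B) (ε * ε) ‖ z ‖² ‖ z′ ‖²))))
    where
    K = 2# * (‖ z ‖² + ‖ z′ ‖²)
    0≤K = 0≤-* (inj₁ 0<2) (0≤-+ (0≤‖‖² z) (0≤‖‖² z′))

  abstract
    root : V → Carrier
    root v = proj₁ (sqrt ‖ v ‖² (0≤‖‖² v))

    root² : ∀ v → root v * root v ≡ ‖ v ‖²
    root² v = proj₂ (proj₂ (sqrt ‖ v ‖² (0≤‖‖² v)))

  root≢0 : ∀ {v} → v ≢ 0ⱽ → root v ≢ 0#
  root≢0 {v} v≢0 e = v≢0 (‖‖²≡0 (trans (sym (root² v)) (trans (cong₂ _*_ e e) (zeroʳ 0#))))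

  -- The zero vector stays zero, so linear dependence needs no separate treatment in Gram-Schmidt.
  normalise : V → V
  normalise v = root v ⁻¹ • v

  ‖normalise‖² : ∀ {v} → v ≢ 0ⱽ → ‖ normalise v ‖² ≡ 1#
  ‖normalise‖² {v} v≢0 = begin
    ⟨ r ⁻¹ • v , r ⁻¹ • v ⟩        ≡⟨ trans (⟨⟩-• _ v _) (cong (r ⁻¹ *_) (⟨•⟩ʳ _ v v)) ⟩
    r ⁻¹ * (r ⁻¹ * ‖ v ‖²)         ≡⟨ cong (λ z → r ⁻¹ * (r ⁻¹ * z)) (root² v) ⟨
    r ⁻¹ * (r ⁻¹ * (r * r))        ≡⟨ solve 2 (λ r i → i :* (i :* (r :* r)) := (r :* i) :* (r :* i)) refl r (r ⁻¹) ⟩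
    (r * r ⁻¹) * (r * r ⁻¹)        ≡⟨ cong (λ z → z * z) (⁻¹-inverse r (root≢0 v≢0)) ⟩
    1# * 1#                        ≡⟨ *-identityˡ 1# ⟩
    1#                             ∎
    where
    open ≡-Reasoning
    r = root v

  normalise-0 : ∀ {v} → v ≡ 0ⱽ → normalise v ≡ 0ⱽ
  normalise-0 refl = 𝕍.*ₗ-zeroʳ _

  ⟨,normalise⟩*‖‖² : ∀ w v → ⟨ w , normalise v ⟩ * ‖ normalise v ‖² ≡ ⟨ w , normalise v ⟩
  ⟨,normalise⟩*‖‖² w v with em {P = v ≡ 0ⱽ}
  ... | no v≢0 = trans (cong (⟨ w , normalise v ⟩ *_) (‖normalise‖² v≢0)) (*-identityʳ _)
  ... | yes v≡0 = trans (cong (_* ‖ normalise v ‖²) e) (trans (zeroˡ _) (sym e))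
    where e = trans (cong ⟨ w ,_⟩ (normalise-0 v≡0)) (⟨,0⟩ w)

  ⟨,normalise⟩≡0 : ∀ w v → ⟨ w , normalise v ⟩ ≡ 0# → ⟨ w , v ⟩ ≡ 0#
  ⟨,normalise⟩≡0 w v e with em {P = v ≡ 0ⱽ}
  ... | yes refl = ⟨,0⟩ w
  ... | no v≢0 = x*y≡0⇒y≡0 r⁻¹≢0 (trans (sym (⟨•⟩ʳ _ w v)) e)
    where
    r⁻¹≢0 : root v ⁻¹ ≢ 0#
    r⁻¹≢0 e′ = 0≢1 (trans (sym (zeroʳ (root v))) (trans (cong (root v *_) (sym e′)) (⁻¹-inverse _ (root≢0 v≢0))))

  ⟨⟩≡0⇒normalise : ∀ w v → ⟨ w , v ⟩ ≡ 0# → ⟨ w , normalise v ⟩ ≡ 0#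
  ⟨⟩≡0⇒normalise w v e = trans (⟨•⟩ʳ _ w v) (trans (cong (root v ⁻¹ *_) e) (zeroʳ _))

  -- Zero vectors are allowed: idem says that the norm is 0 or 1.
  record Orthonormal₀ (u : ℕ → V) : Set where
    field
      ortho : ∀ {i j} → i ≢ j → ⟨ u i , u j ⟩ ≡ 0#
      idem  : ∀ v i → ⟨ v , u i ⟩ * ‖ u i ‖² ≡ ⟨ v , u i ⟩

  module _ (u t : ℕ → V) (v : V) where

    coeff : ℕ → Carrier
    coeff k = ⟨ v , u k ⟩

    -- Coefficients are read off along `u` and placed on `t`. With `t` equal to `u` this
    -- approximates a projection; for isometric orthonormal sequences, a partial isometry carrying
    -- `u` to `t`.
    partialSum : ℕ → V
    partialSum zero    = 0ⱽ
    partialSum (suc n) = partialSum n ⊕ coeff n • t n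

  energy : (ℕ → V) → V → ℕ → Carrier
  energy u v zero    = 0#
  energy u v (suc n) = energy u v n + ⟨ v , u n ⟩ * ⟨ v , u n ⟩

  ⟨partialSum⟩-cong : ∀ {u t t′ v z z′} n → (∀ {k} → k ℕ.< n → ⟨ t k , z ⟩ ≡ ⟨ t′ k , z′ ⟩) →
                      ⟨ partialSum u t v n , z ⟩ ≡ ⟨ partialSum u t′ v n , z′ ⟩
  ⟨partialSum⟩-cong {z = z} {z′} zero e = trans (⟨0,⟩ z) (sym (⟨0,⟩ z′))
  ⟨partialSum⟩-cong {u} {t} {t′} {v} {z} {z′} (suc n) e = begin
    ⟨ partialSum u t v n ⊕ c • t n , z ⟩            ≡⟨ trans (⟨⟩-+ (partialSum u t v n) (c • t n) z) (cong (⟨ partialSum u t v n , z ⟩ +_) (⟨⟩-• c (t n) z)) ⟩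
    ⟨ partialSum u t v n , z ⟩ + c * ⟨ t n , z ⟩    ≡⟨ cong₂ _+_ (⟨partialSum⟩-cong n (e ∘ ℕ.m<n⇒m<1+n)) (cong (c *_) (e ℕ.≤-refl)) ⟩
    ⟨ partialSum u t′ v n , z′ ⟩ + c * ⟨ t′ n , z′ ⟩ ≡⟨ trans (⟨⟩-+ (partialSum u t′ v n) (c • t′ n) z′) (cong (⟨ partialSum u t′ v n , z′ ⟩ +_) (⟨⟩-• c (t′ n) z′)) ⟨
    ⟨ partialSum u t′ v n ⊕ c • t′ n , z′ ⟩         ∎
    where
    open ≡-Reasoning
    c = ⟨ v , u n ⟩

  monotone-bounded : (s : ℕ → Carrier) (b : Carrier) → (∀ {m n} → m ℕ.≤ n → s m ≤ s n) → (∀ n → s n ≤ b) →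
                     ∀ δ → 0# < δ → ∃[ N ] ∀ m n → N ℕ.≤ m → m ℕ.≤ n → s n - s m < δ
  monotone-bounded s b mono bd δ 0<δ =
    let Value x = ∃[ n ] s n ≡ x
        ne = s 0 , 0 , refl
        bdd = b , λ where _ (n , refl) → bd n
        σ , ub , _ = supremum Value ne bdd
        x , (N , e) , lt = sup-approx {Value} ne bdd 0<δ
    in N , λ m n N≤m m≤n →
      let lt′ = <-≤-trans (subst (σ - δ <_) (sym e) lt) (mono N≤m)
      in 0<-+ʳ (<⇒0<- lt′) (≤⇒0≤- (ub (s n) (n , refl))) since
           solve 4 (λ σ δ m n → (m :- (σ :- δ)) :+ (σ :- n) := δ :- (n :- m)) refl σ δ (s m) (s n)

  energy-mono : ∀ {u v} {m n} → m ℕ.≤ n → energy u v m ≤ energy u v n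
  energy-mono {u} {v} {m} {n} m≤n = subst (λ k → energy u v m ≤ energy u v k) (ℕ.m∸n+n≡m m≤n) (go (n ℕ.∸ m))
    where
    go : ∀ k → energy u v m ≤ energy u v (k ℕ.+ m)
    go zero = ≤-refl
    go (suc k) = ≤-trans (go k) (0≤-square ⟨ v , u (k ℕ.+ m) ⟩ since≤
      solve 2 (λ e c → c := (e :+ c) :- e) refl (energy u v (k ℕ.+ m)) (⟨ v , u (k ℕ.+ m) ⟩ * ⟨ v , u (k ℕ.+ m) ⟩))

  Isometric : (u t : ℕ → V) → Set
  Isometric u t = ∀ i → ‖ u i ‖² ≡ ‖ t i ‖²

  module PartialSums {u t : ℕ → V} (ou : Orthonormal₀ u) (ot : Orthonormal₀ t) (iso : Isometric u t) (v : V) where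
    open ≡-Reasoning
    private
      S = partialSum u t v
      c = coeff u t v
      E = energy u v

    ⟨S-suc,⟩ : ∀ n z → ⟨ S (suc n) , z ⟩ ≡ ⟨ S n , z ⟩ + c n * ⟨ t n , z ⟩
    ⟨S-suc,⟩ n z = trans (⟨⟩-+ (S n) (c n • t n) z) (cong (⟨ S n , z ⟩ +_) (⟨⟩-• (c n) (t n) z))

    coeff-beyond : ∀ n j → n ℕ.≤ j → ⟨ S n , t j ⟩ ≡ 0#
    coeff-beyond zero j _ = ⟨0,⟩ (t j)
    coeff-beyond (suc n) j n<j = begin
      ⟨ S (suc n) , t j ⟩                  ≡⟨ ⟨S-suc,⟩ n (t j) ⟩
      ⟨ S n , t j ⟩ + c n * ⟨ t n , t j ⟩  ≡⟨ cong₂ _+_ (coeff-beyond n j (ℕ.<⇒≤ n<j))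
                                                (cong (c n *_) (Orthonormal₀.ortho ot (ℕ.<⇒≢ n<j))) ⟩
      0# + c n * 0#                        ≡⟨ trans (+-identityˡ _) (zeroʳ _) ⟩
      0#                                   ∎

    coeff-within : ∀ n j → j ℕ.< n → ⟨ S n , t j ⟩ ≡ c j
    coeff-within (suc n) j (s≤s j≤n) with ℕ.m≤n⇒m<n∨m≡n j≤n
    ... | inj₁ j<n = begin
      ⟨ S (suc n) , t j ⟩                  ≡⟨ ⟨S-suc,⟩ n (t j) ⟩
      ⟨ S n , t j ⟩ + c n * ⟨ t n , t j ⟩  ≡⟨ cong₂ _+_ (coeff-within n j j<n)
                                                (cong (c n *_) (Orthonormal₀.ortho ot (ℕ.<⇒≢ j<n ∘ sym))) ⟩
      c j + c n * 0#                       ≡⟨ trans (cong (c j +_) (zeroʳ _)) (+-identityʳ _) ⟩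
      c j                                  ∎
    ... | inj₂ refl = begin
      ⟨ S (suc n) , t n ⟩                  ≡⟨ ⟨S-suc,⟩ n (t n) ⟩
      ⟨ S n , t n ⟩ + c n * ‖ t n ‖²       ≡⟨ cong₂ _+_ (coeff-beyond n n ℕ.≤-refl) (cong (c n *_) (sym (iso n))) ⟩
      0# + c n * ‖ u n ‖²                  ≡⟨ trans (+-identityˡ _) (Orthonormal₀.idem ou v n) ⟩
      c n                                  ∎

    ‖S⊝S‖² : ∀ n k → ‖ S (k ℕ.+ n) ⊝ S n ‖² ≡ E (k ℕ.+ n) - E n
    ‖S⊝S‖² n zero = trans (cong (λ z → ⟨ z , z ⟩) (𝕍.-ᴹ‿inverseʳ (S n))) (trans (⟨0,⟩ 0ⱽ) (sym (-‿inverseʳ _)))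
    ‖S⊝S‖² n (suc k) = begin
      -- Regrouped to split off the new term, which is orthogonal to the earlier difference.
      ‖ (S m ⊕ cₘ • t m) ⊝ S n ‖²                            ≡⟨ cong ‖_‖² (V-ext λ z → begin
          ⟨ (S m ⊕ cₘ • t m) ⊝ S n , z ⟩                        ≡⟨ trans (⟨⊝⟩ˡ (S m ⊕ cₘ • t m) (S n) z) (cong (_- ⟨ S n , z ⟩) (⟨⟩-+ (S m) (cₘ • t m) z)) ⟩
          ⟨ S m , z ⟩ + ⟨ cₘ • t m , z ⟩ - ⟨ S n , z ⟩          ≡⟨ solve 3 (λ a b c → a :+ b :- c := (a :- c) :+ b) refl ⟨ S m , z ⟩ ⟨ cₘ • t m , z ⟩ ⟨ S n , z ⟩ ⟩
          (⟨ S m , z ⟩ - ⟨ S n , z ⟩) + ⟨ cₘ • t m , z ⟩        ≡⟨ trans (⟨⟩-+ (S m ⊝ S n) (cₘ • t m) z) (cong (_+ ⟨ cₘ • t m , z ⟩) (⟨⊝⟩ˡ (S m) (S n) z)) ⟨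
          ⟨ (S m ⊝ S n) ⊕ cₘ • t m , z ⟩                        ∎) ⟩
      ‖ (S m ⊝ S n) ⊕ cₘ • t m ‖²                            ≡⟨ ‖⊕‖² (S m ⊝ S n) (cₘ • t m) ⟩
      ‖ S m ⊝ S n ‖² + 2# * ⟨ S m ⊝ S n , cₘ • t m ⟩ + ‖ cₘ • t m ‖²   ≡⟨ cong₂ _+_ (cong₂ (λ x y → x + 2# * y) (‖S⊝S‖² n k) cross) square ⟩
      E m - E n + 2# * 0# + cₘ * cₘ                          ≡⟨ solve 3 (λ a b c → a :- b :+ :2 :* :0 :+ c := (a :+ c) :- b) refl (E m) (E n) (cₘ * cₘ) ⟩
      E (suc m) - E n                                        ∎
      where
      m = k ℕ.+ n
      cₘ = c m
      cross : ⟨ S m ⊝ S n , cₘ • t m ⟩ ≡ 0#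
      cross = begin
        ⟨ S m ⊝ S n , cₘ • t m ⟩                ≡⟨ trans (⟨•⟩ʳ cₘ _ (t m)) (cong (cₘ *_) (⟨⊝⟩ˡ (S m) (S n) (t m))) ⟩
        cₘ * (⟨ S m , t m ⟩ - ⟨ S n , t m ⟩)    ≡⟨ cong₂ (λ x y → cₘ * (x - y)) (coeff-beyond m m ℕ.≤-refl) (coeff-beyond n m (ℕ.m≤n+m n k)) ⟩
        cₘ * (0# - 0#)                          ≡⟨ solve 1 (λ c → c :* (:0 :- :0) := :0) refl cₘ ⟩
        0#                                      ∎
      square : ‖ cₘ • t m ‖² ≡ cₘ * cₘ
      square = begin
        ⟨ cₘ • t m , cₘ • t m ⟩      ≡⟨ trans (⟨⟩-• cₘ (t m) _) (cong (cₘ *_) (⟨•⟩ʳ cₘ (t m) (t m))) ⟩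
        cₘ * (cₘ * ‖ t m ‖²)         ≡⟨ cong (λ z → cₘ * (cₘ * z)) (iso m) ⟨
        cₘ * (cₘ * ‖ u m ‖²)         ≡⟨ cong (cₘ *_) (Orthonormal₀.idem ou v m) ⟩
        cₘ * cₘ                      ∎

  -- The remainder `v ⊝ S n` has squared norm `‖ v ‖² - energy u v n`.
  Bessel : ∀ {u} (ou : Orthonormal₀ u) v n → energy u v n ≤ ‖ v ‖²
  Bessel {u} ou v n = 0≤‖‖² (v ⊝ S n) since≤ (begin
    ‖ v ⊝ S n ‖²                               ≡⟨ ‖⊝‖² v (S n) ⟩
    ‖ v ‖² - 2# * ⟨ v , S n ⟩ + ‖ S n ‖²       ≡⟨ cong₂ (λ x y → ‖ v ‖² - 2# * x + y) (⟨v,S⟩ n) ‖S‖² ⟩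
    ‖ v ‖² - 2# * E n + E n                    ≡⟨ solve 2 (λ v e → v :- :2 :* e :+ e := v :- e) refl ‖ v ‖² (E n) ⟩
    ‖ v ‖² - E n                               ∎)
    where
    open ≡-Reasoning
    open PartialSums ou ou (λ _ → refl) v
    S = partialSum u u v
    E = energy u v
    ⟨v,S⟩ : ∀ n → ⟨ v , S n ⟩ ≡ E n
    ⟨v,S⟩ zero = ⟨,0⟩ v
    ⟨v,S⟩ (suc n) = trans (⟨⊕⟩ʳ v (S n) (⟨ v , u n ⟩ • u n)) (cong₂ _+_ (⟨v,S⟩ n) (⟨•⟩ʳ ⟨ v , u n ⟩ v (u n)))
    ‖S‖² : ‖ S n ‖² ≡ E n
    ‖S‖² = begin
      ‖ S n ‖²                             ≡⟨ solve 1 (λ a → a := a :- :2 :* :0 :+ :0) refl ‖ S n ‖² ⟩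
      ‖ S n ‖² - 2# * 0# + 0#              ≡⟨ cong₂ (λ x y → ‖ S n ‖² - 2# * x + y) (⟨,0⟩ (S n)) (⟨0,⟩ 0ⱽ) ⟨
      ‖ S n ‖² - 2# * ⟨ S n , 0ⱽ ⟩ + ‖ 0ⱽ ‖²   ≡⟨ ‖⊝‖² (S n) 0ⱽ ⟨
      ‖ S n ⊝ 0ⱽ ‖²                        ≡⟨ subst (λ k → ‖ S k ⊝ 0ⱽ ‖² ≡ E k - 0#) (ℕ.+-identityʳ n) (‖S⊝S‖² 0 n) ⟩
      E n - 0#                             ≡⟨ solve 1 (λ a → a :- :0 := a) refl (E n) ⟩
      E n                                  ∎

  abstract
    energy-Cauchy : ∀ {u} (ou : Orthonormal₀ u) v δ → 0# < δ →
                    ∃[ N ] ∀ m n → N ℕ.≤ m → m ℕ.≤ n → energy u v n - energy u v m < δ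
    energy-Cauchy {u} ou v = monotone-bounded (energy u v) ‖ v ‖² (λ {m} {n} → energy-mono {u} {v} {m} {n}) (Bessel ou v)

  -- The squared coefficients are the increments of the convergent `energy`, so they tend to zero.
  constant-coefficients : ∀ {u} (ou : Orthonormal₀ u) v → (∀ n → ⟨ v , u n ⟩ ≡ ⟨ v , u 0 ⟩) → ⟨ v , u 0 ⟩ ≡ 0#
  constant-coefficients {u} ou v const = arbitrarily-small λ ε 0<ε →
    let N , small = energy-Cauchy ou v (ε * ε) (*-pos 0<ε 0<ε)
    in subst (_< ε * ε) (trans (solve 2 (λ e c → (e :+ c) :- e := c) refl (energy u v N) (⟨ v , u N ⟩ * ⟨ v , u N ⟩))
         (cong (λ c → c * c) (const N))) (small N (suc N) ℕ.≤-refl (ℕ.n≤1+n N))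

  module Series {u t : ℕ → V} (ou : Orthonormal₀ u) (ot : Orthonormal₀ t) (iso : Isometric u t) where

    private
      module _ (v : V) (ε : Carrier) (0<ε : 0# < ε) where
        open PartialSums ou ot iso v
        S : ℕ → V
        S = partialSum u t v

        N : ℕ
        N = proj₁ (energy-Cauchy ou v (ε * ε) (*-pos 0<ε 0<ε))

        within : ∀ n m → N ℕ.≤ n → n ℕ.≤ m → ‖ S m ⊝ S n ‖² < ε * ε
        within n m N≤n n≤m = subst (_< ε * ε)
          (sym (subst (λ k → ‖ S k ⊝ S n ‖² ≡ energy u v k - energy u v n) (ℕ.m∸n+n≡m n≤m) (‖S⊝S‖² n (m ℕ.∸ n))))
          (proj₂ (energy-Cauchy ou v (ε * ε) (*-pos 0<ε 0<ε)) n m N≤n n≤m)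

        swap : ∀ m n → ‖ S n ⊝ S m ‖² ≡ ‖ S m ⊝ S n ‖²
        swap m n = trans (‖⊝‖² (S n) (S m)) (trans (trans (cong (λ z → ‖ S n ‖² - 2# * z + ‖ S m ‖²) (⟨⟩-sym (S n) (S m)))
          (solve 3 (λ a b c → a :- b :+ c := c :- b :+ a) refl ‖ S n ‖² (2# * ⟨ S m , S n ⟩) ‖ S m ‖²)) (sym (‖⊝‖² (S m) (S n))))

        near : ∀ m n → N ℕ.≤ m → N ℕ.≤ n → n ℕ.≤ m ⊎ m ℕ.≤ n → Within ε (S m) (S n)
        near m n N≤m N≤n (inj₁ n≤m) = within n m N≤n n≤m
        near m n N≤m N≤n (inj₂ m≤n) = subst (_< ε * ε) (swap m n) (within m n N≤m m≤n)

      cauchy : ∀ v → Cauchy (partialSum u t v)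
      cauchy v ε 0<ε = N v ε 0<ε , λ m n N≤m N≤n → near v ε 0<ε m n N≤m N≤n (ℕ.≤-total n m)

    abstract
      Φ : V → V
      Φ v = proj₁ (complete (partialSum u t v) (cauchy v))

      Φ-limit : ∀ v → partialSum u t v ⟶ Φ v
      Φ-limit v = proj₂ (complete (partialSum u t v) (cauchy v))

    ⟨Φ,t⟩ : ∀ v j → ⟨ Φ v , t j ⟩ ≡ ⟨ v , u j ⟩
    ⟨Φ,t⟩ v j = trans (⟨⟩-continuous (t j) (t j) (Φ-limit v) const-limit
        (suc j , λ n j<n → trans (coeff-within n j j<n) (sym (coeff-within (suc j) j ℕ.≤-refl))))
        (coeff-within (suc j) j ℕ.≤-refl)
      where
      open PartialSums ou ot iso v
      x = partialSum u t v (suc j)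
      const-limit : (λ _ → x) ⟶ x
      const-limit ε 0<ε = 0 , λ _ _ → subst (_< ε * ε)
        (sym (trans (cong ‖_‖² (𝕍.-ᴹ‿inverseʳ x)) (⟨0,⟩ 0ⱽ))) (*-pos 0<ε 0<ε)

  module _ {u t t′ : ℕ → V} {ou : Orthonormal₀ u} {ot : Orthonormal₀ t} {ot′ : Orthonormal₀ t′}
           {iso : Isometric u t} {iso′ : Isometric u t′} where
    private
      module A = Series ou ot iso
      module B = Series ou ot′ iso′

    -- Both sides are limits of combinations of the assumed products, with the same coefficients
    -- `⟨ v , u k ⟩`.
    ⟨Φ⟩-cong : ∀ v {z z′} → (∀ k → ⟨ t k , z ⟩ ≡ ⟨ t′ k , z′ ⟩) → ⟨ A.Φ v , z ⟩ ≡ ⟨ B.Φ v , z′ ⟩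
    ⟨Φ⟩-cong v {z} {z′} e = ⟨⟩-continuous z z′ (A.Φ-limit v) (B.Φ-limit v) (0 , λ n _ → ⟨partialSum⟩-cong n (λ {k} _ → e k))

    -- The value does not depend on the target sequence; taking `t′` to be `u` shows that `Φ` along
    -- `t` is isometric on the closed span of `u`.
    ⟨Φ,Φ⟩ : ∀ v w → ⟨ A.Φ v , A.Φ w ⟩ ≡ ⟨ B.Φ v , B.Φ w ⟩
    ⟨Φ,Φ⟩ v w = ⟨Φ⟩-cong v λ k → trans (trans (⟨⟩-sym _ _) (A.⟨Φ,t⟩ w k)) (sym (trans (⟨⟩-sym _ _) (B.⟨Φ,t⟩ w k)))

  module _ {u t : ℕ → V} {ou : Orthonormal₀ u} {ot : Orthonormal₀ t} {iso : Isometric u t} where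
    open Series ou ot iso

    ⟨Φ⟩≡0 : ∀ v {z} → (∀ k → ⟨ t k , z ⟩ ≡ 0#) → ⟨ Φ v , z ⟩ ≡ 0#
    ⟨Φ⟩≡0 v {z} e = trans (⟨Φ⟩-cong v λ k → trans (e k) (sym (⟨,0⟩ _))) (⟨,0⟩ (Φ v))

  module Projection {u : ℕ → V} (ou : Orthonormal₀ u) where
    open Series ou ou (λ _ → refl) public using () renaming (Φ to P; ⟨Φ,t⟩ to ⟨P,u⟩; Φ-limit to P-limit)

    ⊝P⊥u : ∀ v j → ⟨ v ⊝ P v , u j ⟩ ≡ 0#
    ⊝P⊥u v j = trans (⟨⊝⟩ˡ v (P v) (u j)) (trans (cong (λ z → ⟨ v , u j ⟩ - z) (⟨P,u⟩ v j)) (-‿inverseʳ _))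

    ⟨P,⊝P⟩ : ∀ v w → ⟨ P v , w ⊝ P w ⟩ ≡ 0#
    ⟨P,⊝P⟩ v w = ⟨Φ⟩≡0 v λ k → trans (⟨⟩-sym _ _) (⊝P⊥u w k)

    ⟨P,⟩ : ∀ v w → ⟨ P v , w ⟩ ≡ ⟨ P v , P w ⟩
    ⟨P,⟩ v w = x-y≡0⇒x≡y (trans (sym (⟨⊝⟩ʳ (P v) w (P w))) (⟨P,⊝P⟩ v w))

    P-self-adjoint : ∀ v w → ⟨ P v , w ⟩ ≡ ⟨ v , P w ⟩
    P-self-adjoint v w = trans (⟨P,⟩ v w) (trans (⟨⟩-sym _ _) (trans (sym (⟨P,⟩ w v)) (⟨⟩-sym _ _)))

    ⟨⊝P,⊝P⟩ : ∀ v w → ⟨ v ⊝ P v , w ⊝ P w ⟩ ≡ ⟨ v , w ⟩ - ⟨ P v , P w ⟩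
    ⟨⊝P,⊝P⟩ v w = begin
      ⟨ v ⊝ P v , w ⊝ P w ⟩                     ≡⟨ ⟨⊝⟩ˡ v (P v) _ ⟩
      ⟨ v , w ⊝ P w ⟩ - ⟨ P v , w ⊝ P w ⟩       ≡⟨ cong₂ _-_ (⟨⊝⟩ʳ v w (P w)) (⟨P,⊝P⟩ v w) ⟩
      (⟨ v , w ⟩ - ⟨ v , P w ⟩) - 0#            ≡⟨ cong (λ z → (⟨ v , w ⟩ - z) - 0#) (trans (sym (P-self-adjoint v w)) (⟨P,⟩ v w)) ⟩
      (⟨ v , w ⟩ - ⟨ P v , P w ⟩) - 0#          ≡⟨ solve 1 (λ a → a :- :0 := a) refl (⟨ v , w ⟩ - ⟨ P v , P w ⟩) ⟩
      ⟨ v , w ⟩ - ⟨ P v , P w ⟩                 ∎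
      where open ≡-Reasoning

  module GramSchmidt (d : ℕ → V) where

    -- Removes the components along the first `n` basis vectors. The local `u` is `gs n`, written
    -- out because `gs` is itself defined from `reject`.
    reject : ℕ → V → V
    reject zero    v = v
    reject (suc n) v = let u = normalise (reject n (d n)) in reject n v ⊝ ⟨ reject n v , u ⟩ • u

    gs : ℕ → V
    gs n = normalise (reject n (d n))

    reject-⊥ : ∀ n v {k} → k ℕ.< n → ⟨ reject n v , gs k ⟩ ≡ 0#
    gs-⊥ : ∀ n {k} → k ℕ.< n → ⟨ gs n , gs k ⟩ ≡ 0#

    gs-⊥ n {k} k<n = trans (⟨⟩-sym _ _) (⟨⟩≡0⇒normalise (gs k) _ (trans (⟨⟩-sym _ _) (reject-⊥ n (d n) k<n)))

    reject-⊥ (suc n) v {k} (s≤s k≤n) = trans (trans (⟨⊝⟩ˡ (reject n v) (r • gs n) (gs k)) (cong (λ z → ⟨ reject n v , gs k ⟩ - z) (⟨⟩-• r (gs n) (gs k)))) (go (ℕ.m≤n⇒m<n∨m≡n k≤n))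
      where
      open ≡-Reasoning
      r = ⟨ reject n v , gs n ⟩
      go : k ℕ.< n ⊎ k ≡ n → ⟨ reject n v , gs k ⟩ - r * ⟨ gs n , gs k ⟩ ≡ 0#
      go (inj₁ k<n) = trans (cong₂ (λ x y → x - r * y) (reject-⊥ n v k<n) (gs-⊥ n k<n)) (solve 1 (λ r → :0 :- r :* :0 := :0) refl r)
      go (inj₂ refl) = trans (cong (λ z → r - z) (⟨,normalise⟩*‖‖² (reject n v) (reject n (d n)))) (-‿inverseʳ r)

    -- `reject n v` differs from `v` by a combination of the earlier `gs k`, which `z` does not see.
    ⟨reject⟩ : ∀ z n v → (∀ {k} → k ℕ.< n → ⟨ z , gs k ⟩ ≡ 0#) → ⟨ z , reject n v ⟩ ≡ ⟨ z , v ⟩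
    ⟨reject⟩ z zero    v z⊥ = refl
    ⟨reject⟩ z (suc n) v z⊥ = begin
      ⟨ z , reject n v ⊝ r • gs n ⟩                  ≡⟨ trans (⟨⊝⟩ʳ z (reject n v) (r • gs n)) (cong (λ y → ⟨ z , reject n v ⟩ - y) (⟨•⟩ʳ r z (gs n))) ⟩
      ⟨ z , reject n v ⟩ - r * ⟨ z , gs n ⟩          ≡⟨ cong₂ (λ x y → x - r * y) (⟨reject⟩ z n v (z⊥ ∘ ℕ.m<n⇒m<1+n)) (z⊥ ℕ.≤-refl) ⟩
      ⟨ z , v ⟩ - r * 0#                             ≡⟨ solve 2 (λ a r → a :- r :* :0 := a) refl ⟨ z , v ⟩ r ⟩
      ⟨ z , v ⟩                                      ∎
      where
      open ≡-Reasoning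
      r = ⟨ reject n v , gs n ⟩

    orthonormal₀ : Orthonormal₀ gs
    orthonormal₀ = record
      { ortho = λ {i} {j} i≢j → case ℕ.<-cmp i j of λ where
          (tri< i<j _ _) → trans (⟨⟩-sym _ _) (gs-⊥ j i<j)
          (tri≈ _ e _) → contradiction e i≢j
          (tri> _ _ j<i) → gs-⊥ i j<i
      ; idem = λ v i → ⟨,normalise⟩*‖‖² v (reject i (d i))
      }

    ⊥gs⇒⊥d : ∀ z k → (∀ j → ⟨ z , gs j ⟩ ≡ 0#) → ⟨ z , d k ⟩ ≡ 0#
    ⊥gs⇒⊥d z k z⊥ = trans (sym (⟨reject⟩ z k (d k) (λ {j} _ → z⊥ j))) (⟨,normalise⟩≡0 z _ (z⊥ k))

    -- `gs k` is a combination of the `d j` with `j` at most `k`. The bound `N` serves the situation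
    -- where only finitely many products with `d` are known.
    ⊥d⇒⊥gs : ∀ z N → (∀ {j} → j ℕ.< N → ⟨ z , d j ⟩ ≡ 0#) → ∀ {k} → k ℕ.< N → ⟨ z , gs k ⟩ ≡ 0#
    ⊥d⇒⊥gs z (suc N) z⊥ {k} (s≤s k≤N) with ℕ.m≤n⇒m<n∨m≡n k≤N
    ... | inj₁ k<N = ⊥d⇒⊥gs z N (z⊥ ∘ ℕ.m<n⇒m<1+n) k<N
    ... | inj₂ refl = ⟨⟩≡0⇒normalise z _ (trans (⟨reject⟩ z N (d N) (⊥d⇒⊥gs z N (z⊥ ∘ ℕ.m<n⇒m<1+n))) (z⊥ ℕ.≤-refl))

    agree-gs : ∀ {x y} N → (∀ {j} → j ℕ.< N → ⟨ d j , x ⟩ ≡ ⟨ d j , y ⟩) → ∀ {k} → k ℕ.< N → ⟨ gs k , x ⟩ ≡ ⟨ gs k , y ⟩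
    agree-gs {x} {y} N e {k} k<N = x-y≡0⇒x≡y (trans (trans (sym (⟨⊝⟩ʳ (gs k) x y)) (⟨⟩-sym _ _))
      (⊥d⇒⊥gs (x ⊝ y) N (λ {j} j<N → trans (trans (⟨⟩-sym _ _) (⟨⊝⟩ʳ (d j) x y))
        (trans (cong (_- ⟨ d j , y ⟩) (e j<N)) (-‿inverseʳ _))) k<N))

    open Projection orthonormal₀ public

    P-cong : ∀ v {x y} → (∀ j → ⟨ d j , x ⟩ ≡ ⟨ d j , y ⟩) → ⟨ P v , x ⟩ ≡ ⟨ P v , y ⟩
    P-cong v e = ⟨Φ⟩-cong v λ k → agree-gs (suc k) (λ {j} _ → e j) ℕ.≤-refl

    -- The residue is orthogonal to the whole basis, hence to `d k`, and also to `P (d k)`, hence to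
    -- itself.
    P-d : ∀ k → P (d k) ≡ d k
    P-d k = sym (‖⊝‖²≡0 (begin
      ⟨ z , d k ⊝ P (d k) ⟩            ≡⟨ ⟨⊝⟩ʳ z (d k) (P (d k)) ⟩
      ⟨ z , d k ⟩ - ⟨ z , P (d k) ⟩    ≡⟨ cong₂ _-_ (⊥gs⇒⊥d z k (⊝P⊥u (d k))) (trans (⟨⟩-sym _ _) (⟨P,⊝P⟩ (d k) (d k))) ⟩
      0# - 0#                          ≡⟨ -‿inverseʳ 0# ⟩
      0#                               ∎))
      where
      open ≡-Reasoning
      z = d k ⊝ P (d k)

  record Orthonormal (e : ℕ → V) : Set where
    field
      ortho : ∀ {i j} → i ≢ j → ⟨ e i , e j ⟩ ≡ 0#
      unit  : ∀ i → ‖ e i ‖² ≡ 1#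

    orthonormal₀ : Orthonormal₀ e
    orthonormal₀ = record
      { ortho = ortho
      ; idem  = λ v i → trans (cong (⟨ v , e i ⟩ *_) (unit i)) (*-identityʳ _)
      }

    reindex : ∀ {σ : ℕ → ℕ} → Injective _≡_ _≡_ σ → Orthonormal (e ∘ σ)
    reindex σ-injective = record { ortho = λ i≢j → ortho (i≢j ∘ σ-injective) ; unit = λ i → unit _ }

  -- shift moves e k to e (2k + 1) and fixes the complement of e, which
  -- frees the even members of e.
  module Shift {e : ℕ → V} (oe : Orthonormal e) where
    open Orthonormal oe

    private
      odd-even : ∀ k n → suc (2 ℕ.* k) ≢ 2 ℕ.* n
      odd-even k n eq = ℕ.even≢odd n k (sym eq)

      odds : Orthonormal (λ k → e (suc (2 ℕ.* k)))
      odds = reindex λ {i} {j} eq → ℕ.*-cancelˡ-≡ i j 2 (ℕ.suc-injective eq)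

      ot : Orthonormal₀ (λ k → e (suc (2 ℕ.* k)))
      ot = Orthonormal.orthonormal₀ odds

      iso : Isometric e (λ k → e (suc (2 ℕ.* k)))
      iso i = trans (unit i) (sym (unit _))

    evens : Orthonormal (λ k → e (2 ℕ.* k))
    evens = reindex λ {i} {j} → ℕ.*-cancelˡ-≡ i j 2

    open Projection orthonormal₀
    open Series orthonormal₀ ot iso

    shift : V → V
    shift v = (v ⊝ P v) ⊕ Φ v

    private
      ⊝P⊥Φ : ∀ v w → ⟨ Φ w , v ⊝ P v ⟩ ≡ 0#
      ⊝P⊥Φ v w = ⟨Φ⟩≡0 {ou = orthonormal₀} {ot} {iso} w λ k → trans (⟨⟩-sym _ _) (⊝P⊥u v _)

    -- The component orthogonal to `e` is kept, and the rest is moved isometrically within the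
    -- closed span of `e`; so the cross terms vanish.
    shift-isometry : ∀ v w → ⟨ shift v , shift w ⟩ ≡ ⟨ v , w ⟩
    shift-isometry v w = begin
      ⟨ (v ⊝ P v) ⊕ Φ v , (w ⊝ P w) ⊕ Φ w ⟩                     ≡⟨ ⟨⟩-+ (v ⊝ P v) (Φ v) (shift w) ⟩
      ⟨ v ⊝ P v , (w ⊝ P w) ⊕ Φ w ⟩ + ⟨ Φ v , (w ⊝ P w) ⊕ Φ w ⟩  ≡⟨ cong₂ _+_ (⟨⊕⟩ʳ (v ⊝ P v) (w ⊝ P w) (Φ w)) (⟨⊕⟩ʳ (Φ v) (w ⊝ P w) (Φ w)) ⟩
      (⟨ v ⊝ P v , w ⊝ P w ⟩ + ⟨ v ⊝ P v , Φ w ⟩) + (⟨ Φ v , w ⊝ P w ⟩ + ⟨ Φ v , Φ w ⟩)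
        ≡⟨ cong₂ _+_ (cong₂ _+_ (⟨⊝P,⊝P⟩ v w) (trans (⟨⟩-sym _ _) (⊝P⊥Φ v w)))
             (cong₂ _+_ (⊝P⊥Φ w v) (⟨Φ,Φ⟩ {ou = orthonormal₀} {ot} {orthonormal₀} {iso} {λ _ → refl} v w)) ⟩
      (⟨ v , w ⟩ - ⟨ P v , P w ⟩ + 0#) + (0# + ⟨ P v , P w ⟩)    ≡⟨ solve 2 (λ a b → (a :- b :+ :0) :+ (:0 :+ b) := a) refl ⟨ v , w ⟩ ⟨ P v , P w ⟩ ⟩
      ⟨ v , w ⟩                                                  ∎
      where open ≡-Reasoning

    shift-⊥ : ∀ v n → ⟨ shift v , e (2 ℕ.* n) ⟩ ≡ 0#
    shift-⊥ v n = trans (⟨⟩-+ (v ⊝ P v) (Φ v) (e (2 ℕ.* n))) (trans (cong₂ _+_ (⊝P⊥u v (2 ℕ.* n))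
      (⟨Φ⟩≡0 {ou = orthonormal₀} {ot} {iso} v λ k → ortho (odd-even k n))) (+-identityˡ 0#))

-- Quantifier-free types as Gram matrices

module QuantifierFreeTypes (em : ∀ {ℓ} → ExcludedMiddle ℓ) (ext : ∀ {a b} → Extensionality a b)
                           (ℝ : CompleteOrderedField) (H : HilbertSpace ℝ) (ℵ₁ : Set) where

  open Classical em ext
  open CompleteOrderedField ℝ hiding (_≤_)
  open RealField em ext ℝ
  open HilbertGeometry em ext ℝ H
  open TwoSorted H
  open Simplicity structure Universe ℵ₁ using (M; Expr; tp; Type; IsAutomorphism; enum)

  -- Scalars become the zero vector, so a Gram matrix is defined for mixed sequences without
  -- tracking sorts.
  vec : M → V
  vec (SV , v) = v
  vec (SF , r) = 0ⱽ

  -- Constants name all reals, so equal types force equal scalars; of vectors only the sort is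
  -- recorded here.
  data Alike : M → M → Set where
    vectors : ∀ {v w} → Alike (SV , v) (SV , w)
    scalars : ∀ {r} → Alike (SF , r) (SF , r)

  Alike-refl : ∀ m → Alike m m
  Alike-refl (SV , _) = vectors
  Alike-refl (SF , _) = scalars

  Alike-sym : ∀ {m m′} → Alike m m′ → Alike m′ m
  Alike-sym vectors = vectors
  Alike-sym scalars = scalars

  Alike-trans : ∀ {m m′ m″} → Alike m m′ → Alike m′ m″ → Alike m m″
  Alike-trans vectors vectors = vectors
  Alike-trans scalars scalars = scalars

  Alike-≡ : ∀ {m m′} → Alike m m′ → vec m ≡ vec m′ → m ≡ m′
  Alike-≡ vectors refl = refl
  Alike-≡ scalars _    = refl

  record Similar {K : Set} (x y : K → M) : Set where
    field
      alike : ∀ k → Alike (x k) (y k)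
      gram  : ∀ k l → ⟨ vec (x k) , vec (x l) ⟩ ≡ ⟨ vec (y k) , vec (y l) ⟩

  open Similar public

  module _ {K : Set} where

    Similar-sym : {x y : K → M} → Similar x y → Similar y x
    Similar-sym s = record { alike = Alike-sym ∘ alike s ; gram = λ k l → sym (gram s k l) }

    Similar-trans : {x y z : K → M} → Similar x y → Similar y z → Similar x z
    Similar-trans s t = record
      { alike = λ k → Alike-trans (alike s k) (alike t k)
      ; gram  = λ k l → trans (gram s k l) (gram t k l)
      }


  Preserves : {K : Set} → (K → M) → (K → M) → Set₁
  Preserves {K} x y = ∀ {n} {R : Pred (Fin n → M) 0ℓ} → Definable R →
                      (k : Fin n → K) → R (x ∘ k) → R (y ∘ k)

  module SimilarPreserves {n : ℕ} {x y : Fin n → M} (sim : Similar x y) where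

    private
      s : Fin n → Sort
      s = proj₁ ∘ x

      -- Rewrites `y` in the sorts of `x`: a formula belongs to one assignment of sorts, and both
      -- environments must interpret the same formula.
      pull : ∀ {m m′} → Alike m m′ → ⟦ proj₁ m ⟧ˢ
      pull (vectors {w = w}) = w
      pull (scalars {r})     = r

      pull-≡ : ∀ {m m′} (a : Alike m m′) → (proj₁ m , pull a) ≡ m′
      pull-≡ vectors = refl
      pull-≡ scalars = refl

      e e′ : Env s
      e  = proj₂ ∘ x
      e′ = pull ∘ alike sim

      -- Pairs linear combinations of `x` and `y` with the same coefficients. The two values of a
      -- vector term need not be equal; this is the relation that they keep.
      data Span : V → V → Set where
        gen  : ∀ i → Span (vec (x i)) (vec (y i))
        add  : ∀ {u u′ v v′} → Span u u′ → Span v v′ → Span (u ⊕ v) (u′ ⊕ v′)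
        mult : ∀ r {u u′} → Span u u′ → Span (r • u) (r • u′)

      gen-gram : ∀ i {w w′} → Span w w′ → ⟨ vec (x i) , w ⟩ ≡ ⟨ vec (y i) , w′ ⟩
      gen-gram i (gen j) = gram sim i j
      gen-gram i (add {u} {u′} {v} {v′} p q) = trans (⟨⊕⟩ʳ _ u v)
        (trans (cong₂ _+_ (gen-gram i p) (gen-gram i q)) (sym (⟨⊕⟩ʳ _ u′ v′)))
      gen-gram i (mult r {u} {u′} p) = trans (⟨•⟩ʳ r _ u) (trans (cong (r *_) (gen-gram i p)) (sym (⟨•⟩ʳ r _ u′)))

      span-gram : ∀ {u u′ w w′} → Span u u′ → Span w w′ → ⟨ u , w ⟩ ≡ ⟨ u′ , w′ ⟩
      span-gram (gen i) q = gen-gram i q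
      span-gram {w = w} {w′} (add {u} {u′} {v} {v′} p p′) q = trans (⟨⟩-+ u v w)
        (trans (cong₂ _+_ (span-gram p q) (span-gram p′ q)) (sym (⟨⟩-+ u′ v′ w′)))
      span-gram {w = w} {w′} (mult r {u} {u′} p) q = trans (⟨⟩-• r u w)
        (trans (cong (r *_) (span-gram p q)) (sym (⟨⟩-• r u′ w′)))

      -- Equality is distance zero, and the Gram matrix determines distances.
      span-≡ : ∀ {u u′ w w′} → Span u u′ → Span w w′ → (u ≡ w → u′ ≡ w′) × (u′ ≡ w′ → u ≡ w)
      span-≡ {u} {u′} {w} {w′} p q =
        (λ u≡w → ‖⊝‖²≡0 (trans (sym dist) (zero-dist u≡w))) , λ u′≡w′ → ‖⊝‖²≡0 (trans dist (zero-dist u′≡w′))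
        where
        dist : ‖ u ⊝ w ‖² ≡ ‖ u′ ⊝ w′ ‖²
        dist = trans (‖⊝‖² u w) (trans (cong₂ _+_ (cong₂ (λ a b → a - 2# * b) (span-gram p p) (span-gram p q)) (span-gram q q))
          (sym (‖⊝‖² u′ w′)))
        zero-dist : ∀ {v z} → v ≡ z → ‖ v ⊝ z ‖² ≡ 0#
        zero-dist {v} refl = trans (⟨⊝⟩ˡ v v (v ⊝ v)) (-‿inverseʳ _)

      Corresponds : ∀ σ → ⟦ σ ⟧ˢ → ⟦ σ ⟧ˢ → Set
      Corresponds SV = Span
      Corresponds SF = _≡_

      corresponds : ∀ {m m′} (a : Alike m m′) → Span (vec m) (vec m′) → Corresponds (proj₁ m) (proj₂ m) (pull a)
      corresponds vectors p = p
      corresponds scalars _ = refl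

      eval-corresponds : ∀ {σ} (t : Term s σ) → Corresponds σ (eval t e) (eval t e′)
      eval-corresponds (var i)    = corresponds (alike sim i) (gen i)
      eval-corresponds (const r)  = refl
      eval-corresponds (t +ᶠ u)   = cong₂ _+_ (eval-corresponds t) (eval-corresponds u)
      eval-corresponds (t *ᶠ u)   = cong₂ _*_ (eval-corresponds t) (eval-corresponds u)
      eval-corresponds (-ᶠ t)     = cong -_ (eval-corresponds t)
      eval-corresponds (t ⁻¹ᶠ)    = cong _⁻¹ (eval-corresponds t)
      eval-corresponds ⟨ t , u ⟩ᶠ = span-gram (eval-corresponds t) (eval-corresponds u)
      eval-corresponds (t +ⱽ u)   = add (eval-corresponds t) (eval-corresponds u)
      eval-corresponds (t •ⱽ u)   = subst (λ r → Span (eval t e • eval u e) (r • eval u e′))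
                                      (eval-corresponds t) (mult (eval t e) (eval-corresponds u))

      ⊨-corresponds : ∀ φ → (e ⊨ φ → e′ ⊨ φ) × (e′ ⊨ φ → e ⊨ φ)
      ⊨-corresponds (_≈ᵗ_ {SV} t u) = span-≡ (eval-corresponds t) (eval-corresponds u)
      ⊨-corresponds (_≈ᵗ_ {SF} t u) = subst₂ _≡_ (eval-corresponds t) (eval-corresponds u) ,
                                      subst₂ _≡_ (sym (eval-corresponds t)) (sym (eval-corresponds u))
      ⊨-corresponds (t <ᵗ u) = subst₂ _<_ (eval-corresponds t) (eval-corresponds u) ,
                               subst₂ _<_ (sym (eval-corresponds t)) (sym (eval-corresponds u))
      ⊨-corresponds (¬ᵗ φ)   = (λ p q → p (proj₂ (⊨-corresponds φ) q)) , (λ p q → p (proj₁ (⊨-corresponds φ) q))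
      ⊨-corresponds (φ ∧ᵗ ψ) = (λ (p , q) → proj₁ (⊨-corresponds φ) p , proj₁ (⊨-corresponds ψ) q) ,
                               (λ (p , q) → proj₂ (⊨-corresponds φ) p , proj₂ (⊨-corresponds ψ) q)
      ⊨-corresponds (φ ∨ᵗ ψ) = (λ where (inj₁ p) → inj₁ (proj₁ (⊨-corresponds φ) p)
                                        (inj₂ q) → inj₂ (proj₁ (⊨-corresponds ψ) q)) ,
                               (λ where (inj₁ p) → inj₁ (proj₂ (⊨-corresponds φ) p)
                                        (inj₂ q) → inj₂ (proj₂ (⊨-corresponds ψ) q))

    transport : ∀ {R : Pred (Fin n → M) 0ℓ} → Definable R → R x → R y
    transport {R} def Rx = subst R (ext λ i → pull-≡ (alike sim i)) (Equivalence.from (proj₂ (def s) e′)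
      (proj₁ (⊨-corresponds (proj₁ (def s))) (Equivalence.to (proj₂ (def s) e) Rx)))

  module _ {K : Set} {x y : K → M} where

    Similar⇒Preserves : Similar x y → Preserves x y
    Similar⇒Preserves sim {R = R} def k = SimilarPreserves.transport
      (record { alike = alike sim ∘ k ; gram = λ i j → gram sim (k i) (k j) }) {R = R} def

  truth : ∀ {n} {s : Fin n → Sort} → QF s
  truth = const 0# ≈ᵗ const 0#

  -- This relation and the next two detect the sort, the value of a scalar and an inner product;
  -- together they recover `Similar` from a type.
  IsVector : Pred (Fin 1 → M) 0ℓ
  IsVector z = proj₁ (z zero) ≡ SV

  IsVector-definable : Definable IsVector
  IsVector-definable s = formula (s zero) , λ _ → correct (s zero)
    where
    formula : Sort → QF s
    formula SV = truth
    formula SF = ¬ᵗ truth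
    correct : ∀ σ {x} → (σ ≡ SV) ⇔ (x ⊨ formula σ)
    correct SV = mk⇔ (λ _ → refl) (λ _ → refl)
    correct SF = mk⇔ (λ ()) (λ f → contradiction refl f)

  IsScalar : Carrier → Pred (Fin 1 → M) 0ℓ
  IsScalar r z = z zero ≡ (SF , r)

  IsScalar-definable : ∀ r → Definable (IsScalar r)
  IsScalar-definable r s = formula (s zero) (var zero) , λ x → correct (s zero) (var zero) x
    where
    formula : ∀ σ → Term s σ → QF s
    formula SV t = ¬ᵗ truth
    formula SF t = t ≈ᵗ const r
    correct : ∀ σ (t : Term s σ) x → ((σ , eval t x) ≡ (SF , r)) ⇔ (x ⊨ formula σ t)
    correct SV t x = mk⇔ (λ ()) (λ f → contradiction refl f)
    correct SF t x = mk⇔ (λ where refl → refl) (cong (SF ,_))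

  HasGram : Carrier → Pred (Fin 2 → M) 0ℓ
  HasGram r z = ⟨ vec (z zero) , vec (z (suc zero)) ⟩ ≡ r

  HasGram-definable : ∀ r → Definable (HasGram r)
  HasGram-definable r s = (term (s zero) (s (suc zero)) (var zero) (var (suc zero)) ≈ᵗ const r) ,
                          λ x → correct (s zero) (s (suc zero)) (var zero) (var (suc zero)) x
    where
    term : ∀ σ τ → Term s σ → Term s τ → Term s SF
    term SV SV t u = ⟨ t , u ⟩ᶠ
    term SV SF t u = const 0#
    term SF τ  t u = const 0#
    eval-term : ∀ σ τ (t : Term s σ) (u : Term s τ) x →
                eval (term σ τ t u) x ≡ ⟨ vec (σ , eval t x) , vec (τ , eval u x) ⟩
    eval-term SV SV t u x = refl
    eval-term SV SF t u x = sym (⟨,0⟩ _)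
    eval-term SF τ  t u x = sym (⟨0,⟩ _)
    correct : ∀ σ τ (t : Term s σ) (u : Term s τ) x →
              (⟨ vec (σ , eval t x) , vec (τ , eval u x) ⟩ ≡ r) ⇔ (eval (term σ τ t u) x ≡ r)
    correct σ τ t u x = mk⇔ (trans (eval-term σ τ t u x)) (trans (sym (eval-term σ τ t u x)))

  module _ {K : Set} {x y : K → M} (pres : Preserves x y) where

    private
      is-vector : ∀ {m v} → proj₁ m ≡ SV → Alike (SV , v) m
      is-vector {SV , _} refl = vectors

      alike-at : ∀ k m → x k ≡ m → Alike (x k) (y k)
      alike-at k (SV , v) e = subst (λ m → Alike m (y k)) (sym e)
        (is-vector (pres {R = IsVector} IsVector-definable (λ _ → k) (cong proj₁ e)))
      alike-at k (SF , r) e = subst₂ Alike (sym e) (sym (pres {R = IsScalar r} (IsScalar-definable r) (λ _ → k) e)) scalars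

    Preserves⇒Similar : Similar x y
    Preserves⇒Similar = record
      { alike = λ k → alike-at k (x k) refl
      ; gram  = λ k l → sym (pres {R = HasGram ⟨ vec (x k) , vec (x l) ⟩} (HasGram-definable ⟨ vec (x k) , vec (x l) ⟩)
                               (λ where zero → k ; (suc _) → l) refl)
      }

  module _ {I J : Set} {a a′ : I → M} {b b′ : J → M} where

    Similar⇒tp⊆ : Similar [ a , b ]′ [ a′ , b′ ]′ → ∀ {e} → tp a b e → tp a′ b′ e
    Similar⇒tp⊆ sim {e} = Similar⇒Preserves sim {R = Expr.R e} (Expr.R∈ℛ e) (Expr.args e)

    tp⊆⇒Similar : (∀ {e} → tp a b e → tp a′ b′ e) → Similar [ a , b ]′ [ a′ , b′ ]′
    tp⊆⇒Similar sub = Preserves⇒Similar λ {n} {R} def k →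
      sub {record { arity = n ; R = R ; R∈ℛ = def ; args = k }}

  Similar-automorphism : (g : M ↔ M) → IsAutomorphism g → Similar (λ m → m) (Inverse.to g)
  Similar-automorphism g aut = Preserves⇒Similar λ {_} {R} def k → Equivalence.to (aut R def k)

  setVec : M → V → M
  setVec (SV , _) w = SV , w
  setVec (SF , r) w = SF , r

  Alike-setVec : ∀ m w → Alike m (setVec m w)
  Alike-setVec (SV , _) w = vectors
  Alike-setVec (SF , _) w = scalars

  -- At a scalar the norm condition forces `w` to vanish. Thus a copy computed on vector parts alone
  -- lifts to a sequence of mixed sorts.
  vec-setVec : ∀ m w → ‖ w ‖² ≡ ‖ vec m ‖² → vec (setVec m w) ≡ w
  vec-setVec (SV , _) w e = refl
  vec-setVec (SF , _) w e = sym (‖‖²≡0 (trans e (⟨0,⟩ 0ⱽ)))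

-- Countable sets and their enumerations

module CountableSets (em : ∀ {ℓ} → ExcludedMiddle ℓ) (ext : ∀ {a b} → Extensionality a b)
                     (ℝ : CompleteOrderedField) (H : HilbertSpace ℝ)
                     (ℵ₁ : Set) (isℵ₁ : IsAleph₁ ℵ₁) where

  open Classical em ext
  open HilbertGeometry em ext ℝ H
  open QuantifierFreeTypes em ext ℝ H ℵ₁
  open TwoSorted H
  open Simplicity structure Universe ℵ₁ using (M; Subset; IsSet; Free) renaming (∣_∣ to ∣_∣ˢ)

  ≺ℵ₁⇒≼ℕ : ∀ {I : Set} → card I ≺ card ℵ₁ → card I ≼ card ℕ
  ≺ℵ₁⇒≼ℕ = proj₂ isℵ₁ _

  module _ {a ℓ} {S : Setoid a ℓ} where

    ≼ℕ⇒≺ℵ₁ : S ≼ card ℕ → S ≺ card ℵ₁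
    ≼ℕ⇒≺ℵ₁ c = ≼-trans c (proj₁ (proj₁ isℵ₁)) , λ i → proj₂ (proj₁ isℵ₁) (≼-trans i c)

  Fin≼ℕ : ∀ {n} → card (Fin n) ≼ card ℕ
  Fin≼ℕ = mk↣ toℕ-injective

  Fin≺ℕ : ∀ {n} → card (Fin n) ≺ card ℕ
  Fin≺ℕ = Fin≼ℕ , λ i → ℕ→Fin-notInjective (Injection.to i) (Injection.injective i)

  module _ {A : Subset} where

    -- Minimality of ℵ₁ speaks of types, whereas `∣ A ∣ˢ` ignores proofs of membership; squashed
    -- membership gives a type of the same size.
    IsSet⇒countable : IsSet A → ∣ A ∣ˢ ≼ card ℕ
    IsSet⇒countable (A≼ℵ₁ , ℵ₁⋠A) = ≼-trans A≼A′ (≺ℵ₁⇒≼ℕ (≼-trans A′≼A A≼ℵ₁ , λ i → ℵ₁⋠A (≼-trans i A′≼A)))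
      where
      A′ : Set
      A′ = Σ[ m ∈ M ] Squash (A m)
      A≼A′ : ∣ A ∣ˢ ≼ card A′
      A≼A′ = record
        { to        = λ (m , p) → m , squash p
        ; cong      = λ { {m , p} {_ , q} refl → cong (m ,_) (Squash-irrelevant (squash p) (squash q)) }
        ; injective = cong proj₁
        }
      A′≼A : card A′ ≼ ∣ A ∣ˢ
      A′≼A = record
        { to        = λ (m , p) → m , unsquash p
        ; cong      = cong proj₁
        ; injective = λ { {m , p} {_ , q} refl → cong (m ,_) (Squash-irrelevant p q) }
        }

  ⊆-countable : {A B : Subset} → (∀ {m} → A m → B m) → ∣ B ∣ˢ ≼ card ℕ → ∣ A ∣ˢ ≼ card ℕ
  ⊆-countable A⊆B = ≼-trans (record
    { to        = λ (m , p) → m , A⊆B p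
    ; cong      = λ e → e
    ; injective = λ e → e
    })

  ∅-countable : ∣ (λ _ → ⊥) ∣ˢ ≼ card ℕ
  ∅-countable = record { to = λ (); cong = λ { {_ , ()} }; injective = λ { {_ , ()} } }

  -- Only vector parts are listed. Zero fills the indices outside the image of the injection and
  -- adds nothing to the span.
  record Enumerates (A : Subset) (d : ℕ → V) : Set where
    field
      member : ∀ k → d k ≡ 0ⱽ ⊎ ∃[ m ] A m × vec m ≡ d k
      covers : ∀ {m} → A m → ∃[ k ] d k ≡ vec m

  enumerate : {A : Subset} → ∣ A ∣ˢ ≼ card ℕ → ∃ (Enumerates A)
  enumerate {A} ι = d , record
    { member = λ k → member k em
    ; covers = λ p → Injection.to ι (_ , p) , covers p em
    }
    where
    At : ℕ → Set
    At k = Σ[ x ∈ ∃ A ] Injection.to ι x ≡ k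
    pick : ∀ {k} → Dec (At k) → V
    pick (yes (x , _)) = vec (proj₁ x)
    pick (no _)        = 0ⱽ
    d : ℕ → V
    d k = pick {k} em
    member : ∀ k (p : Dec (At k)) → pick p ≡ 0ⱽ ⊎ ∃[ m ] A m × vec m ≡ pick p
    member k (yes ((m , p) , _)) = inj₂ (m , p , refl)
    member k (no _)              = inj₁ refl
    covers : ∀ {m} (p : A m) (q : Dec (At (Injection.to ι (m , p)))) → pick q ≡ vec m
    covers p (yes (x , e)) = cong vec (Injection.injective ι e)
    covers p (no none)     = contradiction (_ , refl) none

  sequence : ∀ {I : Set} → card I ≼ card ℕ → (a : I → V) → Σ[ s ∈ (ℕ → V) ] Σ[ ι ∈ (I → ℕ) ] ∀ i → s (ι i) ≡ a i
  sequence {I} ι a = (λ k → pick {k} em) , Injection.to ι , λ i → pick-≡ i em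
    where
    At : ℕ → Set
    At k = Σ[ i ∈ I ] Injection.to ι i ≡ k
    pick : ∀ {k} → Dec (At k) → V
    pick (yes (i , _)) = a i
    pick (no _)        = 0ⱽ
    pick-≡ : ∀ i (p : Dec (At (Injection.to ι i))) → pick p ≡ a i
    pick-≡ i (yes (j , e)) = cong a (Injection.injective ι e)
    pick-≡ i (no none)     = contradiction (i , refl) none

-- Room orthogonal to small families of vectors

module Independence (em : ∀ {ℓ} → ExcludedMiddle ℓ) (ext : ∀ {a b} → Extensionality a b)
                    (ℝ : CompleteOrderedField) (H : HilbertSpace ℝ)
                    (ℵ₁ : Set) (isℵ₁ : IsAleph₁ ℵ₁)
                    (homogeneous : Simplicity.StronglyHomogeneous (TwoSorted.structure H) (TwoSorted.Universe H) ℵ₁)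
                    (ℕ≺Λ : card ℕ ≺ card (TwoSorted.Universe H))
                    {e : ℕ → HilbertSpace.V H} (oe : HilbertGeometry.Orthonormal em ext ℝ H e) where

  open Classical em ext
  open CompleteOrderedField ℝ hiding (_≤_)
  open RealField em ext ℝ
  open HilbertGeometry em ext ℝ H
  open QuantifierFreeTypes em ext ℝ H ℵ₁
  open CountableSets em ext ℝ H ℵ₁ isℵ₁
  open TwoSorted H
  open Simplicity structure Universe ℵ₁ renaming (∣_∣ to ∣_∣ˢ)
  open ≡-Reasoning

  module _ {X : Set} (X-infinite : card ℕ ≼ card X) (X-small : card X ≺ card M) where

    -- An automorphism carries fam to its image under Shift.shift, which
    -- leaves room; pull that room back.
    orthonormal-complement : {Q : Set} → card Q ≼ card ℕ → (fam : X → Q → V) →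
                             Σ[ h ∈ (ℕ → V) ] Orthonormal h × ∀ k x q → ⟨ h k , fam x q ⟩ ≡ 0#
    orthonormal-complement {Q} Q≼ℕ fam = (λ k → vec (m k)) ,
      record { ortho = λ {i} {j} i≢j → trans (gram-h i j) (Orthonormal.ortho evens i≢j)
             ; unit = λ i → trans (gram-h i i) (Orthonormal.unit evens i) } ,
      λ k x q → begin
        ⟨ vec (m k) , fam x q ⟩                                      ≡⟨ gram g-similar (m k) (SV , fam x q) ⟩
        ⟨ vec (g (m k)) , vec (g (SV , fam x q)) ⟩                   ≡⟨ cong₂ ⟨_,_⟩ (cong vec (g-m k)) (cong vec (g-fam (x , q))) ⟩
        ⟨ E k , shift (fam x q) ⟩                                    ≡⟨ ⟨⟩-sym _ _ ⟩
        ⟨ shift (fam x q) , E k ⟩                                    ≡⟨ shift-⊥ (fam x q) k ⟩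
        0#                                                           ∎
      where
      open Shift oe
      E : ℕ → V
      E k = e (2 ℕ.* k)
      -- Homogeneity asks for fewer than λ elements; a countable factor does not enlarge the
      -- infinite `X`.
      X×Q≼X : card (X × Q) ≼ card X
      X×Q≼X = ≼-trans (mk↣ {to = λ (x , q) → x , Injection.to Q≼ℕ q} λ {(x , q)} {(y , r)} eq →
                cong₂ _,_ (cong proj₁ eq) (Injection.injective Q≼ℕ (cong proj₂ eq))) (≼ℕ×-absorbs X-infinite)
      small : card (X × Q) ≺ card M
      small = ≼-trans X×Q≼X (proj₁ X-small) , λ i → proj₂ X-small (≼-trans i X×Q≼X)
      before after : X × Q → M
      before (x , q) = SV , fam x q
      after  (x , q) = SV , shift (fam x q)
      sim : Similar [ before , (λ ()) ]′ [ after , (λ ()) ]′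
      sim = record
        { alike = λ { (inj₁ _) → vectors ; (inj₂ ()) }
        ; gram  = λ { (inj₁ (x , q)) (inj₁ (y , r)) → sym (shift-isometry (fam x q) (fam y r))
                  ; (inj₁ _) (inj₂ ()) ; (inj₂ ()) _ }
        }
      auto = homogeneous (X × Q) small before after
               ((λ {x} → Similar⇒tp⊆ sim {x}) , (λ {x} → Similar⇒tp⊆ (Similar-sym sim) {x}))
      g = Inverse.to (proj₁ auto)
      g-fam : ∀ i → g (before i) ≡ after i
      g-fam = proj₂ (proj₂ auto)
      g-similar : Similar (λ m → m) g
      g-similar = Similar-automorphism (proj₁ auto) (proj₁ (proj₂ auto))
      m : ℕ → M
      m k = Inverse.from (proj₁ auto) (SV , E k)
      g-m : ∀ k → g (m k) ≡ (SV , E k)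
      g-m k = Inverse.strictlyInverseˡ (proj₁ auto) (SV , E k)
      gram-h : ∀ i j → ⟨ vec (m i) , vec (m j) ⟩ ≡ ⟨ E i , E j ⟩
      gram-h i j = trans (gram g-similar (m i) (m j)) (cong₂ ⟨_,_⟩ (cong vec (g-m i)) (cong vec (g-m j)))

    -- The component of a orthogonal to d is rebuilt, via its Gram–Schmidt
    -- basis, on an orthonormal sequence orthogonal to fam and d.
    independent-copy : (d a : ℕ → V) → let open GramSchmidt d in
                       {Q : Set} → card Q ≼ card ℕ → (fam : X → Q → V) →
                       Σ[ a′ ∈ (ℕ → V) ] (∀ i j → ⟨ a′ i , a′ j ⟩ ≡ ⟨ a i , a j ⟩) ×
                         (∀ i x q → ⟨ a′ i , fam x q ⟩ ≡ ⟨ P (a i) , fam x q ⟩)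
    independent-copy d a {Q} Q≼ℕ fam = a′ , gram-a′ , a′-fam
      where
      open GramSchmidt d
      w : ℕ → V
      w i = a i ⊝ P (a i)
      module W = GramSchmidt w
      -- `d` joins the family, so that `h` is also orthogonal to the closed span onto which `P`
      -- projects.
      fam′ : X → Q ⊎ ℕ → V
      fam′ x (inj₁ q) = fam x q
      fam′ x (inj₂ k) = d k
      Q⊎ℕ≼ℕ : card (Q ⊎ ℕ) ≼ card ℕ
      Q⊎ℕ≼ℕ = ≼-trans (mk↣ {to = map₁ (Injection.to Q≼ℕ)} map₁-injective) (mk↣ merge-injective)
        where
        map₁-injective : Injective _≡_ _≡_ (map₁ {C = ℕ} (Injection.to Q≼ℕ))
        map₁-injective {inj₁ p} {inj₁ q} eq = cong inj₁ (Injection.injective Q≼ℕ (inj₁-injective eq))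
        map₁-injective {inj₂ p} {inj₂ q} eq = cong inj₂ (inj₂-injective eq)
      comp = orthonormal-complement Q⊎ℕ≼ℕ fam′
      h = proj₁ comp
      oh = proj₁ (proj₂ comp)
      h⊥ = proj₂ (proj₂ comp)
      -- Any index will do, since `fam′` lists `d` under each.
      x₀ : X
      x₀ = Injection.to X-infinite 0
      -- Zero or one: `t k` drops `h k` where the Gram-Schmidt vector vanishes, which makes `W.gs`
      -- and `t` isometric.
      n : ℕ → Carrier
      n k = ‖ W.gs k ‖²
      nn : ∀ k → n k * n k ≡ n k
      nn k = Orthonormal₀.idem W.orthonormal₀ (W.gs k) k
      t : ℕ → V
      t k = n k • h k
      ‖t‖² : ∀ k → ‖ t k ‖² ≡ n k
      ‖t‖² k = begin
        ⟨ n k • h k , n k • h k ⟩      ≡⟨ trans (⟨⟩-• (n k) (h k) (t k)) (cong (n k *_) (⟨•⟩ʳ (n k) (h k) (h k))) ⟩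
        n k * (n k * ‖ h k ‖²)         ≡⟨ cong (λ z → n k * (n k * z)) (Orthonormal.unit oh k) ⟩
        n k * (n k * 1#)               ≡⟨ cong (n k *_) (*-identityʳ (n k)) ⟩
        n k * n k                      ≡⟨ nn k ⟩
        n k                            ∎
      ⟨t⟩ : ∀ {v} k → ⟨ h k , v ⟩ ≡ 0# → ⟨ t k , v ⟩ ≡ 0#
      ⟨t⟩ {v} k z = trans (⟨⟩-• (n k) (h k) v) (trans (cong (n k *_) z) (zeroʳ (n k)))
      ot : Orthonormal₀ t
      ot = record
        { ortho = λ {i} {j} i≢j → ⟨t⟩ i (trans (⟨•⟩ʳ (n j) (h i) (h j))
                    (trans (cong (n j *_) (Orthonormal.ortho oh i≢j)) (zeroʳ (n j))))
        ; idem  = λ v i → begin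
            ⟨ v , t i ⟩ * ‖ t i ‖²          ≡⟨ cong₂ _*_ (⟨•⟩ʳ (n i) v (h i)) (‖t‖² i) ⟩
            n i * ⟨ v , h i ⟩ * n i         ≡⟨ solve 2 (λ n v → n :* v :* n := n :* n :* v) refl (n i) ⟨ v , h i ⟩ ⟩
            n i * n i * ⟨ v , h i ⟩         ≡⟨ cong (_* ⟨ v , h i ⟩) (nn i) ⟩
            n i * ⟨ v , h i ⟩               ≡⟨ ⟨•⟩ʳ (n i) v (h i) ⟨
            ⟨ v , t i ⟩                     ∎
        }
      iso : Isometric W.gs t
      iso i = sym (‖t‖² i)
      open Series W.orthonormal₀ ot iso using (Φ)
      a′ : ℕ → V
      a′ i = P (a i) ⊕ Φ (w i)
      Φ⊥ : ∀ i {v} → (∀ k → ⟨ h k , v ⟩ ≡ 0#) → ⟨ Φ (w i) , v ⟩ ≡ 0#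
      Φ⊥ i h⊥v = ⟨Φ⟩≡0 {ou = W.orthonormal₀} {ot} {iso} (w i) λ k → ⟨t⟩ k (h⊥v k)
      h⊥P : ∀ k v → ⟨ h k , P v ⟩ ≡ 0#
      h⊥P k v = trans (⟨⟩-sym _ _) (⟨Φ⟩≡0 {ou = orthonormal₀} {orthonormal₀} {λ _ → refl} v λ j →
        trans (⟨⟩-sym _ _) (⊥d⇒⊥gs (h k) (suc j) (λ {l} _ → h⊥ k x₀ (inj₂ l)) ℕ.≤-refl))
      ΦΦ : ∀ i j → ⟨ Φ (w i) , Φ (w j) ⟩ ≡ ⟨ a i , a j ⟩ - ⟨ P (a i) , P (a j) ⟩
      ΦΦ i j = begin
        ⟨ Φ (w i) , Φ (w j) ⟩          ≡⟨ ⟨Φ,Φ⟩ {ou = W.orthonormal₀} {ot} {W.orthonormal₀} {iso} {λ _ → refl} (w i) (w j) ⟩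
        ⟨ W.P (w i) , W.P (w j) ⟩      ≡⟨ cong₂ ⟨_,_⟩ (W.P-d i) (W.P-d j) ⟩
        ⟨ w i , w j ⟩                  ≡⟨ ⟨⊝P,⊝P⟩ (a i) (a j) ⟩
        ⟨ a i , a j ⟩ - ⟨ P (a i) , P (a j) ⟩   ∎
      gram-a′ : ∀ i j → ⟨ a′ i , a′ j ⟩ ≡ ⟨ a i , a j ⟩
      gram-a′ i j = begin
        ⟨ P (a i) ⊕ Φ (w i) , a′ j ⟩                       ≡⟨ ⟨⟩-+ (P (a i)) (Φ (w i)) (a′ j) ⟩
        ⟨ P (a i) , a′ j ⟩ + ⟨ Φ (w i) , a′ j ⟩            ≡⟨ cong₂ _+_ (⟨⊕⟩ʳ (P (a i)) (P (a j)) (Φ (w j))) (⟨⊕⟩ʳ (Φ (w i)) (P (a j)) (Φ (w j))) ⟩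
        (⟨ P (a i) , P (a j) ⟩ + ⟨ P (a i) , Φ (w j) ⟩) + (⟨ Φ (w i) , P (a j) ⟩ + ⟨ Φ (w i) , Φ (w j) ⟩)
          ≡⟨ cong₂ _+_ (cong (⟨ P (a i) , P (a j) ⟩ +_) (trans (⟨⟩-sym _ _) (Φ⊥ j λ k → h⊥P k (a i))))
                       (cong₂ _+_ (Φ⊥ i λ k → h⊥P k (a j)) (ΦΦ i j)) ⟩
        (⟨ P (a i) , P (a j) ⟩ + 0#) + (0# + (⟨ a i , a j ⟩ - ⟨ P (a i) , P (a j) ⟩))
          ≡⟨ solve 2 (λ p q → (p :+ :0) :+ (:0 :+ (q :- p)) := q) refl ⟨ P (a i) , P (a j) ⟩ ⟨ a i , a j ⟩ ⟩
        ⟨ a i , a j ⟩                                      ∎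
      a′-fam : ∀ i x q → ⟨ a′ i , fam x q ⟩ ≡ ⟨ P (a i) , fam x q ⟩
      a′-fam i x q = begin
        ⟨ P (a i) ⊕ Φ (w i) , fam x q ⟩                    ≡⟨ ⟨⟩-+ (P (a i)) (Φ (w i)) (fam x q) ⟩
        ⟨ P (a i) , fam x q ⟩ + ⟨ Φ (w i) , fam x q ⟩      ≡⟨ cong (⟨ P (a i) , fam x q ⟩ +_) (Φ⊥ i λ k → h⊥ k x (inj₁ q)) ⟩
        ⟨ P (a i) , fam x q ⟩ + 0#                         ≡⟨ +-identityʳ _ ⟩
        ⟨ P (a i) , fam x q ⟩                              ∎

-- Freeness as orthogonality modulo the closed span of the base

module Freeness (em : ∀ {ℓ} → ExcludedMiddle ℓ) (ext : ∀ {a b} → Extensionality a b)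
                (ℝ : CompleteOrderedField) (H : HilbertSpace ℝ)
                (ℵ₁ : Set) (isℵ₁ : IsAleph₁ ℵ₁)
                (homogeneous : Simplicity.StronglyHomogeneous (TwoSorted.structure H) (TwoSorted.Universe H) ℵ₁)
                (ℕ≺Λ : card ℕ ≺ card (TwoSorted.Universe H))
                {e : ℕ → HilbertSpace.V H} (oe : HilbertGeometry.Orthonormal em ext ℝ H e) where

  open Classical em ext
  open CompleteOrderedField ℝ
  open RealField em ext ℝ
  open HilbertGeometry em ext ℝ H
  open QuantifierFreeTypes em ext ℝ H ℵ₁
  open CountableSets em ext ℝ H ℵ₁ isℵ₁
  open Independence em ext ℝ H ℵ₁ isℵ₁ homogeneous ℕ≺Λ oe
  open TwoSorted H
  open Simplicity structure Universe ℵ₁ renaming (∣_∣ to ∣_∣ˢ)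
  open ≡-Reasoning

  ℕ-infinite : card ℕ ≼ card ℕ
  ℕ-infinite = mk↣ λ e → e

  module _ {C : Subset} {d : ℕ → V} (enum-d : Enumerates C d) where

    open GramSchmidt d
    open Enumerates enum-d

    fixed : ∀ {c} → C c → P (vec c) ≡ vec c
    fixed Cc = let k , dk≡c = covers Cc in subst (λ v → P v ≡ v) dk≡c (P-d k)

    agree-on : ∀ {x y} → (∀ {c} → C c → ⟨ vec c , x ⟩ ≡ ⟨ vec c , y ⟩) → ∀ k → ⟨ d k , x ⟩ ≡ ⟨ d k , y ⟩
    agree-on {x} {y} agree k with member k
    ... | inj₁ dk≡0 = trans (cong ⟨_, x ⟩ dk≡0) (trans (⟨0,⟩ x) (sym (trans (cong ⟨_, y ⟩ dk≡0) (⟨0,⟩ y))))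
    ... | inj₂ (c , Cc , c≡dk) = subst (λ v → ⟨ v , x ⟩ ≡ ⟨ v , y ⟩) c≡dk (agree Cc)

    -- Self-adjointness moves the projection to `z`, and `P z` is a limit of combinations of vectors
    -- from `C`.
    P-agree : ∀ {x y} → (∀ {c} → C c → ⟨ vec c , x ⟩ ≡ ⟨ vec c , y ⟩) → ∀ z → ⟨ P x , z ⟩ ≡ ⟨ P y , z ⟩
    P-agree {x} {y} agree z = begin
      ⟨ P x , z ⟩    ≡⟨ P-self-adjoint x z ⟩
      ⟨ x , P z ⟩    ≡⟨ ⟨⟩-sym _ _ ⟩
      ⟨ P z , x ⟩    ≡⟨ P-cong z (agree-on agree) ⟩
      ⟨ P z , y ⟩    ≡⟨ ⟨⟩-sym _ _ ⟩
      ⟨ y , P z ⟩    ≡⟨ P-self-adjoint y z ⟨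
      ⟨ P y , z ⟩    ∎

    ⟨P,C⟩ : ∀ v {c} → C c → ⟨ P v , vec c ⟩ ≡ ⟨ v , vec c ⟩
    ⟨P,C⟩ v {c} Cc = trans (P-self-adjoint v (vec c)) (cong ⟨ v ,_⟩ (fixed Cc))

    Orthogonal : Subset → Subset → Set
    Orthogonal A B = ∀ {a b} → A a → B b → ⟨ vec a , vec b ⟩ ≡ ⟨ P (vec a) , vec b ⟩

    module _ {A B : Subset} where

      -- A copy of `a` independent of the whole sequence `b′` has with `b′ x` the products of `P a`.
      -- These are the products of `a` with `b`, because `b′ x` and `b` have the same type over `C`;
      -- so the copy realizes the union.
      orthogonal⇒free : Orthogonal A B → Free ℵ₁ A B C
      orthogonal⇒free orth I J I≺ℵ₁ J≺ℵ₁ a b a∈A b∈B∪C D = not-realized (a′ , λ x {e} → Similar⇒tp⊆ (realizes x) {e})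
        where
        open Divides D
        J≼ℕ = ≺ℵ₁⇒≼ℕ J≺ℵ₁
        seq = sequence (≺ℵ₁⇒≼ℕ I≺ℵ₁) (vec ∘ a)
        s = proj₁ seq
        ι = proj₁ (proj₂ seq)
        s-ι : ∀ i → s (ι i) ≡ vec (a i)
        s-ι = proj₂ (proj₂ seq)
        copy = independent-copy infinite small d s J≼ℕ (λ x j → vec (b′ x j))
        c = proj₁ copy
        gram-c : ∀ i k → ⟨ c (ι i) , c (ι k) ⟩ ≡ ⟨ vec (a i) , vec (a k) ⟩
        gram-c i k = trans (proj₁ (proj₂ copy) (ι i) (ι k)) (cong₂ ⟨_,_⟩ (s-ι i) (s-ι k))
        a′ : I → M
        a′ i = setVec (a i) (c (ι i))
        vec-a′ : ∀ i → vec (a′ i) ≡ c (ι i)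
        vec-a′ i = vec-setVec (a i) (c (ι i)) (gram-c i i)
        same : ∀ x → Similar [ b′ x , enum C ]′ [ b , enum C ]′
        same x = tp⊆⇒Similar λ {e} → proj₁ (same-type x) {e}
        a-b : ∀ i j → ⟨ vec (a i) , vec (b j) ⟩ ≡ ⟨ P (vec (a i)) , vec (b j) ⟩
        a-b i j with b∈B∪C j
        ... | inj₁ b∈B = orth (a∈A i) b∈B
        ... | inj₂ b∈C = sym (⟨P,C⟩ (vec (a i)) b∈C)
        a-b′ : ∀ i x j → ⟨ vec (a i) , vec (b j) ⟩ ≡ ⟨ vec (a′ i) , vec (b′ x j) ⟩
        a-b′ i x j = begin
          ⟨ vec (a i) , vec (b j) ⟩         ≡⟨ a-b i j ⟩
          ⟨ P (vec (a i)) , vec (b j) ⟩     ≡⟨ P-cong (vec (a i)) (agree-on λ {m} Cm → gram (same x) (inj₂ (m , Cm)) (inj₁ j)) ⟨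
          ⟨ P (vec (a i)) , vec (b′ x j) ⟩  ≡⟨ cong (λ v → ⟨ P v , vec (b′ x j) ⟩) (s-ι i) ⟨
          ⟨ P (s (ι i)) , vec (b′ x j) ⟩    ≡⟨ proj₂ (proj₂ copy) (ι i) x j ⟨
          ⟨ c (ι i) , vec (b′ x j) ⟩        ≡⟨ cong ⟨_, vec (b′ x j) ⟩ (vec-a′ i) ⟨
          ⟨ vec (a′ i) , vec (b′ x j) ⟩     ∎
        realizes : ∀ x → Similar [ a , b ]′ [ a′ , b′ x ]′
        realizes x = record
          { alike = λ where
              (inj₁ i) → Alike-setVec (a i) (c (ι i))
              (inj₂ j) → Alike-sym (alike (same x) (inj₁ j))
          ; gram = λ where
              (inj₁ i) (inj₁ k) → sym (trans (cong₂ ⟨_,_⟩ (vec-a′ i) (vec-a′ k)) (gram-c i k))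
              (inj₁ i) (inj₂ j) → a-b′ i x j
              (inj₂ j) (inj₁ i) → trans (⟨⟩-sym _ _) (trans (a-b′ i x j) (⟨⟩-sym _ _))
              (inj₂ j) (inj₂ l) → sym (gram (same x) (inj₁ j) (inj₁ l))
          }

    -- The vectors P b ⊕ root w • h n, with h n orthonormal, are copies of
    -- b over C.  By Bessel no vector has the same nonzero product with
    -- all the h n, so tp(a/b,C) divides unless ⟨ a , w ⟩ = 0.
    module Dividing (b : M) (w≢0 : vec b ⊝ P (vec b) ≢ 0ⱽ) where

      w : V
      w = vec b ⊝ P (vec b)

      τ : Carrier
      τ = root w

      room : Σ[ h ∈ (ℕ → V) ] Orthonormal h × ∀ k x q → ⟨ h k , d q ⟩ ≡ 0#
      room = orthonormal-complement {ℕ} ℕ-infinite ℕ≺Λ ℕ-infinite (λ _ → d)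

      h : ℕ → V
      h = proj₁ room

      oh : Orthonormal h
      oh = proj₁ (proj₂ room)

      ⟨P,h⟩ : ∀ v k → ⟨ P v , h k ⟩ ≡ 0#
      ⟨P,h⟩ v k = ⟨Φ⟩≡0 {ou = orthonormal₀} {orthonormal₀} {λ _ → refl} v λ j →
        trans (⟨⟩-sym _ _) (⊥d⇒⊥gs (h k) (suc j) (λ {l} _ → proj₂ (proj₂ room) k 0 l) ℕ.≤-refl)

      -- The coordinate of `v` along the unit vector in the direction of `w`.
      weight : V → Carrier
      weight v = ⟨ v ⊝ P v , w ⟩ * τ ⁻¹

      move : ℕ → V → V
      move n v = P v ⊕ weight v • h n

      ⟨move,⟩ : ∀ n v z → ⟨ move n v , z ⟩ ≡ ⟨ P v , z ⟩ + weight v * ⟨ h n , z ⟩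
      ⟨move,⟩ n v z = trans (⟨⟩-+ (P v) (weight v • h n) z) (cong (⟨ P v , z ⟩ +_) (⟨⟩-• (weight v) (h n) z))

      ⟨move,move⟩ : ∀ m n u v → ⟨ move m u , move n v ⟩ ≡ ⟨ P u , P v ⟩ + weight u * (weight v * ⟨ h m , h n ⟩)
      ⟨move,move⟩ m n u v = begin
        ⟨ move m u , move n v ⟩                                        ≡⟨ ⟨move,⟩ m u (move n v) ⟩
        ⟨ P u , move n v ⟩ + weight u * ⟨ h m , move n v ⟩             ≡⟨ cong₂ (λ x y → x + weight u * y) (expand (P u)) (expand (h m)) ⟩
        (⟨ P u , P v ⟩ + weight v * ⟨ P u , h n ⟩) + weight u * (⟨ h m , P v ⟩ + weight v * ⟨ h m , h n ⟩)
          ≡⟨ cong₂ (λ x y → (⟨ P u , P v ⟩ + weight v * x) + weight u * (y + weight v * ⟨ h m , h n ⟩))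
               (⟨P,h⟩ u n) (trans (⟨⟩-sym _ _) (⟨P,h⟩ v m)) ⟩
        (⟨ P u , P v ⟩ + weight v * 0#) + weight u * (0# + weight v * ⟨ h m , h n ⟩)
          ≡⟨ solve 4 (λ p a b c → (p :+ b :* :0) :+ a :* (:0 :+ b :* c) := p :+ a :* (b :* c)) refl ⟨ P u , P v ⟩ (weight u) (weight v) ⟨ h m , h n ⟩ ⟩
        ⟨ P u , P v ⟩ + weight u * (weight v * ⟨ h m , h n ⟩)          ∎
        where
        expand : ∀ z → ⟨ z , move n v ⟩ ≡ ⟨ z , P v ⟩ + weight v * ⟨ z , h n ⟩
        expand z = trans (⟨⊕⟩ʳ z (P v) (weight v • h n)) (cong (⟨ z , P v ⟩ +_) (⟨•⟩ʳ (weight v) z (h n)))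

      -- `move n` forgets whatever part of `v ⊝ P v` is not along `w`, so isometry is claimed only
      -- for `b` and the elements of `C`.
      data Movable : M → Set where
        itself : Movable b
        fixes  : ∀ {c} → C c → Movable c

      weight-b : weight (vec b) ≡ τ
      weight-b = begin
        ‖ w ‖² * τ ⁻¹       ≡⟨ cong (_* τ ⁻¹) (root² w) ⟨
        τ * τ * τ ⁻¹        ≡⟨ *-assoc τ τ (τ ⁻¹) ⟩
        τ * (τ * τ ⁻¹)      ≡⟨ cong (τ *_) (⁻¹-inverse τ (root≢0 w≢0)) ⟩
        τ * 1#              ≡⟨ *-identityʳ τ ⟩
        τ                   ∎

      ⊝P-C : ∀ {c} → C c → ∀ z → ⟨ vec c ⊝ P (vec c) , z ⟩ ≡ 0#
      ⊝P-C {c} Cc z = trans (⟨⊝⟩ˡ (vec c) (P (vec c)) z)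
        (trans (cong (λ v → ⟨ vec c , z ⟩ - ⟨ v , z ⟩) (fixed Cc)) (-‿inverseʳ _))

      weight-C : ∀ {c} → C c → weight (vec c) ≡ 0#
      weight-C Cc = trans (cong (_* τ ⁻¹) (⊝P-C Cc w)) (zeroˡ _)

      weights : ∀ {x y} → Movable x → Movable y →
                weight (vec x) * weight (vec y) ≡ ⟨ vec x ⊝ P (vec x) , vec y ⊝ P (vec y) ⟩
      weights itself itself = trans (cong₂ _*_ weight-b weight-b) (root² w)
      weights {y = y} (fixes Cc) _ = trans (trans (cong (_* weight (vec y)) (weight-C Cc)) (zeroˡ _)) (sym (⊝P-C Cc _))
      weights itself (fixes Cc) = trans (trans (cong (weight (vec b) *_) (weight-C Cc)) (zeroʳ _))
                                    (sym (trans (⟨⟩-sym _ _) (⊝P-C Cc w)))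

      move-isometry : ∀ n {x y} → Movable x → Movable y → ⟨ move n (vec x) , move n (vec y) ⟩ ≡ ⟨ vec x , vec y ⟩
      move-isometry n {x} {y} mx my = begin
        ⟨ move n u , move n v ⟩                                    ≡⟨ ⟨move,move⟩ n n u v ⟩
        ⟨ P u , P v ⟩ + weight u * (weight v * ⟨ h n , h n ⟩)      ≡⟨ cong (λ z → ⟨ P u , P v ⟩ + weight u * (weight v * z)) (Orthonormal.unit oh n) ⟩
        ⟨ P u , P v ⟩ + weight u * (weight v * 1#)                 ≡⟨ cong (λ z → ⟨ P u , P v ⟩ + weight u * z) (*-identityʳ _) ⟩
        ⟨ P u , P v ⟩ + weight u * weight v                        ≡⟨ cong (⟨ P u , P v ⟩ +_) (trans (weights mx my) (⟨⊝P,⊝P⟩ u v)) ⟩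
        ⟨ P u , P v ⟩ + (⟨ u , v ⟩ - ⟨ P u , P v ⟩)                ≡⟨ solve 2 (λ p q → p :+ (q :- p) := q) refl ⟨ P u , P v ⟩ ⟨ u , v ⟩ ⟩
        ⟨ u , v ⟩                                                  ∎
        where
        u = vec x
        v = vec y

      moveᴹ : ℕ → M → M
      moveᴹ n m = setVec m (move n (vec m))

      vec-moveᴹ : ∀ n {m} → Movable m → vec (moveᴹ n m) ≡ move n (vec m)
      vec-moveᴹ n {m} mm = vec-setVec m (move n (vec m)) (move-isometry n mm mm)

      move-C : ∀ n {c} → C c → move n (vec c) ≡ vec c
      move-C n {c} Cc = V-ext λ z → begin
        ⟨ move n (vec c) , z ⟩                                ≡⟨ ⟨move,⟩ n (vec c) z ⟩
        ⟨ P (vec c) , z ⟩ + weight (vec c) * ⟨ h n , z ⟩      ≡⟨ cong₂ (λ v r → ⟨ v , z ⟩ + r * ⟨ h n , z ⟩) (fixed Cc) (weight-C Cc) ⟩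
        ⟨ vec c , z ⟩ + 0# * ⟨ h n , z ⟩                      ≡⟨ solve 2 (λ a b → a :+ :0 :* b := a) refl ⟨ vec c , z ⟩ ⟨ h n , z ⟩ ⟩
        ⟨ vec c , z ⟩                                         ∎

      module _ {J : Set} (bJ : J → M) (movable : ∀ j → Movable (bJ j)) where

        copies : ℕ → J → M
        copies n j = moveᴹ n (bJ j)

        vec-copies : ∀ n j → vec (copies n j) ≡ move n (vec (bJ j))
        vec-copies n j = vec-moveᴹ n (movable j)

        copies-C : ∀ n j {c} → C c → ⟨ vec (copies n j) , vec c ⟩ ≡ ⟨ vec (bJ j) , vec c ⟩
        copies-C n j {c} Cc = begin
          ⟨ vec (copies n j) , vec c ⟩                     ≡⟨ cong₂ ⟨_,_⟩ (vec-copies n j) (sym (move-C n Cc)) ⟩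
          ⟨ move n (vec (bJ j)) , move n (vec c) ⟩         ≡⟨ move-isometry n (movable j) (fixes Cc) ⟩
          ⟨ vec (bJ j) , vec c ⟩                           ∎

        copies-same : ∀ n → Similar [ copies n , enum C ]′ [ bJ , enum C ]′
        copies-same n = record
          { alike = λ where
              (inj₁ j) → Alike-sym (Alike-setVec (bJ j) _)
              (inj₂ (c , _)) → Alike-refl c
          ; gram = λ where
              (inj₁ j) (inj₁ l) → trans (cong₂ ⟨_,_⟩ (vec-copies n j) (vec-copies n l)) (move-isometry n (movable j) (movable l))
              (inj₁ j) (inj₂ (c , Cc)) → copies-C n j Cc
              (inj₂ (c , Cc)) (inj₁ j) → trans (⟨⟩-sym _ _) (trans (copies-C n j Cc) (⟨⟩-sym _ _))
              (inj₂ _) (inj₂ _) → refl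
          }

        ⟨h,h⟩-increasing : ∀ {n} {x y : Fin n → ℕ} → Increasing ℕ._<_ x → Increasing ℕ._<_ y →
                           ∀ i j → ⟨ h (x i) , h (x j) ⟩ ≡ ⟨ h (y i) , h (y j) ⟩
        ⟨h,h⟩-increasing {x = x} {y} inc-x inc-y i j = go (<ᶠ-cmp i j)
          where
          go : Tri (i <ᶠ j) (i ≡ j) (j <ᶠ i) → ⟨ h (x i) , h (x j) ⟩ ≡ ⟨ h (y i) , h (y j) ⟩
          go (tri< i<j _ _)  = trans (Orthonormal.ortho oh (ℕ.<⇒≢ (inc-x i<j))) (sym (Orthonormal.ortho oh (ℕ.<⇒≢ (inc-y i<j))))
          go (tri≈ _ refl _) = trans (Orthonormal.unit oh (x i)) (sym (Orthonormal.unit oh (y i)))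
          go (tri> _ _ j<i)  = trans (Orthonormal.ortho oh (ℕ.>⇒≢ (inc-x j<i))) (sym (Orthonormal.ortho oh (ℕ.>⇒≢ (inc-y j<i))))

        -- Only the products `⟨ h m , h n ⟩` involve the indices, and these depend just on whether
        -- the indices are equal.
        copies-similar : ∀ {n} (x y : Fin n → ℕ) → Increasing ℕ._<_ x → Increasing ℕ._<_ y →
                         Similar [ concat (copies ∘ x) , enum C ]′ [ concat (copies ∘ y) , enum C ]′
        copies-similar x y inc-x inc-y = record
          { alike = λ where
              (inj₁ (i , j)) → Alike-trans (Alike-sym (Alike-setVec (bJ j) _)) (Alike-setVec (bJ j) _)
              (inj₂ (c , _)) → Alike-refl c
          ; gram = λ where
              (inj₁ (i , j)) (inj₁ (k , l)) → begin
                ⟨ vec (copies (x i) j) , vec (copies (x k) l) ⟩     ≡⟨ cong₂ ⟨_,_⟩ (vec-copies (x i) j) (vec-copies (x k) l) ⟩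
                ⟨ move (x i) (v j) , move (x k) (v l) ⟩             ≡⟨ ⟨move,move⟩ (x i) (x k) (v j) (v l) ⟩
                ⟨ P (v j) , P (v l) ⟩ + weight (v j) * (weight (v l) * ⟨ h (x i) , h (x k) ⟩)
                  ≡⟨ cong (λ z → ⟨ P (v j) , P (v l) ⟩ + weight (v j) * (weight (v l) * z)) (⟨h,h⟩-increasing inc-x inc-y i k) ⟩
                ⟨ P (v j) , P (v l) ⟩ + weight (v j) * (weight (v l) * ⟨ h (y i) , h (y k) ⟩)
                  ≡⟨ ⟨move,move⟩ (y i) (y k) (v j) (v l) ⟨
                ⟨ move (y i) (v j) , move (y k) (v l) ⟩             ≡⟨ cong₂ ⟨_,_⟩ (vec-copies (y i) j) (vec-copies (y k) l) ⟨
                ⟨ vec (copies (y i) j) , vec (copies (y k) l) ⟩     ∎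
              (inj₁ (i , j)) (inj₂ (c , Cc)) → trans (copies-C (x i) j Cc) (sym (copies-C (y i) j Cc))
              (inj₂ (c , Cc)) (inj₁ (i , j)) → trans (⟨⟩-sym _ _) (trans (copies-C (x i) j Cc)
                                                  (trans (sym (copies-C (y i) j Cc)) (⟨⟩-sym _ _)))
              (inj₂ _) (inj₂ _) → refl
          }
          where
          v : J → V
          v j = vec (bJ j)

        -- The copies meet all other requirements of dividing, so without dividing their union must
        -- be realized.
        copies-realized : ∀ {I : Set} (a : I → M) → ¬ Divides (tp a bJ) bJ C →
                          Σ[ a′ ∈ (I → M) ] ∀ n → Similar [ a , bJ ]′ [ a′ , copies n ]′
        copies-realized a ¬div = by-contradiction λ none → ¬div record
          { X = ℕ
          ; _<_ = ℕ._<_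
          ; isStrictTotalOrder = ℕ.<-isStrictTotalOrder
          ; infinite = ℕ-infinite
          ; small = ℕ≺Λ
          ; b′ = copies
          ; indiscernible = λ x y inc-x inc-y →
              (λ {e} → Similar⇒tp⊆ (copies-similar x y inc-x inc-y) {e}) ,
              (λ {e} → Similar⇒tp⊆ (copies-similar y x inc-y inc-x) {e})
          ; same-type = λ n → (λ {e} → Similar⇒tp⊆ (copies-same n) {e}) , (λ {e} → Similar⇒tp⊆ (Similar-sym (copies-same n)) {e})
          ; not-realized = λ (a′ , real) → none (a′ , λ n → tp⊆⇒Similar λ {e} → real n {e})
          }

      -- Only finitely many parameters d k from C fit into a type, so P b is
      -- controlled up to a partial sum of its expansion.
      module _ {A B : Subset} (b∈B : B b) (free : Free ℕ A B C) {a : M} (a∈A : A a) (N : ℕ) where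

        private
          Source : ℕ → Set
          Source k = d k ≡ 0ⱽ ⊎ ∃[ m ] C m × vec m ≡ d k

          param : ∀ {k} → Source k → M
          -- A zero entry of `d` need not come from `C`; `b` takes its place as a parameter that is
          -- available in any case.
          param (inj₁ _)       = b
          param (inj₂ (c , _)) = c

          param-movable : ∀ {k} (s : Source k) → Movable (param s)
          param-movable (inj₁ _)            = itself
          param-movable (inj₂ (_ , Cc , _)) = fixes Cc

          param∈ : ∀ {k} (s : Source k) → B (param s) ⊎ C (param s)
          param∈ (inj₁ _)            = inj₁ b∈B
          param∈ (inj₂ (_ , Cc , _)) = inj₂ Cc

          params : Fin (suc N) → M
          params zero    = b
          params (suc k) = param (member (toℕ k))

          params-movable : ∀ j → Movable (params j)
          params-movable zero    = itself
          params-movable (suc k) = param-movable (member (toℕ k))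

          params∈ : ∀ j → B (params j) ⊎ C (params j)
          params∈ zero    = inj₁ b∈B
          params∈ (suc k) = param∈ (member (toℕ k))

          realization : Σ[ a′ ∈ (Fin 1 → M) ] ∀ n → Similar [ (λ _ → a) , params ]′ [ a′ , copies params params-movable n ]′
          realization = copies-realized params params-movable {Fin 1} (λ _ → a)
            (free (Fin 1) (Fin (suc N)) Fin≺ℕ Fin≺ℕ (λ _ → a) params (λ _ → a∈A) params∈)

          a′ : V
          a′ = vec (proj₁ realization zero)

          real = proj₂ realization

          a′-move : ∀ n j → ⟨ a′ , move n (vec (params j)) ⟩ ≡ ⟨ vec a , vec (params j) ⟩
          a′-move n j = trans (cong ⟨ a′ ,_⟩ (sym (vec-copies params params-movable n j)))
                          (sym (gram (real n) (inj₁ zero) (inj₂ j)))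

          agree-at : ∀ {k} (s : Source k) → ⟨ a′ , move 0 (vec (param s)) ⟩ ≡ ⟨ vec a , vec (param s) ⟩ →
                     ⟨ a′ , d k ⟩ ≡ ⟨ vec a , d k ⟩
          agree-at (inj₁ dk≡0) _ = trans (cong ⟨ a′ ,_⟩ dk≡0) (trans (⟨,0⟩ _) (sym (trans (cong ⟨ vec a ,_⟩ dk≡0) (⟨,0⟩ _))))
          agree-at (inj₂ (c , Cc , c≡dk)) p = subst (λ v → ⟨ a′ , v ⟩ ≡ ⟨ vec a , v ⟩) c≡dk
                                                (trans (cong ⟨ a′ ,_⟩ (sym (move-C 0 Cc))) p)

          a′-param : ∀ (k : Fin N) → ⟨ a′ , d (toℕ k) ⟩ ≡ ⟨ vec a , d (toℕ k) ⟩
          a′-param k = agree-at (member (toℕ k)) (a′-move 0 (suc k))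

        -- A common realization for all copies has equal, hence zero, products with the `h n`; what
        -- is left of its product with a copy of `b` is its product with `P (vec b)`.
        partial-realization : Σ[ v ∈ V ] ‖ v ‖² ≡ ‖ vec a ‖² × ⟨ v , P (vec b) ⟩ ≡ ⟨ vec a , vec b ⟩ ×
                              (∀ {k} → k ℕ.< N → ⟨ d k , v ⟩ ≡ ⟨ d k , vec a ⟩)
        partial-realization = a′ , sym (gram (real 0) (inj₁ zero) (inj₁ zero)) , a′-Pb , λ {k} k<N →
            trans (⟨⟩-sym _ _) (trans (subst (λ l → ⟨ a′ , d l ⟩ ≡ ⟨ vec a , d l ⟩) (toℕ-fromℕ< k<N) (a′-param (fromℕ< k<N))) (⟨⟩-sym _ _))
          where
          r = ⟨ vec a , vec b ⟩
          split : ∀ n → ⟨ a′ , P (vec b) ⟩ + τ * ⟨ a′ , h n ⟩ ≡ r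
          split n = begin
            ⟨ a′ , P (vec b) ⟩ + τ * ⟨ a′ , h n ⟩                        ≡⟨ cong (λ t → ⟨ a′ , P (vec b) ⟩ + t * ⟨ a′ , h n ⟩) weight-b ⟨
            ⟨ a′ , P (vec b) ⟩ + weight (vec b) * ⟨ a′ , h n ⟩           ≡⟨ cong (⟨ a′ , P (vec b) ⟩ +_) (⟨•⟩ʳ (weight (vec b)) a′ (h n)) ⟨
            ⟨ a′ , P (vec b) ⟩ + ⟨ a′ , weight (vec b) • h n ⟩           ≡⟨ ⟨⊕⟩ʳ a′ (P (vec b)) (weight (vec b) • h n) ⟨
            ⟨ a′ , move n (vec b) ⟩                                      ≡⟨ a′-move n zero ⟩
            r                                                            ∎
          τ-constant : ∀ n → τ * ⟨ a′ , h n ⟩ ≡ r - ⟨ a′ , P (vec b) ⟩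
          τ-constant n = trans (solve 2 (λ p q → q := (p :+ q) :- p) refl ⟨ a′ , P (vec b) ⟩ (τ * ⟨ a′ , h n ⟩))
                           (cong (_- ⟨ a′ , P (vec b) ⟩) (split n))
          constant : ∀ n → ⟨ a′ , h n ⟩ ≡ ⟨ a′ , h 0 ⟩
          constant n = x-y≡0⇒x≡y (x*y≡0⇒y≡0 (root≢0 w≢0) (begin
            τ * (⟨ a′ , h n ⟩ - ⟨ a′ , h 0 ⟩)           ≡⟨ solve 3 (λ t p q → t :* (p :- q) := t :* p :- t :* q) refl τ ⟨ a′ , h n ⟩ ⟨ a′ , h 0 ⟩ ⟩
            τ * ⟨ a′ , h n ⟩ - τ * ⟨ a′ , h 0 ⟩         ≡⟨ cong₂ _-_ (τ-constant n) (τ-constant 0) ⟩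
            (r - ⟨ a′ , P (vec b) ⟩) - (r - ⟨ a′ , P (vec b) ⟩)   ≡⟨ -‿inverseʳ _ ⟩
            0#                                          ∎))
          a′-Pb : ⟨ a′ , P (vec b) ⟩ ≡ r
          a′-Pb = begin
            ⟨ a′ , P (vec b) ⟩                              ≡⟨ solve 2 (λ p t → p := p :+ t :* :0) refl ⟨ a′ , P (vec b) ⟩ τ ⟩
            ⟨ a′ , P (vec b) ⟩ + τ * 0#                     ≡⟨ cong (λ z → ⟨ a′ , P (vec b) ⟩ + τ * z) (constant-coefficients (Orthonormal.orthonormal₀ oh) a′ constant) ⟨
            ⟨ a′ , P (vec b) ⟩ + τ * ⟨ a′ , h 0 ⟩           ≡⟨ split 0 ⟩
            r                                               ∎

    module _ {A B : Subset} where

      -- A finite tuple gives agreement with `a` on finitely many `d k` only, so a realization `v`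
      -- is taken for each `ε`. The error is the product of `vec a ⊝ v` with the tail of the series
      -- of `P (vec b)`.
      free⇒orthogonal : Free ℕ A B C → Orthogonal A B
      free⇒orthogonal free {a} {b} a∈A b∈B with em {P = vec b ⊝ P (vec b) ≡ 0ⱽ}
      ... | yes w≡0 = trans (cong ⟨ vec a ,_⟩ (⊝≡0 w≡0)) (sym (P-self-adjoint (vec a) (vec b)))
      ... | no w≢0 = trans (x-y≡0⇒x≡y (small-multiples {K = 4# * ‖ vec a ‖²} (0≤-* 0≤4 (0≤‖‖² (vec a))) bound))
                       (sym (P-self-adjoint (vec a) (vec b)))
        where
        -- By the parallelogram identity, the difference of two vectors of equal norm has at most
        -- four times their squared norm.
        4# = 2# + 2#
        0≤4 : 0# ≤ 4#
        0≤4 = inj₁ (0<-+ 0<2 0<2)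
        x = ⟨ vec a , vec b ⟩ - ⟨ vec a , P (vec b) ⟩
        bound : ∀ ε → 0# < ε → x * x ≤ 4# * ‖ vec a ‖² * (ε * ε)
        bound ε 0<ε = subst (λ z → z * z ≤ 4# * ‖ vec a ‖² * (ε * ε)) y-x (≤-trans (Cauchy-Schwarz δ (S ⊝ P (vec b)))
            (≤-trans (*-monoʳ-≤ (0≤‖‖² δ) (inj₁ near)) (*-monoˡ-≤ (0≤-square ε) ‖δ‖²≤)))
          where
          limit = P-limit (vec b) ε 0<ε
          N = proj₁ limit
          S = partialSum gs gs (vec b) N
          near : ‖ S ⊝ P (vec b) ‖² < ε * ε
          near = proj₂ limit N ℕ.≤-refl
          pr = Dividing.partial-realization b w≢0 {A} {B} b∈B free {a} a∈A N
          v = proj₁ pr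
          δ = vec a ⊝ v
          -- `S` lies in the span of the first `N` entries of `d`, on which `v` and `a` agree.
          ⟨δ,S⟩ : ⟨ δ , S ⟩ ≡ 0#
          ⟨δ,S⟩ = trans (⟨⊝⟩ˡ (vec a) v S) (trans (cong (_- ⟨ v , S ⟩)
            (trans (⟨⟩-sym _ _) (trans (⟨partialSum⟩-cong N λ {k} k<N → agree-gs N (λ j<N → sym (proj₂ (proj₂ (proj₂ pr)) j<N)) k<N) (⟨⟩-sym _ _)))) (-‿inverseʳ _))
          y-x : ⟨ δ , S ⊝ P (vec b) ⟩ ≡ x
          y-x = begin
            ⟨ δ , S ⊝ P (vec b) ⟩                             ≡⟨ ⟨⊝⟩ʳ δ S (P (vec b)) ⟩
            ⟨ δ , S ⟩ - ⟨ δ , P (vec b) ⟩                     ≡⟨ cong₂ _-_ ⟨δ,S⟩ (⟨⊝⟩ˡ (vec a) v (P (vec b))) ⟩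
            0# - (⟨ vec a , P (vec b) ⟩ - ⟨ v , P (vec b) ⟩)  ≡⟨ cong (λ z → 0# - (⟨ vec a , P (vec b) ⟩ - z)) (proj₁ (proj₂ (proj₂ pr))) ⟩
            0# - (⟨ vec a , P (vec b) ⟩ - ⟨ vec a , vec b ⟩)  ≡⟨ solve 2 (λ p q → :0 :- (p :- q) := q :- p) refl ⟨ vec a , P (vec b) ⟩ ⟨ vec a , vec b ⟩ ⟩
            x                                                 ∎
          ‖δ‖²≤ : ‖ δ ‖² ≤ 4# * ‖ vec a ‖²
          ‖δ‖²≤ = 0≤‖‖² (vec a ⊕ v) since≤ (begin
            ‖ vec a ⊕ v ‖²                                                           ≡⟨ ‖⊕‖² (vec a) v ⟩
            ‖ vec a ‖² + 2# * ⟨ vec a , v ⟩ + ‖ v ‖²                                 ≡⟨ solve 3 (λ p q r → p :+ :2 :* q :+ r :=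
                                                                                          (p :+ p :+ (r :+ r)) :- (p :- :2 :* q :+ r)) refl ‖ vec a ‖² ⟨ vec a , v ⟩ ‖ v ‖² ⟩
            (‖ vec a ‖² + ‖ vec a ‖² + (‖ v ‖² + ‖ v ‖²)) - (‖ vec a ‖² - 2# * ⟨ vec a , v ⟩ + ‖ v ‖²)
              ≡⟨ cong₂ (λ p q → (‖ vec a ‖² + ‖ vec a ‖² + (p + p)) - q) (proj₁ (proj₂ pr)) (sym (‖⊝‖² (vec a) v)) ⟩
            (‖ vec a ‖² + ‖ vec a ‖² + (‖ vec a ‖² + ‖ vec a ‖²)) - ‖ δ ‖²           ≡⟨ solve 2 (λ p q → (p :+ p :+ (p :+ p)) :- q :=
                                                                                          (:2 :+ :2) :* p :- q) refl ‖ vec a ‖² ‖ δ ‖² ⟩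
            4# * ‖ vec a ‖² - ‖ δ ‖²                                                 ∎)

-- Simplicity and stability in the presence of an orthonormal sequence

module InfiniteDimensional (em : ∀ {ℓ} → ExcludedMiddle ℓ) (ext : ∀ {a b} → Extensionality a b)
                           (ℝ : CompleteOrderedField) (H : HilbertSpace ℝ)
                           (ℵ₁ : Set) (isℵ₁ : IsAleph₁ ℵ₁)
                           (homogeneous : Simplicity.StronglyHomogeneous (TwoSorted.structure H) (TwoSorted.Universe H) ℵ₁)
                           (ℕ≺Λ : card ℕ ≺ card (TwoSorted.Universe H))
                           {e : ℕ → HilbertSpace.V H} (oe : HilbertGeometry.Orthonormal em ext ℝ H e) where

  open Classical em ext
  open HilbertGeometry em ext ℝ H
  open QuantifierFreeTypes em ext ℝ H ℵ₁
  open CountableSets em ext ℝ H ℵ₁ isℵ₁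
  open Independence em ext ℝ H ℵ₁ isℵ₁ homogeneous ℕ≺Λ oe
  open Freeness em ext ℝ H ℵ₁ isℵ₁ homogeneous ℕ≺Λ oe
  open TwoSorted H
  open Simplicity structure Universe ℵ₁ renaming (∣_∣ to ∣_∣ˢ)
  open ≡-Reasoning

  ≺ℕ⇒≺ℵ₁ : ∀ {I : Set} → card I ≺ card ℕ → card I ≺ card ℵ₁
  ≺ℕ⇒≺ℵ₁ I≺ℕ = ≼ℕ⇒≺ℵ₁ (proj₁ I≺ℕ)

  Free-ℕ : ∀ {A B C} → Free ℵ₁ A B C → Free ℕ A B C
  Free-ℕ free I J I≺ℕ J≺ℕ = free I J (≺ℕ⇒≺ℵ₁ I≺ℕ) (≺ℕ⇒≺ℵ₁ J≺ℕ)

  finite-character : ∀ A B C → IsSet A → IsSet B → IsSet C → Free ℕ A B C → Free ℵ₁ A B C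
  finite-character A B C _ _ setC free =
    orthogonal⇒free enum-d {A} {B} (free⇒orthogonal enum-d {A} {B} free)
    where enum-d = proj₂ (enumerate (IsSet⇒countable setC))

  free-from-base : ∀ {D A} → ∣ A ∣ˢ ≼ card ℕ → Free ℵ₁ D A A
  free-from-base {D} {A} cA = orthogonal⇒free enum-d {D} {A} λ {a} {b} _ Ab → sym (⟨P,C⟩ enum-d (vec a) {b} Ab)
    where enum-d = proj₂ (enumerate cA)

  module _ {I : Set} (I≺ℵ₁ : card I ≺ card ℵ₁) (a : I → M) where

    module FreeCopy {B C : Subset} (B⊆C : ∀ {m} → B m → C m) (cB : ∣ B ∣ˢ ≼ card ℕ) (cC : ∣ C ∣ˢ ≼ card ℕ) where

      dB = proj₁ (enumerate cB)
      enum-B = proj₂ (enumerate cB)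
      dC = proj₁ (enumerate cC)
      enum-C = proj₂ (enumerate cC)
      open GramSchmidt dB using (P)

      seq = sequence (≺ℵ₁⇒≼ℕ I≺ℵ₁) (vec ∘ a)
      s = proj₁ seq
      ι = proj₁ (proj₂ seq)
      s-ι : ∀ i → s (ι i) ≡ vec (a i)
      s-ι = proj₂ (proj₂ seq)

      copy = independent-copy ℕ-infinite ℕ≺Λ dB s ℕ-infinite (λ _ → dC)

      c : I → V
      c i = proj₁ copy (ι i)

      gram-c : ∀ i k → ⟨ c i , c k ⟩ ≡ ⟨ vec (a i) , vec (a k) ⟩
      gram-c i k = trans (proj₁ (proj₂ copy) (ι i) (ι k)) (cong₂ ⟨_,_⟩ (s-ι i) (s-ι k))

      a′ : I → M
      a′ i = setVec (a i) (c i)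

      vec-a′ : ∀ i → vec (a′ i) ≡ c i
      vec-a′ i = vec-setVec (a i) (c i) (gram-c i i)

      ⟨a′,C⟩ : ∀ i {m} → C m → ⟨ vec (a′ i) , vec m ⟩ ≡ ⟨ P (vec (a i)) , vec m ⟩
      ⟨a′,C⟩ i {m} Cm = begin
        ⟨ vec (a′ i) , vec m ⟩      ≡⟨ cong ⟨_, vec m ⟩ (vec-a′ i) ⟩
        ⟨ c i , vec m ⟩             ≡⟨ subst (λ v → ⟨ c i , v ⟩ ≡ ⟨ P (s (ι i)) , v ⟩) (proj₂ (Enumerates.covers enum-C Cm))
                                         (proj₂ (proj₂ copy) (ι i) 0 (proj₁ (Enumerates.covers enum-C Cm))) ⟩
        ⟨ P (s (ι i)) , vec m ⟩     ≡⟨ cong (λ v → ⟨ P v , vec m ⟩) (s-ι i) ⟩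
        ⟨ P (vec (a i)) , vec m ⟩   ∎

      free : Free ℵ₁ (range a′) C B
      free = orthogonal⇒free enum-B {range a′} {C} λ { {b = m} (i , refl) Cm → orthogonal i {m} Cm }
        where
        orthogonal : ∀ i {m} → C m → ⟨ vec (a′ i) , vec m ⟩ ≡ ⟨ P (vec (a′ i)) , vec m ⟩
        -- `a′` and `a` have the same products with `B`, so their projections may be exchanged.
        orthogonal i {m} Cm = trans (⟨a′,C⟩ i {m} Cm) (P-agree enum-B (λ {b} Bb → begin
          ⟨ vec b , vec (a i) ⟩         ≡⟨ ⟨⟩-sym _ _ ⟩
          ⟨ vec (a i) , vec b ⟩         ≡⟨ ⟨P,C⟩ enum-B (vec (a i)) {b} Bb ⟨
          ⟨ P (vec (a i)) , vec b ⟩     ≡⟨ ⟨a′,C⟩ i {b} (B⊆C Bb) ⟨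
          ⟨ vec (a′ i) , vec b ⟩        ≡⟨ ⟨⟩-sym _ _ ⟩
          ⟨ vec b , vec (a′ i) ⟩        ∎) (vec m))

      -- Where `a` already has the products of its projection, the copy keeps them; this is how
      -- freeness of `a` from `A` over `B` enters.
      realizes : {A : Subset} → (∀ {m} → A m → C m) →
                 (∀ i {m} → A m → ⟨ vec (a i) , vec m ⟩ ≡ ⟨ P (vec (a i)) , vec m ⟩) →
                 Similar [ a , enum A ]′ [ a′ , enum A ]′
      realizes {A} A⊆C orth = record
        { alike = λ where
            (inj₁ i) → Alike-setVec (a i) (c i)
            (inj₂ (m , _)) → Alike-refl m
        ; gram = λ where
            (inj₁ i) (inj₁ k) → sym (trans (cong₂ ⟨_,_⟩ (vec-a′ i) (vec-a′ k)) (gram-c i k))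
            (inj₁ i) (inj₂ (m , Am)) → a-A i {m} Am
            (inj₂ (m , Am)) (inj₁ i) → trans (⟨⟩-sym _ _) (trans (a-A i {m} Am) (⟨⟩-sym _ _))
            (inj₂ _) (inj₂ _) → refl
        }
        where
        a-A : ∀ i {m} → A m → ⟨ vec (a i) , vec m ⟩ ≡ ⟨ vec (a′ i) , vec m ⟩
        a-A i {m} Am = trans (orth i {m} Am) (sym (⟨a′,C⟩ i {m} (A⊆C Am)))

    -- Free extensions of tp(c/A) over B agree: their products with B are
    -- those of the projection of c to A.
    module _ {A B : Subset} (A⊆B : ∀ {m} → A m → B m) (cA : ∣ A ∣ˢ ≼ card ℕ) where

      dA = proj₁ (enumerate cA)
      enum-A = proj₂ (enumerate cA)
      open GramSchmidt dA using (P)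

      ⟨free,B⟩ : {a′ : I → M} → Similar [ a , enum A ]′ [ a′ , enum A ]′ → Free ℵ₁ (range a′) B A →
                 ∀ i {m} → B m → ⟨ vec (a′ i) , vec m ⟩ ≡ ⟨ P (vec (a i)) , vec m ⟩
      ⟨free,B⟩ {a′} sim free i {m} Bm = trans
        (free⇒orthogonal enum-A {range a′} {B} (Free-ℕ {range a′} {B} {A} free) {a′ i} {m} (i , refl) Bm)
        (P-agree enum-A (λ {b} Ab → sym (gram sim (inj₂ (b , Ab)) (inj₁ i))) (vec m))

      free-extension-unique : {a′ a″ : I → M} →
        Similar [ a , enum A ]′ [ a′ , enum A ]′ → Free ℵ₁ (range a′) B A →
        Similar [ a , enum A ]′ [ a″ , enum A ]′ → Free ℵ₁ (range a″) B A →
        Similar [ a′ , enum B ]′ [ a″ , enum B ]′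
      free-extension-unique {a′} {a″} s′ f′ s″ f″ = record
        { alike = λ where
            (inj₁ i) → Alike-trans (Alike-sym (alike s′ (inj₁ i))) (alike s″ (inj₁ i))
            (inj₂ (m , _)) → Alike-refl m
        ; gram = λ where
            (inj₁ i) (inj₁ k) → trans (sym (gram s′ (inj₁ i) (inj₁ k))) (gram s″ (inj₁ i) (inj₁ k))
            (inj₁ i) (inj₂ (m , Bm)) → a-B i {m} Bm
            (inj₂ (m , Bm)) (inj₁ i) → trans (⟨⟩-sym _ _) (trans (a-B i {m} Bm) (⟨⟩-sym _ _))
            (inj₂ _) (inj₂ _) → refl
        }
        where
        a-B : ∀ i {m} → B m → ⟨ vec (a′ i) , vec m ⟩ ≡ ⟨ vec (a″ i) , vec m ⟩
        a-B i {m} Bm = trans (⟨free,B⟩ {a′} s′ f′ i {m} Bm) (sym (⟨free,B⟩ {a″} s″ f″ i {m} Bm))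

  -- Sets are countable here, so `A` may serve as its own base.
  local-character : ∀ (I : Set) → card I ≺ card ℵ₁ → (a : I → M) → ∀ A → IsSet A →
                    Σ[ B ∈ Subset ] (∀ {m} → B m → A m) × (∣ B ∣ˢ ≺ card ℵ₁) × Free ℵ₁ (range a) A B
  local-character I I≺ℵ₁ a A setA = A , (λ p → p) , setA , free-from-base {range a} (IsSet⇒countable setA)

  extension-bases : ∀ A → IsSet A → IsExtensionBase ℵ₁ A
  extension-bases A setA I I≺ℵ₁ a large B B⊆A free C setC A⊆C =
    FC.a′ , (λ {e} → Similar⇒tp⊆ (FC.realizes {A} A⊆C λ i {m} Am → orth {a i} {m} (i , refl) Am) {e}) , FC.free
    where
    cB = ⊆-countable {B} {A} B⊆A (IsSet⇒countable setA)
    module FC = FreeCopy I≺ℵ₁ a {B} {C} (λ p → A⊆C (B⊆A p)) cB (IsSet⇒countable setC)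
    orth : Orthogonal FC.enum-B (range a) A
    orth = free⇒orthogonal FC.enum-B {range a} {A} (Free-ℕ {range a} {A} {B} free)

  simple : IsSimple ℵ₁
  simple = record
    { finite-character = finite-character
    ; local-character  = local-character
    ; extension-bases  = extension-bases
    }

  simplyStable : IsSimplyStable ℵ₁
  simplyStable = simple , ℕ , ℕ-infinite , ℕ≺Λ , λ I I≺ℵ₁ A B _ A⊆B cB c →
    record
      -- Injectivity of a constant map is the uniqueness of the free extension; `A` is countable as
      -- a subset of `B`.
      { to        = λ _ → 0
      ; cong      = λ _ → refl
      ; injective = λ { {_ , a′ , r′ , f′ , (p⊆ , ⊆p)} {_ , a″ , r″ , f″ , (q⊆ , ⊆q)} _ →
          let sim = free-extension-unique I≺ℵ₁ c {A} {B} A⊆B (⊆-countable {A} {B} A⊆B cB)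
                      {a′} {a″} (tp⊆⇒Similar λ {e} → r′ {e}) f′ (tp⊆⇒Similar λ {e} → r″ {e}) f″
          in (λ {e} x → ⊆q (Similar⇒tp⊆ sim {e} (p⊆ x))) , (λ {e} x → ⊆p (Similar⇒tp⊆ (Similar-sym sim) {e} (q⊆ x))) }
      }

-- An orthonormal sequence from condition (P)

module OrthonormalSequence (em : ∀ {ℓ} → ExcludedMiddle ℓ) (ext : ∀ {a b} → Extensionality a b)
                         (ℝ : CompleteOrderedField) (H : HilbertSpace ℝ)
                         (ℵ₁ : Set) (isℵ₁ : IsAleph₁ ℵ₁)
                         (π′ : Set) (P : Simplicity.ConditionP (TwoSorted.structure H) (TwoSorted.Universe H) ℵ₁ π′) where

  open Classical em ext
  open CompleteOrderedField ℝ renaming (_≤_ to _≤ᴿ_)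
  open RealField em ext ℝ
  open HilbertGeometry em ext ℝ H
  open QuantifierFreeTypes em ext ℝ H ℵ₁
  open CountableSets em ext ℝ H ℵ₁ isℵ₁
  open TwoSorted H
  open Simplicity structure Universe ℵ₁ renaming (∣_∣ to ∣_∣ˢ)
  open ≡-Reasoning

  module Circle {p q : V} (‖p‖² : ‖ p ‖² ≡ 1#) (‖q‖² : ‖ q ‖² ≡ 1#) (p⊥q : ⟨ p , q ⟩ ≡ 0#) where

    den : Carrier → Carrier
    den t = 1# + t * t

    0<den : ∀ t → 0# < den t
    0<den t = 0<-+ʳ 0<1 (0≤-square t)

    scale : Carrier → Carrier
    scale t = den t ⁻¹

    den*scale : ∀ t → den t * scale t ≡ 1#
    den*scale t = ⁻¹-inverse (den t) (0<⇒≢0 (0<den t))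

    -- The rational parametrization of the unit circle by the tangent of half the angle; nonnegative
    -- parameters trace a half circle without one end.
    X Y : Carrier → Carrier
    X t = scale t * (1# - t * t)
    Y t = scale t * (2# * t)

    point : Carrier → V
    point t = X t • p ⊕ Y t • q

    ⟨point⟩ : ∀ s t → ⟨ point s , point t ⟩ ≡ X s * X t + Y s * Y t
    ⟨point⟩ s t = begin
      ⟨ X s • p ⊕ Y s • q , point t ⟩                  ≡⟨ ⟨⟩-+ (X s • p) (Y s • q) (point t) ⟩
      ⟨ X s • p , point t ⟩ + ⟨ Y s • q , point t ⟩    ≡⟨ cong₂ _+_ (trans (⟨⟩-• (X s) p (point t)) (cong (X s *_) (expand p)))
                                                                      (trans (⟨⟩-• (Y s) q (point t)) (cong (Y s *_) (expand q))) ⟩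
      X s * (X t * ‖ p ‖² + Y t * ⟨ p , q ⟩) + Y s * (X t * ⟨ q , p ⟩ + Y t * ‖ q ‖²)
        ≡⟨ cong₂ (λ a b → X s * a + Y s * b)
             (cong₂ (λ a b → X t * a + Y t * b) ‖p‖² p⊥q)
             (cong₂ (λ a b → X t * a + Y t * b) (trans (⟨⟩-sym q p) p⊥q) ‖q‖²) ⟩
      X s * (X t * 1# + Y t * 0#) + Y s * (X t * 0# + Y t * 1#)
        ≡⟨ solve 4 (λ a b c d → a :* (c :* :1 :+ d :* :0) :+ b :* (c :* :0 :+ d :* :1) := a :* c :+ b :* d)
             refl (X s) (Y s) (X t) (Y t) ⟩
      X s * X t + Y s * Y t                            ∎
      where
      expand : ∀ v → ⟨ v , point t ⟩ ≡ X t * ⟨ v , p ⟩ + Y t * ⟨ v , q ⟩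
      expand v = trans (⟨⊕⟩ʳ v (X t • p) (Y t • q)) (cong₂ _+_ (⟨•⟩ʳ (X t) v p) (⟨•⟩ʳ (Y t) v q))

    -- Half the squared distance between two points of the unit circle.
    gap : Carrier → Carrier → Carrier
    gap s t = 1# - ⟨ point s , point t ⟩

    gap-sym : ∀ s t → gap s t ≡ gap t s
    gap-sym s t = cong (λ z → 1# - z) (⟨⟩-sym (point s) (point t))

    gap-formula : ∀ s t → gap s t * (den s * den t) ≡ 2# * ((t - s) * (t - s))
    gap-formula s t = begin
      gap s t * (den s * den t)                            ≡⟨ cong (λ z → (1# - z) * (den s * den t)) (⟨point⟩ s t) ⟩
      (1# - (X s * X t + Y s * Y t)) * (den s * den t)     ≡⟨ solve 6 (λ ds dt i j s t →
          (:1 :- (i :* (:1 :- s :* s) :* (j :* (:1 :- t :* t)) :+ i :* (:2 :* s) :* (j :* (:2 :* t)))) :* (ds :* dt) :=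
          ds :* dt :- (ds :* i) :* (dt :* j) :* ((:1 :- s :* s) :* (:1 :- t :* t) :+ :2 :* s :* (:2 :* t)))
          refl (den s) (den t) (scale s) (scale t) s t ⟩
      den s * den t - den s * scale s * (den t * scale t) * ((1# - s * s) * (1# - t * t) + 2# * s * (2# * t))
        ≡⟨ cong₂ (λ a b → den s * den t - a * b * ((1# - s * s) * (1# - t * t) + 2# * s * (2# * t))) (den*scale s) (den*scale t) ⟩
      den s * den t - 1# * 1# * ((1# - s * s) * (1# - t * t) + 2# * s * (2# * t))
        ≡⟨ solve 2 (λ s t → (:1 :+ s :* s) :* (:1 :+ t :* t) :- :1 :* :1 :* ((:1 :- s :* s) :* (:1 :- t :* t) :+ :2 :* s :* (:2 :* t)) :=
             :2 :* ((t :- s) :* (t :- s))) refl s t ⟩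
      2# * ((t - s) * (t - s))                             ∎

    ‖point‖² : ∀ t → ‖ point t ‖² ≡ 1#
    ‖point‖² t = sym (x-y≡0⇒x≡y (x*y≡0⇒y≡0 (0<⇒≢0 (*-pos (0<den t) (0<den t))) (begin
      den t * den t * gap t t           ≡⟨ *-comm _ _ ⟩
      gap t t * (den t * den t)         ≡⟨ gap-formula t t ⟩
      2# * ((t - t) * (t - t))          ≡⟨ solve 1 (λ t → :2 :* ((t :- t) :* (t :- t)) := :0) refl t ⟩
      0#                                ∎)))

    -- On the arc 0 ≤ t the chord from r shrinks as its other end
    -- approaches r, so no three points are equidistant.
    no-equidistant-sorted : ∀ {s t r} → 0# < t + s → s < t → t < r → gap s r ≢ gap t r
    no-equidistant-sorted {s} {t} {r} 0<t+s s<t t<r eq = <-asym chord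
      -- With equal gaps, `den s < den t` would make `r - s` smaller than `r - t` once denominators
      -- are cleared, but `s` is farther from `r`.
      (subst₂ _<_ (gap-eq s) (gap-eq t) (*-monoʳ-< (*-pos 0<k (0<den r)) den<))
      where
      k = gap s r
      gap-eq : ∀ t → k * den r * den t ≡ k * (den t * den r)
      gap-eq t = solve 3 (λ k a b → k :* a :* b := k :* (b :* a)) refl k (den r) (den t)
      den< : den s < den t
      den< = *-pos (<⇒0<- s<t) 0<t+s since
        solve 2 (λ s t → (t :- s) :* (t :+ s) := (:1 :+ t :* t) :- (:1 :+ s :* s)) refl s t
      s<r = <-trans s<t t<r
      0<k : 0# < k
      0<k = *-cancel-pos (*-pos (0<den s) (0<den r)) (subst (0# <_)
        (trans (sym (gap-formula s r)) (*-comm _ _)) (*-pos 0<2 (*-pos (<⇒0<- s<r) (<⇒0<- s<r))))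
      chord : k * (den t * den r) < k * (den s * den r)
      chord = subst₂ _<_ (sym (trans (cong (_* (den t * den r)) eq) (gap-formula t r))) (sym (gap-formula s r))
        (*-monoʳ-< 0<2 (square-mono-< (inj₁ (<⇒0<- t<r)) (<⇒0<- s<t since
          solve 3 (λ s t r → t :- s := (r :- s) :- (r :- t)) refl s t r)))

    no-equidistant : ∀ {s t r κ} → 0# ≤ᴿ s → 0# ≤ᴿ t → 0# ≤ᴿ r → s ≢ t → s ≢ r → t ≢ r →
                     gap s t ≡ κ → gap s r ≡ κ → gap t r ≢ κ
    no-equidistant {s} {t} {r} {κ} 0≤s 0≤t 0≤r s≢t s≢r t≢r st sr tr =
      by-order (compare s t) (compare s r) (compare t r)
      where
      ts = trans (gap-sym t s) st
      rs = trans (gap-sym r s) sr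
      rt = trans (gap-sym r t) tr
      sorted : ∀ {a b c} → 0# ≤ᴿ a → a < b → b < c → gap a c ≡ κ → gap b c ≢ κ
      sorted 0≤a a<b b<c e e′ = no-equidistant-sorted
        (0<-+ʳ (≤-<-trans 0≤a a<b) 0≤a) a<b b<c (trans e (sym e′))
      by-order : Tri (s < t) (s ≡ t) (t < s) → Tri (s < r) (s ≡ r) (r < s) → Tri (t < r) (t ≡ r) (r < t) → ⊥
      by-order (tri≈ _ e _) _ _ = s≢t e
      by-order _ (tri≈ _ e _) _ = s≢r e
      by-order _ _ (tri≈ _ e _) = t≢r e
      by-order (tri< s<t _ _) _ (tri< t<r _ _) = sorted 0≤s s<t t<r sr tr
      by-order (tri< s<t _ _) (tri< s<r _ _) (tri> _ _ r<t) = sorted 0≤s s<r r<t st rt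
      by-order (tri< s<t _ _) (tri> _ _ r<s) (tri> _ _ _) = sorted 0≤r r<s s<t rt st
      by-order (tri> _ _ t<s) (tri< s<r _ _) _ = sorted 0≤t t<s s<r tr sr
      by-order (tri> _ _ t<s) (tri> _ _ r<s) (tri< t<r _ _) = sorted 0≤t t<r r<s ts rs
      by-order (tri> _ _ t<s) (tri> _ _ r<s) (tri> _ _ r<t) = sorted 0≤r r<t t<s rs ts

    module _ (d : ℕ → V) (separating : ∀ v → (∀ n → ⟨ v , d n ⟩ ≡ 0#) → v ≡ 0ⱽ) where

      -- Coordinate zero tells the sorts apart; for a vector the others are its products with the
      -- separating family.
      coordinates : M → ℕ → Carrier
      coordinates (SV , v) zero          = 0#
      coordinates (SF , r) zero          = 1#
      coordinates (SV , v) (suc n)       = ⟨ v , d n ⟩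
      coordinates (SF , r) (suc n)       = r

      coordinates-injective : Injective _≡_ _≡_ coordinates
      coordinates-injective {SV , v} {SV , w} e = cong (SV ,_) (⊝≡0 (separating (v ⊝ w) λ n →
        trans (⟨⊝⟩ˡ v w (d n)) (trans (cong (_- ⟨ w , d n ⟩) (cong-app e (suc n))) (-‿inverseʳ _))))
      coordinates-injective {SV , v} {SF , r} e = contradiction (cong-app e 0) 0≢1
      coordinates-injective {SF , r} {SV , v} e = contradiction (sym (cong-app e 0)) 0≢1
      coordinates-injective {SF , r} {SF , s} e = cong (SF ,_) (cong-app e 1)

      π′≼M : card π′ ≼ card M
      π′≼M = proj₁ (proj₂ P)

      code : π′ → Carrier
      code x = cantor (encode (coordinates (Injection.to π′≼M x)))

      code-injective : Injective _≡_ _≡_ code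
      code-injective e = Injection.injective π′≼M (coordinates-injective (encode-injective (cantor-injective e)))

      0≤code : ∀ x → 0# ≤ᴿ code x
      0≤code x = 0≤cantor (encode (coordinates (Injection.to π′≼M x)))

      open WellOrdering π′

      ∅ : Subset
      ∅ _ = ⊥

      a : π′ → Fin 1 → M
      a x _ = SV , point (code x)

      a-similar : ∀ x → Similar [ (λ _ → SV , p) , enum ∅ ]′ [ a x , enum ∅ ]′
      a-similar x = record
        { alike = λ { (inj₁ _) → vectors ; (inj₂ (_ , ())) }
        ; gram  = λ { (inj₁ _) (inj₁ _) → trans ‖p‖² (sym (‖point‖² (code x)))
                    ; (inj₁ _) (inj₂ (_ , ())) ; (inj₂ (_ , ())) _ }
        }

      -- All points have the norm of `p`, so they realize one type over the empty set; they are
      -- indexed by `π′` itself under a well-ordering.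
      extracted = proj₂ (proj₂ P) (Fin 1) (≼ℕ⇒≺ℵ₁ Fin≼ℕ) ∅ (≼ℕ⇒≺ℵ₁ ∅-countable) (λ _ → SV , p)
                    π′ _≺ʷ_ ≺ʷ-isStrictTotalOrder ≺ʷ-wellFounded (mk↣ λ e → e) a
                    (λ x {e} → Similar⇒tp⊆ (a-similar x) {e})

      b : ℕ → Fin 1 → M
      b = proj₁ extracted

      place : Fin 3 → π′
      -- The argument 2 asks for a subsequence of three terms.
      place = proj₁ (proj₂ (proj₂ extracted) 2)

      place-increasing : Increasing _≺ʷ_ place
      place-increasing = proj₁ (proj₂ (proj₂ (proj₂ extracted) 2))

      t : Fin 3 → Carrier
      t i = code (place i)

      t-distinct : ∀ {i j} → i <ᶠ j → t i ≢ t j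
      t-distinct i<j e = ≺ʷ-irrefl (code-injective e) (place-increasing i<j)

      realized : Similar [ concat {3} (λ k → b (toℕ k)) , enum ∅ ]′ [ concat (a ∘ place) , enum ∅ ]′
      realized = tp⊆⇒Similar λ {e} → proj₂ (proj₂ (proj₂ (proj₂ extracted) 2)) {e}

      ⟨point,point⟩ : ∀ i j → ⟨ point (t i) , point (t j) ⟩ ≡ ⟨ vec (b (toℕ i) zero) , vec (b (toℕ j) zero) ⟩
      ⟨point,point⟩ i j = sym (gram realized (inj₁ (i , zero)) (inj₁ (j , zero)))

      two : ℕ → ℕ → Fin 2 → ℕ
      two m n zero    = m
      two m n (suc _) = n

      two-increasing : ∀ {m n} → m ℕ.< n → Increasing ℕ._<_ (two m n)
      two-increasing m<n {zero} {suc zero} _ = m<n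
      two-increasing m<n {suc zero} {suc zero} (s≤s ())

      indiscernible : ∀ {m n k l} → m ℕ.< n → k ℕ.< l →
                      ⟨ vec (b m zero) , vec (b n zero) ⟩ ≡ ⟨ vec (b k zero) , vec (b l zero) ⟩
      indiscernible {m} {n} {k} {l} m<n k<l = gram
        (tp⊆⇒Similar {a = concat (b ∘ two m n)} {concat (b ∘ two k l)} {enum ∅} {enum ∅} λ {e} →
          proj₁ (proj₁ (proj₂ extracted) (two m n) (two k l) (two-increasing m<n) (two-increasing k<l)) {e})
        (inj₁ (zero , zero)) (inj₁ (suc zero , zero))

      equal-gaps : ∀ i j k l → i <ᶠ j → k <ᶠ l → gap (t i) (t j) ≡ gap (t k) (t l)
      equal-gaps i j k l i<j k<l = cong (λ z → 1# - z)
        (trans (⟨point,point⟩ i j) (trans (indiscernible i<j k<l) (sym (⟨point,point⟩ k l))))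

      not-separable : ⊥
      not-separable = no-equidistant (0≤code (place i₀)) (0≤code (place i₁)) (0≤code (place i₂))
          (t-distinct {i₀} {i₁} 0<1ᶠ) (t-distinct {i₀} {i₂} 0<2ᶠ) (t-distinct {i₁} {i₂} 1<2ᶠ)
          refl (equal-gaps i₀ i₂ i₀ i₁ 0<2ᶠ 0<1ᶠ) (equal-gaps i₁ i₂ i₀ i₁ 1<2ᶠ 0<1ᶠ)
        where
        i₀ i₁ i₂ : Fin 3
        i₀ = zero
        i₁ = suc zero
        i₂ = suc (suc zero)
        0<1ᶠ : i₀ <ᶠ i₁
        0<1ᶠ = s≤s z≤n
        0<2ᶠ : i₀ <ᶠ i₂
        0<2ᶠ = s≤s z≤n
        1<2ᶠ : i₁ <ᶠ i₂
        1<2ᶠ = s≤s (s≤s z≤n)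

    -- `d` is not separating, so its orthogonal complement contains a nonzero vector to normalise.
    unit-⊥ : (d : ℕ → V) → ∃[ v ] ‖ v ‖² ≡ 1# × ∀ n → ⟨ v , d n ⟩ ≡ 0#
    unit-⊥ d = by-contradiction λ none → not-separable d λ v v⊥d → by-contradiction λ v≢0 →
      none (normalise v , ‖normalise‖² v≢0 , λ n → trans (⟨⟩-sym _ _)
        (⟨⟩≡0⇒normalise (d n) v (trans (⟨⟩-sym _ _) (v⊥d n))))

    -- The vectors constructed so far, latest first and padded with zeros, so that `unit-⊥` can be
    -- applied to an infinite sequence at each stage.
    earlier : ℕ → ℕ → V
    earlier zero    _       = 0ⱽ
    earlier (suc n) zero    = proj₁ (unit-⊥ (earlier n))
    earlier (suc n) (suc k) = earlier n k

    next : ℕ → V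
    next n = proj₁ (unit-⊥ (earlier n))

    next-earlier : ∀ {m n} → m ℕ.< n → ∃[ k ] earlier n k ≡ next m
    next-earlier {m} {suc n} (s≤s m≤n) = go (ℕ.m≤n⇒m<n∨m≡n m≤n)
      where
      go : m ℕ.< n ⊎ m ≡ n → ∃[ k ] earlier (suc n) k ≡ next m
      go (inj₁ m<n)  = let k , e = next-earlier m<n in suc k , e
      go (inj₂ refl) = zero , refl

    next-⊥ : ∀ {m n} → m ℕ.< n → ⟨ next n , next m ⟩ ≡ 0#
    next-⊥ {m} {n} m<n = let k , e = next-earlier m<n in
      subst (λ v → ⟨ next n , v ⟩ ≡ 0#) e (proj₂ (proj₂ (unit-⊥ (earlier n))) k)

    orthonormal-sequence : Orthonormal next
    orthonormal-sequence = record
      { ortho = λ {i} {j} i≢j → case ℕ.<-cmp i j of λ where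
          (tri< i<j _ _) → trans (⟨⟩-sym _ _) (next-⊥ i<j)
          (tri≈ _ e _)   → contradiction e i≢j
          (tri> _ _ j<i) → next-⊥ j<i
      ; unit = λ i → proj₁ (proj₂ (unit-⊥ (earlier i)))
      }

-- Dimension at most one

module DimensionAtMostOne (em : ∀ {ℓ} → ExcludedMiddle ℓ) (ext : ∀ {a b} → Extensionality a b)
                          (ℝ : CompleteOrderedField) (H : HilbertSpace ℝ)
                          (ℵ₁ : Set) (isℵ₁ : IsAleph₁ ℵ₁)
                          (ℕ≺Λ : card ℕ ≺ card (TwoSorted.Universe H))
                          (thin : ∀ u v → HilbertSpace.⟨_,_⟩ H u v ≡ CompleteOrderedField.0# ℝ →
                                  u ≡ HilbertSpace.0ⱽ H ⊎ v ≡ HilbertSpace.0ⱽ H) where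

  open Classical em ext
  open CompleteOrderedField ℝ hiding (_≤_; isStrictTotalOrder)
  open RealField em ext ℝ
  open HilbertGeometry em ext ℝ H
  open QuantifierFreeTypes em ext ℝ H ℵ₁
  open CountableSets em ext ℝ H ℵ₁ isℵ₁
  open TwoSorted H
  open Simplicity structure Universe ℵ₁ renaming (∣_∣ to ∣_∣ˢ)

  -- Equal norms make `v ⊝ w` and `v ⊕ w` orthogonal, so one of them vanishes.
  ±-equal : ∀ {v w} → ‖ v ‖² ≡ ‖ w ‖² → v ≡ w ⊎ v ≡ ⊖ w
  ±-equal {v} {w} e with thin (v ⊝ w) (v ⊕ w) (begin
      ⟨ v ⊝ w , v ⊕ w ⟩                                        ≡⟨ ⟨⊝⟩ˡ v w (v ⊕ w) ⟩
      ⟨ v , v ⊕ w ⟩ - ⟨ w , v ⊕ w ⟩                            ≡⟨ cong₂ _-_ (⟨⊕⟩ʳ v v w) (⟨⊕⟩ʳ w v w) ⟩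
      (‖ v ‖² + ⟨ v , w ⟩) - (⟨ w , v ⟩ + ‖ w ‖²)              ≡⟨ cong₂ (λ x y → (x + ⟨ v , w ⟩) - (y + ‖ w ‖²)) e (⟨⟩-sym w v) ⟩
      (‖ w ‖² + ⟨ v , w ⟩) - (⟨ v , w ⟩ + ‖ w ‖²)              ≡⟨ solve 2 (λ x y → (x :+ y) :- (y :+ x) := :0) refl ‖ w ‖² ⟨ v , w ⟩ ⟩
      0#                                                       ∎)
    where open ≡-Reasoning
  ... | inj₁ v⊝w≡0 = inj₁ (⊝≡0 v⊝w≡0)
  ... | inj₂ v⊕w≡0 = inj₂ (V-ext λ z → begin
      ⟨ v , z ⟩                           ≡⟨ solve 2 (λ x y → x := (x :+ y) :- y) refl ⟨ v , z ⟩ ⟨ w , z ⟩ ⟩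
      (⟨ v , z ⟩ + ⟨ w , z ⟩) - ⟨ w , z ⟩ ≡⟨ cong (_- ⟨ w , z ⟩) (trans (sym (⟨⟩-+ v w z)) (trans (cong ⟨_, z ⟩ v⊕w≡0) (⟨0,⟩ z))) ⟩
      0# - ⟨ w , z ⟩                      ≡⟨ +-identityˡ _ ⟩
      - ⟨ w , z ⟩                         ≡⟨ ⟨⊖⟩ˡ w z ⟨
      ⟨ ⊖ w , z ⟩                         ∎)
    where open ≡-Reasoning

  ⊖0 : ∀ {v} → v ≡ 0ⱽ → ⊖ v ≡ 0ⱽ
  ⊖0 refl = ‖‖²≡0 (trans (⟨⊖,⊖⟩ 0ⱽ 0ⱽ) (⟨0,⟩ 0ⱽ))

  negate : M → M
  negate m = setVec m (⊖ vec m)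

  vec-negate : ∀ m → vec (negate m) ≡ ⊖ vec m
  vec-negate m = vec-setVec m (⊖ vec m) (⟨⊖,⊖⟩ (vec m) (vec m))

  Similar-negate : ∀ {K : Set} (x : K → M) → Similar x (negate ∘ x)
  Similar-negate x = record
    { alike = λ k → Alike-setVec (x k) _
    ; gram  = λ k l → sym (trans (cong₂ ⟨_,_⟩ (vec-negate (x k)) (vec-negate (x l))) (⟨⊖,⊖⟩ _ _))
    }

  Similar-≗ : ∀ {K : Set} {x y : K → M} → (∀ k → y k ≡ x k) → Similar x y
  Similar-≗ {x = x} e = record
    { alike = λ k → subst (Alike (x k)) (sym (e k)) (Alike-refl (x k))
    ; gram  = λ k l → cong₂ (λ m n → ⟨ vec m , vec n ⟩) (sym (e k)) (sym (e l))
    }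

  module _ {K : Set} {x y : K → M} (sim : Similar x y) where

    -- The sign is uniform: two entries with different signs would be orthogonal, and then one of
    -- them is zero and has both signs.
    Similar⇒± : (∀ k → y k ≡ x k) ⊎ (∀ k → y k ≡ negate (x k))
    Similar⇒± with em {P = ∀ k → y k ≡ x k}
    ... | yes same = inj₁ same
    ... | no ¬same = inj₂ λ k → sym (Alike-≡ (Alike-trans (Alike-sym (Alike-setVec (x k) _)) (alike sim k))
                                       (trans (vec-negate (x k)) (sym (opposite k (±-equal (sym (gram sim k k)))))))
      where
      open ≡-Reasoning
      witness : ∃[ k ] ¬ y k ≡ x k
      witness = ¬∀⇒∃¬ ¬same
      k₀ = proj₁ witness
      vec≢ : vec (y k₀) ≢ vec (x k₀)
      vec≢ e = proj₂ witness (sym (Alike-≡ (alike sim k₀) (sym e)))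
      opposite₀ : vec (y k₀) ≡ ⊖ vec (x k₀)
      opposite₀ = [ (λ e → contradiction e vec≢) , (λ e → e) ]′ (±-equal (sym (gram sim k₀ k₀)))
      opposite : ∀ k → vec (y k) ≡ vec (x k) ⊎ vec (y k) ≡ ⊖ vec (x k) → vec (y k) ≡ ⊖ vec (x k)
      opposite k (inj₂ e) = e
      opposite k (inj₁ e) = [ (λ u≡0 → trans e (trans u≡0 (sym (⊖0 u≡0)))) ,
                              (λ v≡0 → contradiction (trans opposite₀ (trans (⊖0 v≡0) (sym v≡0))) vec≢) ]′
                            (thin u v (x*y≡0⇒y≡0 (0<⇒≢0 0<2) (begin
          2# * ⟨ u , v ⟩                    ≡⟨ solve 1 (λ r → :2 :* r := r :- (:- r)) refl ⟨ u , v ⟩ ⟩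
          ⟨ u , v ⟩ - (- ⟨ u , v ⟩)         ≡⟨ cong (_- (- ⟨ u , v ⟩)) (trans (gram sim k k₀) (cong₂ ⟨_,_⟩ e opposite₀)) ⟩
          ⟨ u , ⊖ v ⟩ - (- ⟨ u , v ⟩)       ≡⟨ cong (_- (- ⟨ u , v ⟩)) (⟨⊖⟩ʳ u v) ⟩
          - ⟨ u , v ⟩ - (- ⟨ u , v ⟩)       ≡⟨ -‿inverseʳ _ ⟩
          0#                                ∎)))
        where
        u = vec (x k)
        v = vec (x k₀)

  module _ {I J : Set} (a : I → M) (b : J → M) (C : Subset) where

    -- Each term of the sequence is `b` or its negative. If one sign suffices, `a` or its negative
    -- realizes the union; a genuine mixture contradicts indiscernibility, which fixes the products
    -- of distinct terms.
    nothing-divides : ¬ Divides (tp a b) b C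
    nothing-divides D = by-cases em em
      where
      open Divides D renaming (_<_ to _<ᴰ_)
      open IsStrictTotalOrder isStrictTotalOrder renaming (compare to compareᴰ) using ()

      Same Opposite : X → Set
      Same x     = ∀ j → b′ x j ≡ b j
      Opposite x = ∀ j → b′ x j ≡ negate (b j)

      sign-of : ∀ x → Same x ⊎ Opposite x
      sign-of x = Similar⇒± record { alike = alike s ∘ inj₁ ; gram = λ j l → gram s (inj₁ j) (inj₁ l) }
        where
        s : Similar [ b , enum C ]′ [ b′ x , enum C ]′
        s = tp⊆⇒Similar λ {e} → proj₂ (same-type x) {e}

      module _ {x y} (x-opposite : Opposite x) (y-same : Same y) (j : J) (bj≢ : b j ≢ negate (b j)) where

        β : V
        β = vec (b j)

        G : X → X → Carrier
        G u v = ⟨ vec (b′ u j) , vec (b′ v j) ⟩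

        two : X → X → Fin 2 → X
        two u v zero    = u
        two u v (suc _) = v

        two-increasing : ∀ {u v} → u <ᴰ v → Increasing _<ᴰ_ (two u v)
        two-increasing u<v {zero} {suc zero} _ = u<v
        two-increasing u<v {suc zero} {suc zero} (s≤s ())

        G-increasing : ∀ {u v u′ v′} → u <ᴰ v → u′ <ᴰ v′ → G u v ≡ G u′ v′
        G-increasing {u} {v} {u′} {v′} p q = gram
          (tp⊆⇒Similar {a = concat (b′ ∘ two u v)} {concat (b′ ∘ two u′ v′)} {enum C} {enum C} λ {e} →
            proj₁ (indiscernible (two u v) (two u′ v′) (two-increasing p) (two-increasing q)) {e})
          (inj₁ (zero , j)) (inj₁ (suc zero , j))

        G-sym : ∀ u v → G u v ≡ G v u
        G-sym u v = ⟨⟩-sym _ _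

        ordered : ∀ {u v} → u ≢ v → ∃[ u′ ] ∃[ v′ ] (u′ <ᴰ v′) × G u v ≡ G u′ v′
        ordered {u} {v} u≢v = go (compareᴰ u v)
          where
          go : Tri (u <ᴰ v) (u ≡ v) (v <ᴰ u) → ∃[ u′ ] ∃[ v′ ] (u′ <ᴰ v′) × G u v ≡ G u′ v′
          go (tri< u<v _ _) = u , v , u<v , refl
          go (tri≈ _ e _)   = contradiction e u≢v
          go (tri> _ _ v<u) = v , u , v<u , G-sym u v

        G-constant : ∀ {u v u′ v′} → u ≢ v → u′ ≢ v′ → G u v ≡ G u′ v′
        G-constant p q =
          let _ , _ , lt , e = ordered p
              _ , _ , lt′ , e′ = ordered q
          in trans e (trans (G-increasing lt lt′) (sym e′))

        G-same : ∀ {u v} → Same u → Same v → G u v ≡ ‖ β ‖²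
        G-same p q = cong₂ (λ m n → ⟨ vec m , vec n ⟩) (p j) (q j)

        G-opposite : ∀ {u v} → Opposite u → Opposite v → G u v ≡ ‖ β ‖²
        G-opposite p q = trans (cong₂ (λ m n → ⟨ vec m , vec n ⟩) (p j) (q j)) (sym (gram (Similar-negate b) j j))

        point : ℕ → X
        point = Injection.to infinite

        point≢ : ∀ {m n} → m ≢ n → point m ≢ point n
        point≢ m≢n e = m≢n (Injection.injective infinite e)

        -- Of three terms two share a sign. A pair of opposite signs has the negative product, which
        -- indiscernibility equates with this one.
        pigeonhole : ∃[ u ] ∃[ v ] u ≢ v × G u v ≡ ‖ β ‖²
        pigeonhole = go (sign-of (point 0)) (sign-of (point 1)) (sign-of (point 2))
          where
          go : Same (point 0) ⊎ Opposite (point 0) → Same (point 1) ⊎ Opposite (point 1) →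
               Same (point 2) ⊎ Opposite (point 2) → ∃[ u ] ∃[ v ] u ≢ v × G u v ≡ ‖ β ‖²
          go (inj₁ p) (inj₁ q) _ = point 0 , point 1 , point≢ (λ ()) , G-same p q
          go (inj₂ p) (inj₂ q) _ = point 0 , point 1 , point≢ (λ ()) , G-opposite p q
          go (inj₁ p) (inj₂ _) (inj₁ r) = point 0 , point 2 , point≢ (λ ()) , G-same p r
          go (inj₁ _) (inj₂ q) (inj₂ r) = point 1 , point 2 , point≢ (λ ()) , G-opposite q r
          go (inj₂ _) (inj₁ q) (inj₁ r) = point 1 , point 2 , point≢ (λ ()) , G-same q r
          go (inj₂ p) (inj₁ _) (inj₂ r) = point 0 , point 2 , point≢ (λ ()) , G-opposite p r

        mixed-signs : ⊥
        mixed-signs = bj≢ (Alike-≡ (Alike-setVec (b j) _) (trans β≡0 (trans (sym (⊖0 β≡0)) (sym (vec-negate (b j))))))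
          where
          open ≡-Reasoning
          x≢y : x ≢ y
          x≢y refl = bj≢ (trans (sym (y-same j)) (x-opposite j))
          -‖β‖² : G x y ≡ - ‖ β ‖²
          -‖β‖² = trans (cong₂ (λ m n → ⟨ vec m , vec n ⟩) (x-opposite j) (y-same j))
                    (trans (cong ⟨_, β ⟩ (vec-negate (b j))) (⟨⊖⟩ˡ β β))
          ‖β‖²≡ : ‖ β ‖² ≡ - ‖ β ‖²
          ‖β‖²≡ = let _ , _ , u≢v , e = pigeonhole in trans (sym e) (trans (G-constant u≢v x≢y) -‖β‖²)
          β≡0 : β ≡ 0ⱽ
          β≡0 = ‖‖²≡0 (x*y≡0⇒y≡0 (0<⇒≢0 0<2) (begin
            2# * ‖ β ‖²                  ≡⟨ solve 1 (λ r → :2 :* r := r :- (:- r)) refl ‖ β ‖² ⟩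
            ‖ β ‖² - (- ‖ β ‖²)          ≡⟨ cong (λ r → ‖ β ‖² - r) ‖β‖²≡ ⟨
            ‖ β ‖² - ‖ β ‖²              ≡⟨ -‿inverseʳ _ ⟩
            0#                           ∎))

      extend : ∀ {a′ : I → M} {c : J → M} (f : M → M) → (∀ {K : Set} (x : K → M) → Similar x (f ∘ x)) →
               (∀ j → c j ≡ f (b j)) → Similar [ a , b ]′ [ f ∘ a , c ]′
      extend f f-sim e = Similar-trans (f-sim [ a , b ]′) (Similar-≗ λ where
        (inj₁ i) → refl
        (inj₂ j) → e j)

      by-cases : Dec (∀ x → Same x) → Dec (∀ x → Opposite x) → ⊥
      by-cases (yes same) _ = not-realized (a , λ x {e} →
        Similar⇒tp⊆ (extend {a} {b′ x} (λ m → m) (λ _ → Similar-≗ λ _ → refl) (same x)) {e})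
      by-cases (no _) (yes opposite) = not-realized (negate ∘ a , λ x {e} →
        Similar⇒tp⊆ (extend {negate ∘ a} {b′ x} negate Similar-negate (opposite x)) {e})
      by-cases (no ¬same) (no ¬opposite) = mix (¬∀⇒∃¬ ¬same) (¬∀⇒∃¬ ¬opposite)
        where
        mix : ∃[ x ] ¬ Same x → ∃[ y ] ¬ Opposite y → ⊥
        mix (x , ¬s) (y , ¬o) with sign-of x | sign-of y
        ... | inj₁ s | _ = ¬s s
        ... | _ | inj₂ o = ¬o o
        ... | inj₂ o | inj₁ s = let j , bj≢ = ¬∀⇒∃¬ λ e → ¬o λ j → trans (s j) (e j) in
                                mixed-signs o s j bj≢

  free : ∀ {A B C} → Free ℵ₁ A B C
  free {C = C} I J _ _ a b _ _ = nothing-divides a b C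

  simple : IsSimple ℵ₁
  simple = record
    { finite-character = λ A B C _ _ _ _ → free {A} {B} {C}
    ; local-character  = λ I _ a A _ → (λ _ → ⊥) , (λ ()) , ≼ℕ⇒≺ℵ₁ ∅-countable , free {range a} {A} {λ _ → ⊥}
    ; extension-bases  = λ A _ I _ a _ B _ _ C _ _ → a , (λ p → p) , free {range a} {C} {B}
    }

  module _ {I : Set} (A B : Subset) (c : I → M) where

    extension-± : ∀ {q} → IsFreeExtension ℵ₁ A (tp/ c A) B q →
                  (∀ {e} → q e ⇔ tp/ c B e) ⊎ (∀ {e} → q e ⇔ tp/ (negate ∘ c) B e)
    extension-± {q} (a′ , r , _ , (q⊆ , ⊆q)) = go (Similar⇒± record { alike = alike s ∘ inj₁ ; gram = λ i k → gram s (inj₁ i) (inj₁ k) })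
      where
      s : Similar [ c , enum A ]′ [ a′ , enum A ]′
      s = tp⊆⇒Similar λ {e} → r {e}
      same : ∀ {a″} → (∀ i → a′ i ≡ a″ i) → ∀ {e} → q e ⇔ tp/ a″ B e
      same {a″} eq {e} = mk⇔ (λ x → Similar⇒tp⊆ sim {e} (q⊆ x)) (λ x → ⊆q (Similar⇒tp⊆ (Similar-sym sim) {e} x))
        where
        sim : Similar [ a′ , enum B ]′ [ a″ , enum B ]′
        sim = Similar-≗ λ where
          (inj₁ i) → sym (eq i)
          (inj₂ _) → refl
      go : (∀ i → a′ i ≡ c i) ⊎ (∀ i → a′ i ≡ negate (c i)) →
           (∀ {e} → q e ⇔ tp/ c B e) ⊎ (∀ {e} → q e ⇔ tp/ (negate ∘ c) B e)
      go (inj₁ eq) = inj₁ λ {e} → same eq {e}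
      go (inj₂ eq) = inj₂ λ {e} → same eq {e}

    Unmoved : TypeOver I B → Set₁
    Unmoved q = ∀ {e} → q e ⇔ tp/ c B e

    -- Two values suffice: an extension is the type of `c` itself or, failing that, the type of its
    -- negative.
    index-of : ∀ {P : Set₁} → Dec P → ℕ
    index-of (yes _) = 0
    index-of (no _)  = 1

    module _ {q r : TypeOver I B} where

      index-cong : (Unmoved q → Unmoved r) → (Unmoved r → Unmoved q) →
                   (p : Dec (Unmoved q)) (p′ : Dec (Unmoved r)) → index-of p ≡ index-of p′
      index-cong f g (yes _)  (yes _)  = refl
      index-cong f g (yes u)  (no ¬u)  = contradiction (λ {e} → f u {e}) ¬u
      index-cong f g (no ¬u)  (yes u)  = contradiction (λ {e} → g u {e}) ¬u
      index-cong f g (no _)   (no _)   = refl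

      index-injective : IsFreeExtension ℵ₁ A (tp/ c A) B q → IsFreeExtension ℵ₁ A (tp/ c A) B r →
                        (p : Dec (Unmoved q)) (p′ : Dec (Unmoved r)) → index-of p ≡ index-of p′ → ∀ {e} → q e ⇔ r e
      index-injective _ _ (yes u) (yes u′) _ = mk⇔ (Equivalence.from u′ ∘ Equivalence.to u) (Equivalence.from u ∘ Equivalence.to u′)
      index-injective x y (no ¬u) (no ¬u′) _ with extension-± x | extension-± y
      ... | inj₁ u | _ = contradiction (λ {e} → u {e}) ¬u
      ... | inj₂ _ | inj₁ u = contradiction (λ {e} → u {e}) ¬u′
      ... | inj₂ u | inj₂ u′ = mk⇔ (Equivalence.from u′ ∘ Equivalence.to u) (Equivalence.from u ∘ Equivalence.to u′)

  simplyStable : IsSimplyStable ℵ₁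
  simplyStable = simple , ℕ , mk↣ (λ e → e) , ℕ≺Λ , λ I _ A B _ _ _ c →
    record
      { to        = λ (q , _) → index-of A B c (em {P = Unmoved A B c q})
      ; cong      = λ { {q , _} {r , _} (q⊆r , r⊆q) → index-cong A B c {q} {r}
          (λ u → mk⇔ (Equivalence.to u ∘ r⊆q) (q⊆r ∘ Equivalence.from u))
          (λ u → mk⇔ (Equivalence.to u ∘ q⊆r) (r⊆q ∘ Equivalence.from u)) em em }
      ; injective = λ { {q , x} {r , y} e →
          let q⇔r = λ {z} → index-injective A B c {q} {r} x y em em e {z}
          in (λ {z} → Equivalence.to (q⇔r {z})) , (λ {z} → Equivalence.from (q⇔r {z})) }
      }

-- The case distinction on the dimension

open TwoSorted using (structure; Universe)
open Simplicity using (StronglyHomogeneous; ConditionP; IsSimplyStable)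

theorem6p3 : (∀ {ℓ} → ExcludedMiddle ℓ) →
    (∀ {a b} → Extensionality a b) →
    (ℝ : CompleteOrderedField) (H : HilbertSpace ℝ) →
    (ℵ₁ : Set) → IsAleph₁ ℵ₁ →
    StronglyHomogeneous (structure H) (Universe H) ℵ₁ →
    (Σ[ π′ ∈ Set ] card ℕ ≺ card π′ × ConditionP (structure H) (Universe H) ℵ₁ π′) →
    IsSimplyStable (structure H) (Universe H) ℵ₁ ℵ₁
theorem6p3 em ext ℝ H ℵ₁ isℵ₁ homogeneous (π′ , (ℕ≼π′ , π′⋠ℕ) , P) = by-dimension em
  where
  open CompleteOrderedField ℝ using (0#)
  open HilbertGeometry em ext ℝ H

  -- λ is uncountable because the uncountable `π′` embeds into it.
  ℕ≺Λ : card ℕ ≺ card (Universe H)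
  ℕ≺Λ = ≼-trans ℕ≼π′ (proj₁ (proj₂ P)) , λ i → π′⋠ℕ (≼-trans (proj₁ (proj₂ P)) i)

  Plane : Set
  Plane = ∃[ u ] ∃[ v ] ⟨ u , v ⟩ ≡ 0# × u ≢ 0ⱽ × v ≢ 0ⱽ

  by-dimension : Dec Plane → IsSimplyStable (structure H) (Universe H) ℵ₁ ℵ₁
  by-dimension (yes (u , v , u⊥v , u≢0 , v≢0)) =
    InfiniteDimensional.simplyStable em ext ℝ H ℵ₁ isℵ₁ homogeneous ℕ≺Λ orthonormal-sequence
    where
    open OrthonormalSequence em ext ℝ H ℵ₁ isℵ₁ π′ P
    -- Normalising keeps the two vectors orthogonal; they span the plane of the circle.
    open Circle {normalise u} {normalise v} (‖normalise‖² u≢0) (‖normalise‖² v≢0)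
      (⟨⟩≡0⇒normalise (normalise u) v (trans (⟨⟩-sym _ _)
        (⟨⟩≡0⇒normalise v u (trans (⟨⟩-sym v u) u⊥v))))
  by-dimension (no thin) = DimensionAtMostOne.simplyStable em ext ℝ H ℵ₁ isℵ₁ ℕ≺Λ λ u v u⊥v →
    [ inj₁ , (λ u≢0 → [ inj₂ , (λ v≢0 → contradiction (u , v , u⊥v , u≢0 , v≢0) thin) ]′ (decide v)) ]′ (decide u)
    where
    decide : ∀ v → v ≡ 0ⱽ ⊎ v ≢ 0ⱽ
    decide v with em {P = v ≡ 0ⱽ}
    ... | yes v≡0 = inj₁ v≡0
    ... | no v≢0  = inj₂ v≢0
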